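{- Let $c\ge 1$ be the fixed constant used in the choice of the prime $p$ below. The algorithm "Algorithm 3" described in the context is a bidirectional two-pass randomized streaming algorithm for $\mathrm{DYCK}(2)$ with space $O((\log n)^2)$ and time $\mathrm{polylog}(n)$. If the input belongs to $\mathrm{DYCK}(2)$ then the algorithm accepts it with probability $1$; otherwise it rejects it with probability at least $1-n^{ -c}$.
   Context: $\mathrm{DYCK}(2)$ is the language of well-parenthesized words with two types of parentheses: over the alphabet $\{a,\bar a,b,\bar b\}$ it is the smallest language $L$ satisfying $L=\{\epsilon\}\cup aL\bar aL\cup bL\bar bL$. It also denotes the problem of deciding whether a given word is in the language. The letters $a,b$ are called upsteps and $\bar a,\bar b$ downsteps. A $k$-pass streaming algorithm with space $s(n)$ and time $t(n)$ is an algorithm such that for every input stream $x=x_1x_2\ldots x_n$: (1) it performs $k$ sequential passes on $x$, the letters arriving one by one; (2) it maintains a memory space of size $s(n)$ while reading $x$; (3) it has running time at most $t(n)$ per letter $x_i$; (4) it has preprocessing and postprocessing time $t(n)$. It is bidirectional if it is allowed to access the input in the reverse order after reaching the end of the input; then $k$ is the total number of passes in either direction. The length $n$ is given to the algorithm in advance. Hashing. For a word $x$, $\mathrm{height}(x)=|x|_a+|x|_b-|x|_{\bar a}-|x|_{\bar b}$, where $|x|_l$ is the number of occurrences of the letter $l$; $x[1,i]$ is the prefix of length $i$. Let $p$ be a prime with $n^{1+c}\le p<2n^{1+c}$, and let $\alpha$ be a uniformly random integer in $[0,p-1]$; probabilities are over $\alpha$. For a letter at position $i$ of $x$, $\mathrm{hash}(x_i)=\alpha^{\mathrm{height}(x[1,i])}\bmod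 p$ if $x_i=a$, $\mathrm{hash}(x_i)=-\alpha^{\mathrm{height}(x[1,i-1])}\bmod p$ if $x_i=\bar a$, and $\mathrm{hash}(x_i)=0$ otherwise. For a subsequence $v=x_{i_1}x_{i_2}\ldots x_{i_m}$, $\mathrm{hash}(v)=\sum_j\mathrm{hash}(x_{i_j})$ (modulo $p$). The algorithm keeps track of the height of the word read so far. $\mathrm{first}(v)$ is the index of the first letter of $v$. Algorithm 3. Let $k=\lceil\log n\rceil$ (base $2$). Without loss of generality $n=2^k$: an input of odd length is not in $\mathrm{DYCK}(2)$, and an input of even length is padded by appending a word $(a\bar a)^i$ of suitable length (the number of added letters being stored). For each $i$, an $i$-block is a substring $x[(q-1)2^i+1,\,q2^i]$ with $1\le q\le n/2^i$. - Start with an empty stack $S$. - Run the procedure $\mathrm{Block}(k,S)$ below, reading the stream from left to right. - If $S$ is not empty, reject. - Run $\mathrm{Block}(k,S)$ reading the stream from right to left; in this pass the letters $\bar a,\bar b$ are interpreted as $a,b$ respectively, and vice versa. - If no rejection occurred, accept. Procedure $\mathrm{Block}(i,S)$, which reads the $2^i$ letters of an $i$-block $B_i$. Each stack item is a triple $(h,\ell,f)$ encoding a subsequence $v$ of the stream, with $h=\mathrm{hash}(v)$, $\ell=\mathrm{height}(v)$, $f=\mathrm{first}(v)$. - Do the following twice. If $i>1$, call $\mathrm{Block}(i-1,S)$. If $i=1$, read one letter $y$. If $y$ is an upstep, push $(\mathrm{hash}(y),1,\mathrm{first}(y))$ on $S$. If $y$ is a downstep: pop $(h,\ell,f)$ from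 $S$ (reject if $S$ is empty), set $\ell\leftarrow\ell-1$ and $h\leftarrow h+\mathrm{hash}(y)$, push $(h,\ell,f)$ on $S$; then, if $\ell=0$, check that $h=0$ (reject if not), and pop and discard this item. - Afterwards, if $S$ has at the top two items whose first letters are in $B_i$, pop $(h_2,\ell_2,f_2)$, then pop $(h_1,\ell_1,f_1)$, and push $(h_1+h_2,\ell_1+\ell_2,f_1)$ on $S$. -}

module Defs where

open import Data.Bool.Base as Bool using (Bool; true; false; not; _∧_; _∨_)
open import Data.Fin.Base using (Fin)
open import Data.Integer.Base using (+_)
open import Data.List.Base as List using (List; []; _∷_; _++_; length; filterᵇ; upTo; reverse)
open import Data.Nat.Base as ℕ
  using (ℕ; zero; suc; _+_; _*_; _∸_; _^_; _⊔_; _≤_; _<_; _≥_; _≤ᵇ_; _≡ᵇ_; NonZero)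
open import Data.Nat.ListAction using (sum)
open import Data.Nat.Logarithm using (⌊log₂_⌋; ⌈log₂_⌉)
open import Data.Product.Base using (∃-syntax; _×_; _,_)
open import Data.Rational.Base as ℚ using (ℚ; 1ℚ)
open import Data.Sum.Base using (_⊎_)
open import Data.Vec.Base as Vec using (Vec; []; _∷_; lookup; _[_]≔_; replicate)
open import Function.Bundles using (_⇔_)
open import Relation.Binary.PropositionalEquality.Core using (_≡_)
open import Relation.Nullary using (¬_)
import Algebra.Definitions.RawSemiring ℚ.+-*-rawSemiring as ℚ^

-- Dedekind reals, used for the exponent c.
record ℝ : Set₁ where
  field
    lower upper     : ℚ → Set
    lower-inhabited : ∃[ q ] lower q
    upper-inhabited : ∃[ q ] upper q
    lower-rounded   : ∀ q → lower q ⇔ (∃[ r ] (q ℚ.< r × lower r))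
    upper-rounded   : ∀ q → upper q ⇔ (∃[ r ] (r ℚ.< q × upper r))
    disjoint        : ∀ q → ¬ (lower q × upper q)
    located         : ∀ q r → q ℚ.< r → lower q ⊎ upper r

1≤_ : ℝ → Set
1≤ c = ∀ q → q ℚ.< 1ℚ → ℝ.lower c q

_/_<ᴿ_ : (u v : ℕ) .{{_ : NonZero v}} → ℝ → Set
u / v <ᴿ c = ℝ.lower c (+ u ℚ./ v)

-- Comparisons with n^(1+c) and n^(-c) for n ≥ 1 and c > 0.  The power n^c is
-- the supremum of n^(u/v) over the fractions 0 ≤ u/v < c, and each comparison
-- with n^(u/v) is raised to the v-th power.

_^[1+_]≤_ : ℕ → ℝ → ℕ → Set
n ^[1+ c ]≤ m = ∀ u v .{{_ : NonZero v}} → u / v <ᴿ c → n ^ (v + u) ≤ m ^ v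

_<2*_^[1+_] : ℕ → ℕ → ℝ → Set
m <2* n ^[1+ c ] =
  ∃[ u ] ∃[ v ] (u / suc v <ᴿ c × m ^ suc v < 2 ^ suc v * n ^ (suc v + u))

-- The rational on the left is meant to be nonnegative.
_≤_^-_ : ℚ → ℕ → ℝ → Set
q ≤ n ^- c =
  ∀ u v .{{_ : NonZero v}} → u / v <ᴿ c → (q ℚ^.^ v) ℚ.* (+ (n ^ u) ℚ./ 1) ℚ.≤ 1ℚ

_∈O_ : (ℕ → ℕ) → (ℕ → ℕ) → Set
f ∈O g = ∃[ C ] ∃[ n₀ ] ∀ n → n ≥ n₀ → f n ≤ C * g n

Polylog : (ℕ → ℕ) → Set
Polylog f = ∃[ d ] f ∈O (λ n → ⌊log₂ n ⌋ ^ d)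

-- Probability of an event for a uniformly random integer in [0, p-1].
Pr : (p : ℕ) .{{_ : NonZero p}} → (ℕ → Bool) → ℚ
Pr p E = + length (filterᵇ E (upTo p)) ℚ./ p

data Letter : Set where
  a ā b b̄ : Letter

data Dyck₂ : List Letter → Set where
  ε    : Dyck₂ []
  aLāL : ∀ {u v} → Dyck₂ u → Dyck₂ v → Dyck₂ (a ∷ u ++ ā ∷ v)
  bLb̄L : ∀ {u v} → Dyck₂ u → Dyck₂ v → Dyck₂ (b ∷ u ++ b̄ ∷ v)

bits : ℕ → ℕ
bits x = suc ⌊log₂ x ⌋

data Direction : Set where
  →ᵈ ←ᵈ : Direction

-- Programs over a fixed finite number of registers and stacks of natural
-- numbers, with logarithmic (bit) cost.
module Machine (registers stacks : ℕ) {Σ : Set} (code : Σ → ℕ) where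

  Reg Stack : Set
  Reg   = Fin registers
  Stack = Fin stacks

  infixl 9 _:*_ _:/_ _:%_
  infixl 8 _:+_ _:-_
  infix  7 _:≤_ _:≡_
  infixr 6 _:∧_
  infixr 5 _:∨_

  data Expr : Set where
    lit                           : ℕ → Expr
    var                           : Reg → Expr
    _:+_ _:-_ _:*_ _:/_ _:%_ : Expr → Expr → Expr
    ⌈lg_⌉                         : Expr → Expr

  data Test : Set where
    _:≤_ _:≡_ : Expr → Expr → Test
    _:∧_ _:∨_ : Test → Test → Test
    nonEmpty  : Stack → Test

  infix  4 _≔_
  infixr 4 if_then_else_
  infixr 3 _⨾_

  -- rec e step base is a procedure with one numeric argument, called on the
  -- value of e: on 0 it runs base, and on i + 1 it runs step, where self calls
  -- the procedure on i.
  data Cmd : Set where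
    skip reject   : Cmd
    _≔_           : Reg → Expr → Cmd
    push          : Stack → Expr → Cmd
    pop           : Stack → Reg → Cmd
    read          : Reg → Cmd
    _⨾_           : Cmd → Cmd → Cmd
    if_then_else_ : Test → Cmd → Cmd → Cmd
    repeat        : Expr → Cmd → Cmd
    rec           : Expr → Cmd → Cmd → Cmd
    self          : Cmd

  record Config : Set where
    constructor config
    field
      regs  : Vec ℕ registers
      stks  : Vec (List ℕ) stacks
      input : List Σ   -- unread part of the stream in the current pass
      clock : ℕ        -- time since the last letter was read
      time  : ℕ        -- maximum of clock so far
      space : ℕ        -- maximum number of bits in use so far

  open Config public

  sizeOf : Config → ℕ
  sizeOf σ = Vec.sum (Vec.map bits (regs σ))
           + Vec.sum (Vec.map (λ xs → sum (List.map bits xs)) (stks σ))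

  -- k is the number of bits of the control stack, and w the time of a step.
  -- Within the step at most w further bits are written, which covers both
  -- intermediate values and the result.
  charge : (k w : ℕ) → Config → Config
  charge k w σ = record σ
    { clock = clock σ + w
    ; time  = time σ ⊔ (clock σ + w)
    ; space = space σ ⊔ (k + (sizeOf σ + w))
    }

  -- Division by zero yields 0.
  _/₀_ _%₀_ : ℕ → ℕ → ℕ
  x /₀ zero  = 0
  x /₀ suc y = x ℕ./ suc y
  x %₀ zero  = 0
  x %₀ suc y = x ℕ.% suc y

  eval : Expr → Config → ℕ
  eval (lit x)  σ = x
  eval (var x)  σ = lookup (regs σ) x
  eval (e :+ f) σ = eval e σ + eval f σ
  eval (e :- f) σ = eval e σ ∸ eval f σ
  eval (e :* f) σ = eval e σ * eval f σ
  eval (e :/ f) σ = eval e σ /₀ eval f σ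
  eval (e :% f) σ = eval e σ %₀ eval f σ
  eval ⌈lg e ⌉  σ = ⌈log₂ eval e σ ⌉

  isNonEmpty : List ℕ → Bool
  isNonEmpty []      = false
  isNonEmpty (_ ∷ _) = true

  test : Test → Config → Bool
  test (e :≤ f)     σ = eval e σ ≤ᵇ eval f σ
  test (e :≡ f)     σ = eval e σ ≡ᵇ eval f σ
  test (s :∧ t)     σ = test s σ ∧ test t σ
  test (s :∨ t)     σ = test s σ ∨ test t σ
  test (nonEmpty K) σ = isNonEmpty (lookup (stks σ) K)

  -- Schoolbook cost: the product of the operand lengths for every operation.
  opCost : Expr → Expr → Config → ℕ
  opCost e f σ = bits (eval e σ) * bits (eval f σ)

  cost : Expr → Config → ℕ
  cost (lit x)  σ = bits x
  cost (var x)  σ = bits (lookup (regs σ) x)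
  cost (e :+ f) σ = cost e σ + cost f σ + opCost e f σ
  cost (e :- f) σ = cost e σ + cost f σ + opCost e f σ
  cost (e :* f) σ = cost e σ + cost f σ + opCost e f σ
  cost (e :/ f) σ = cost e σ + cost f σ + opCost e f σ
  cost (e :% f) σ = cost e σ + cost f σ + opCost e f σ
  cost ⌈lg e ⌉  σ = cost e σ + bits (eval e σ)

  testCost : Test → Config → ℕ
  testCost (e :≤ f)     σ = cost e σ + cost f σ + opCost e f σ
  testCost (e :≡ f)     σ = cost e σ + cost f σ + opCost e f σ
  testCost (s :∧ t)     σ = testCost s σ + testCost t σ
  testCost (s :∨ t)     σ = testCost s σ + testCost t σ
  testCost (nonEmpty K) σ = 1

  setReg : Reg → ℕ → Config → Config
  setReg x v σ = record σ { regs = regs σ [ x ]≔ v }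

  setStack : Stack → List ℕ → Config → Config
  setStack K xs σ = record σ { stks = stks σ [ K ]≔ xs }

  data Outcome : Set where
    running rejected : Config → Outcome

  final : Outcome → Config
  final (running σ)  = σ
  final (rejected σ) = σ

  isRunning : Outcome → Bool
  isRunning (running _)  = true
  isRunning (rejected _) = false

  infixl 1 _>>=_
  _>>=_ : Outcome → (Config → Outcome) → Outcome
  running σ  >>= f = f σ
  rejected σ >>= f = rejected σ

  popped : Stack → Reg → List ℕ → ℕ → Config → Config
  popped K x []       k σ = charge k 1 σ
  popped K x (v ∷ vs) k σ = setStack K vs (setReg x v (charge k (bits v) σ))

  consumed : Reg → List Σ → ℕ → Config → Config
  consumed x []      k σ = charge k 1 σ
  consumed x (y ∷ w) k σ =
    setReg x (code y) (charge k (bits (code y)) (record σ { input = w ; clock = 0 }))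

  -- The ℕ argument is the current size of the control stack in bits.
  Behaviour : Set
  Behaviour = ℕ → Config → Outcome

  iterateFor : ℕ → ℕ → Behaviour → Behaviour
  iterateFor w zero    c k σ = running σ
  iterateFor w (suc i) c k σ = c k (charge k w σ) >>= iterateFor w i c k

  recurse : ℕ → ℕ → (Behaviour → Behaviour) → Behaviour → Behaviour
  recurse w zero    step base k σ = base k σ
  recurse w (suc i) step base k σ = step (λ k′ → recurse w i step base (k′ + w)) k σ

  -- An active loop holds its counter on the control stack, and an active call
  -- its argument and (constant-size) return address.
  exec : Cmd → Behaviour → Behaviour
  exec skip                 self′ k σ = running σ
  exec reject               self′ k σ = rejected (charge k 1 σ)
  exec (x ≔ e)              self′ k σ = running (setReg x (eval e σ) (charge k (cost e σ) σ))
  exec (push K e)           self′ k σ =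
    running (setStack K (eval e σ ∷ lookup (stks σ) K) (charge k (cost e σ) σ))
  exec (pop K x)            self′ k σ = running (popped K x (lookup (stks σ) K) k σ)
  exec (read x)             self′ k σ = running (consumed x (input σ) k σ)
  exec (c ⨾ d)              self′ k σ = exec c self′ k σ >>= exec d self′ k
  exec (if t then c else d) self′ k σ =
    (Bool.if test t σ then exec c self′ k else exec d self′ k) (charge k (testCost t σ) σ)
  exec (repeat e c)         self′ k σ =
    iterateFor w (eval e σ) (exec c self′) (k + w) (charge k (cost e σ) σ)
    where w = bits (eval e σ)
  exec (rec e step base)    self′ k σ =
    recurse w (eval e σ) (exec step) (exec base self′) (k + w) (charge k (cost e σ) σ)
    where w = bits (eval e σ)
  exec self                 self′ k σ = self′ k (charge k 1 σ)

  -- A bidirectional algorithm with the given number of passes.  What precedes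
  -- the first read is its preprocessing and what follows the last read its
  -- postprocessing; time bounds these as well as the time per letter.
  BidirectionalAlgorithm : ℕ → Set
  BidirectionalAlgorithm passes = Vec (Direction × Cmd) passes

  stream : Direction → List Σ → List Σ
  stream →ᵈ x = x
  stream ←ᵈ x = reverse x

  noSelf : Behaviour
  noSelf k σ = running σ

  runPasses : ∀ {passes} → BidirectionalAlgorithm passes → List Σ → Config → Outcome
  runPasses []            x σ = running σ
  runPasses ((d , c) ∷ A) x σ =
    exec c noSelf 0 (record σ { input = stream d x }) >>= runPasses A x

  run : ∀ {passes} → BidirectionalAlgorithm passes → Vec ℕ registers → List Σ → Outcome
  run A initial x = runPasses A x (config initial (replicate stacks []) [] 0 0 0)

letterCode : Letter → ℕ
letterCode a = 0
letterCode ā = 1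
letterCode b = 2
letterCode b̄ = 3

module Algorithm₃ where

  open import Data.Fin using (#_)

  open Machine 21 2 letterCode public

  n p α k N t H lo hi s m y h ℓ f h′ ℓ′ f′ r sq e : Reg
  n  = # 0    -- length of the input
  p  = # 1
  α  = # 2
  k  = # 3    -- ⌈log n⌉
  N  = # 4    -- 2^k, the padded length
  t  = # 5    -- number of letters of the padded word passed in this pass; so in
              --   the second pass positions and blocks are in reversed order
  H  = # 6    -- height of the word read so far in this pass
  lo = # 7    -- in reading order, the letters at lo+1, …, hi are those of the
  hi = # 8    --   input, and the other ones are padding
  s  = # 9    -- the current block consists of positions s+1, …, s+m
  m  = # 10
  y  = # 11   -- current letter
  h  = # 12
  ℓ  = # 13
  f  = # 14
  h′ = # 15
  ℓ′ = # 16
  f′ = # 17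
  r  = # 18
  sq = # 19
  e  = # 20

  S frames : Stack
  S      = # 0
  frames = # 1  -- saved values of the local variable s

  infixr 4 when_do′_
  when_do′_ : Test → Cmd → Cmd
  when c do′ d = if c then d else skip

  _is_ : Reg → Letter → Test
  x is l = var x :≡ lit (letterCode l)

  pushItem : Expr → Expr → Expr → Cmd
  pushItem h ℓ f = push S f ⨾ push S ℓ ⨾ push S h

  popItem : Reg → Reg → Reg → Cmd
  popItem h ℓ f = pop S h ⨾ pop S ℓ ⨾ pop S f

  -- r ≔ α^H mod p, by repeated squaring.
  power : Cmd
  power =
    r ≔ lit 1 ⨾ sq ≔ var α ⨾ e ≔ var H ⨾
    repeat ⌈lg var H :+ lit 1 ⌉
      ( (when var e :% lit 2 :≡ lit 1 do′ (r ≔ (var r :* var sq) :% var p)) ⨾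
        sq ≔ (var sq :* var sq) :% var p ⨾
        e ≔ var e :/ lit 2 )

  -- r ≔ |hash(y)|; H is the height after an upstep or before a downstep.
  absHash : Cmd
  absHash = if y is a :∨ y is ā then power else (r ≔ lit 0)

  swapLetter : Cmd
  swapLetter =
    if y is a then (y ≔ lit (letterCode ā)) else
    if y is ā then (y ≔ lit (letterCode a)) else
    if y is b then (y ≔ lit (letterCode b̄)) else
    (y ≔ lit (letterCode b))

  upstep : Cmd
  upstep =
    H ≔ var H :+ lit 1 ⨾
    absHash ⨾
    pushItem (var r) (lit 1) (var t)

  downstep : Cmd
  downstep =
    (if nonEmpty S then skip else reject) ⨾
    popItem h ℓ f ⨾
    ℓ ≔ var ℓ :- lit 1 ⨾
    absHash ⨾
    h ≔ (var h :+ (var p :- var r)) :% var p ⨾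
    H ≔ var H :- lit 1 ⨾
    pushItem (var h) (var ℓ) (var f) ⨾
    when var ℓ :≡ lit 0 do′
      ( (if var h :≡ lit 0 then skip else reject) ⨾
        popItem h ℓ f )

  readLetter : Cmd → Cmd
  readLetter interpret =
    read y ⨾ interpret ⨾
    t ≔ var t :+ lit 1 ⨾
    (if y is a :∨ y is b then upstep else downstep)

  inBlock : Reg → Test
  inBlock x = var s :+ lit 1 :≤ var x :∧ var x :≤ var s :+ var m

  -- Primes mark the item above: (h′, ℓ′, f′) is popped first.
  merge : Cmd
  merge =
    when nonEmpty S do′
      ( popItem h′ ℓ′ f′ ⨾
        (if nonEmpty S :∧ inBlock f′ then
          ( popItem h ℓ f ⨾
            (if inBlock f then
              pushItem ((var h :+ var h′) :% var p) (var ℓ :+ var ℓ′) (var f)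
            else
              (pushItem (var h) (var ℓ) (var f) ⨾ pushItem (var h′) (var ℓ′) (var f′))))
        else
          pushItem (var h′) (var ℓ′) (var f′)) )

  -- The next block, of length m, contains no letter of the input.
  padding : Test
  padding = var hi :≤ var t :∨ var t :+ var m :≤ var lo

  -- Block(k, S).  The padding is not in the stream, and is not gone through
  -- letter by letter since its length is not polylogarithmic.  For n even, a
  -- block of padding is a word (aā)^j: each a pushes an item that the next ā
  -- makes zero and discards, so that S and H are unchanged by the block.
  block : Cmd → Cmd
  block interpret =
    rec (var k)
      (if padding then
        (t ≔ var t :+ var m)
      else
        ( push frames (var s) ⨾ s ≔ var t ⨾
          m ≔ var m :/ lit 2 ⨾ self ⨾ self ⨾ m ≔ var m :* lit 2 ⨾
          merge ⨾
          pop frames s ))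
      (readLetter interpret)

  initialise : Cmd
  initialise =
    (when var n :% lit 2 :≡ lit 1 do′ reject) ⨾
    k ≔ ⌈lg var n ⌉ ⨾
    N ≔ lit 1 ⨾ repeat (var k) (N ≔ lit 2 :* var N)

  scan : Expr → Expr → Cmd → Cmd
  scan first last interpret =
    t ≔ lit 0 ⨾ H ≔ lit 0 ⨾ s ≔ lit 0 ⨾ m ≔ var N ⨾
    lo ≔ first ⨾ hi ≔ last ⨾
    block interpret

  algorithm₃ : BidirectionalAlgorithm 2
  algorithm₃ =
      (→ᵈ , (initialise ⨾
             scan (lit 0) (var n) skip ⨾
             when nonEmpty S do′ reject))
    ∷ (←ᵈ , scan (var N :- var n) (var N) swapLetter)
    ∷ []

  run₃ : ℕ → ℕ → List Letter → Outcome
  run₃ prime rand x = run algorithm₃ (length x ∷ prime ∷ rand ∷ replicate 18 0) x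

open Algorithm₃ using (run₃)

spaceUsed timeUsed : (p α : ℕ) → List Letter → ℕ
spaceUsed p α x = Machine.space (Machine.final 21 2 letterCode (run₃ p α x))
timeUsed  p α x = Machine.time (Machine.final 21 2 letterCode (run₃ p α x))

accepts rejects : (p : ℕ) → List Letter → ℕ → Bool
accepts p x α = Machine.isRunning 21 2 letterCode (run₃ p α x)
rejects p x α = not (accepts p x α)

{-# OPTIONS --safe #-}
module Submission where

-- Replace the hash of a stack item by a polynomial in α.  The run of the algorithm
-- then depends on α only through the tests whether the discarded polynomials vanish
-- at α.  A block without type mismatch acts on the older items like its unmatched
-- downsteps, and leaves on the stack at most one item, which encodes its unmatched
-- upsteps; so on a well-parenthesized word all discarded polynomials are zero.
-- Otherwise take a smallest block with a mismatch, which then occurs between the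
-- unmatched upsteps of the left half and the unmatched downsteps of the right half.
-- If there are at most as many of the former, the first pass discards their item
-- within the block, with coefficient ±1 at the height of the mismatch; if not, the
-- second pass, where the halves are exchanged, discards such an item.  A non-zero
-- polynomial of degree at most n has at most n roots modulo p, and n/p ≤ n^(-c).
--
-- At any time the stack holds at most one item for each of the O(log n) finished
-- sibling blocks, hence O((log n)²) bits, and only O(log n) blocks start, end or
-- are skipped between two letters.

open import Defs
open import Algebra.Bundles using (module CommutativeMonoid)
open import Data.Bool.Base as Bool using (Bool; true; false; not; T)
open import Data.Bool.Properties using (T?)
open import Data.Empty using (⊥; ⊥-elim)
open import Data.Fin.Base using (zero; suc)
import Data.Fin.Properties as Fin
open import Data.Integer.Base as ℤ using (ℤ; +_; -_; 0ℤ; 1ℤ)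
open import Data.Integer.Divisibility.Signed as ℤ using () renaming (_∣_ to _∣ℤ_)
import Data.Integer.Properties as ℤ
open import Data.Integer.Tactic.RingSolver using () renaming (solve-∀ to ℤ-solve-∀)
open import Data.List.Base as List using (List; []; _∷_; _++_; length; map; reverse; take; filterᵇ; upTo)
import Data.List.Properties as List
open import Data.List.Relation.Unary.All as All using (All; []; _∷_)
import Data.List.Relation.Unary.All.Properties as All
open import Data.List.Relation.Unary.AllPairs using ([]; _∷_)
open import Data.List.Relation.Unary.Any as Any using (Any; here; there)
open import Data.List.Relation.Unary.Unique.Propositional using (Unique)
import Data.List.Relation.Unary.Unique.Propositional.Properties as Unique
open import Data.Maybe.Base using (Maybe; just; nothing)
open import Data.Nat.Base
open import Data.Nat.Divisibility using (_∣_; ∣⇒≤)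
import Data.Nat.DivMod as ℕ
open import Data.Nat.ListAction using (sum)
open import Data.Nat.Logarithm
open import Data.Nat.Primality using (Prime; euclidsLemma; prime⇒nonTrivial)
open import Data.Nat.Properties as ℕ using (
  ≤-refl; ≤-reflexive; ≤-trans; <⇒≤; n≤1+n; m≤m+n; m≤n+m; +-comm; +-assoc;
  +-identityʳ; +-mono-≤; +-monoˡ-≤; +-monoʳ-≤; *-mono-≤; *-monoˡ-≤; *-monoʳ-≤;
  *-identityʳ; *-identityˡ; ≤ᵇ⇒≤)
open import Data.Nat.Tactic.RingSolver using (solve-∀)
open import Data.Product.Base using (∃-syntax; _×_; _,_; proj₁; proj₂)
open import Data.Rational.Base as ℚ using (ℚ; 1ℚ; toℚᵘ; _-_)
import Data.Rational.Properties as ℚ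
open import Data.Rational.Unnormalised.Base as ℚᵘ using (mkℚᵘ; *≡*; *≤*; *<*)
import Data.Rational.Unnormalised.Properties as ℚᵘ
open import Data.Sum.Base using (_⊎_; inj₁; inj₂)
open import Data.Unit.Base using (⊤; tt)
open import Data.Vec.Base as Vec using (Vec; []; _∷_; lookup; _[_]≔_)
import Data.Vec.Properties as Vec
open import Function.Base using (_∘_)
open import Function.Bundles using (Equivalence)
open import Relation.Binary.PropositionalEquality
open import Relation.Nullary using (¬_; Dec; yes; no)
open import Algebra.Properties.CommutativeSemigroup (CommutativeMonoid.commutativeSemigroup ℚ.*-1-commutativeMonoid) using (interchange)
import Algebra.Definitions.RawSemiring ℚ.+-*-rawSemiring as ℚ^

-- Polynomials modulo p

-- The error bound is proved in contrapositive form. The symbolic run `srun` does not mention α, so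
-- all accepting α share one list of discarded polynomials. If more than n values of α accept, each
-- polynomial on this list has more common roots than its degree and is zero modulo p; there is no
-- union bound over the checks. From this, `null⇒red` rebuilds a cancellation without mismatch
-- bottom-up, so that no smallest bad block has to be located.
--
-- The machine stops at its first failed check, whereas the symbolic run goes on. The link between
-- them is therefore an exact criterion, `Accepts`, which holds if the machine accepts and fails if
-- it rejects. Straight-line code and bounded loops are covered by weakest preconditions with static
-- cost bounds; the recursion is not, and an induction over the tree of blocks carries correctness,
-- clock and space together. Its clock bound rests on two facts: reading a letter resets the clock,
-- and a block that contains a letter never has two halves of padding.

Poly : Set
Poly = List ℤ

infixl 6 _⊕_

_⊕_ : Poly → Poly → Poly
[]      ⊕ Q       = Q
(x ∷ P) ⊕ []      = x ∷ P
(x ∷ P) ⊕ (y ∷ Q) = x ℤ.+ y ∷ (P ⊕ Q)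

mono : ℤ → ℕ → Poly
mono c zero    = c ∷ []
mono c (suc j) = 0ℤ ∷ mono c j

coef : Poly → ℕ → ℤ
coef []      j       = 0ℤ
coef (x ∷ P) zero    = x
coef (x ∷ P) (suc j) = coef P j

ev : ℤ → Poly → ℤ
ev x []      = 0ℤ
ev x (c ∷ P) = c ℤ.+ x ℤ.* ev x P

ev-⊕ : ∀ x P Q → ev x (P ⊕ Q) ≡ ev x P ℤ.+ ev x Q
ev-⊕ x []      Q       = sym (ℤ.+-identityˡ _)
ev-⊕ x (c ∷ P) []      = sym (ℤ.+-identityʳ _)
ev-⊕ x (c ∷ P) (d ∷ Q) = trans (cong (λ z → c ℤ.+ d ℤ.+ x ℤ.* z) (ev-⊕ x P Q)) (rearrange c d x (ev x P) (ev x Q))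
  where
  rearrange : ∀ c d x u v → c ℤ.+ d ℤ.+ x ℤ.* (u ℤ.+ v) ≡ c ℤ.+ x ℤ.* u ℤ.+ (d ℤ.+ x ℤ.* v)
  rearrange = ℤ-solve-∀

ev-mono : ∀ x c j → ev x (mono c j) ≡ c ℤ.* x ℤ.^ j
ev-mono x c zero    = base c x
  where
  base : ∀ c x → c ℤ.+ x ℤ.* 0ℤ ≡ c ℤ.* 1ℤ
  base = ℤ-solve-∀
ev-mono x c (suc j) = trans (cong (λ z → 0ℤ ℤ.+ x ℤ.* z) (ev-mono x c j)) (shift x c (x ℤ.^ j))
  where
  shift : ∀ x c z → 0ℤ ℤ.+ x ℤ.* (c ℤ.* z) ≡ c ℤ.* (x ℤ.* z)
  shift = ℤ-solve-∀

ev-zero : ∀ x P → (∀ j → coef P j ≡ 0ℤ) → ev x P ≡ 0ℤ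
ev-zero x []      z = refl
ev-zero x (c ∷ P) z rewrite z 0 | ev-zero x P (λ j → z (suc j)) = trans (ℤ.+-identityˡ _) (ℤ.*-zeroʳ x)

coef-⊕ : ∀ P Q j → coef (P ⊕ Q) j ≡ coef P j ℤ.+ coef Q j
coef-⊕ []      Q       j       = sym (ℤ.+-identityˡ _)
coef-⊕ (x ∷ P) []      j       = sym (ℤ.+-identityʳ _)
coef-⊕ (x ∷ P) (y ∷ Q) zero    = refl
coef-⊕ (x ∷ P) (y ∷ Q) (suc j) = coef-⊕ P Q j

coef-mono-≡ : ∀ c j → coef (mono c j) j ≡ c
coef-mono-≡ c zero    = refl
coef-mono-≡ c (suc j) = coef-mono-≡ c j

coef-mono-≢ : ∀ c i {j} → i ≢ j → coef (mono c i) j ≡ 0ℤ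
coef-mono-≢ c zero    {zero}  i≢j = ⊥-elim (i≢j refl)
coef-mono-≢ c zero    {suc j} i≢j = refl
coef-mono-≢ c (suc i) {zero}  i≢j = refl
coef-mono-≢ c (suc i) {suc j} i≢j = coef-mono-≢ c i (λ i≡j → i≢j (cong suc i≡j))

length-⊕ : ∀ {m} P Q → length P ≤ m → length Q ≤ m → length (P ⊕ Q) ≤ m
length-⊕ []      Q       _         q≤m       = q≤m
length-⊕ (x ∷ P) []      p≤m       _         = p≤m
length-⊕ (x ∷ P) (y ∷ Q) (s≤s p≤m) (s≤s q≤m) = s≤s (length-⊕ P Q p≤m q≤m)

length-mono : ∀ c j → length (mono c j) ≡ suc j
length-mono c zero    = refl
length-mono c (suc j) = cong suc (length-mono c j)

-- The quotient of P - P(r) by X - r.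
quot : ℤ → Poly → Poly
quot r []          = []
quot r (c ∷ [])    = []
quot r (c ∷ d ∷ P) = ev r (d ∷ P) ∷ quot r (d ∷ P)

length-quot : ∀ r c P → length (quot r (c ∷ P)) ≡ length P
length-quot r c []      = refl
length-quot r c (d ∷ P) = cong suc (length-quot r d P)

ev-quot : ∀ r x P → ev x P ℤ.- ev r P ≡ (x ℤ.- r) ℤ.* ev x (quot r P)
ev-quot r x []          = base x r
  where
  base : ∀ x r → 0ℤ ℤ.- 0ℤ ≡ (x ℤ.- r) ℤ.* 0ℤ
  base = ℤ-solve-∀
ev-quot r x (c ∷ [])    = base x r c
  where
  base : ∀ x r c → c ℤ.+ x ℤ.* 0ℤ ℤ.- (c ℤ.+ r ℤ.* 0ℤ) ≡ (x ℤ.- r) ℤ.* 0ℤ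
  base = ℤ-solve-∀
ev-quot r x (c ∷ P@(d ∷ _)) = begin
  c ℤ.+ x ℤ.* ev x P ℤ.- (c ℤ.+ r ℤ.* ev r P)  ≡⟨ split c x r (ev x P) (ev r P) ⟩
  (x ℤ.- r) ℤ.* ev r P ℤ.+ x ℤ.* (ev x P ℤ.- ev r P)  ≡⟨ cong (λ z → (x ℤ.- r) ℤ.* ev r P ℤ.+ x ℤ.* z) (ev-quot r x P) ⟩
  (x ℤ.- r) ℤ.* ev r P ℤ.+ x ℤ.* ((x ℤ.- r) ℤ.* ev x (quot r P)) ≡⟨ join x r (ev r P) (ev x (quot r P)) ⟩
  (x ℤ.- r) ℤ.* (ev r P ℤ.+ x ℤ.* ev x (quot r P))  ∎
  where
  open ≡-Reasoning
  split : ∀ c x r u v → c ℤ.+ x ℤ.* u ℤ.- (c ℤ.+ r ℤ.* v) ≡ (x ℤ.- r) ℤ.* v ℤ.+ x ℤ.* (u ℤ.- v)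
  split = ℤ-solve-∀
  join : ∀ x r v u → (x ℤ.- r) ℤ.* v ℤ.+ x ℤ.* ((x ℤ.- r) ℤ.* u) ≡ (x ℤ.- r) ℤ.* (v ℤ.+ x ℤ.* u)
  join = ℤ-solve-∀

Vanishes : ℕ → ℕ → Poly → Set
Vanishes p α P = + p ∣ℤ ev (+ α) P

Null : ℕ → Poly → Set
Null p = All (+ p ∣ℤ_)

-- As in Horner's scheme, the coefficients of the quotient are the values at r of the proper tails
-- of P. Each coefficient of P is the value of the tail starting there minus r times the value of
-- the next tail, and p divides all these values.
quot-null : ∀ {p} r P → Vanishes p r P → Null p (quot (+ r) P) → Null p P
quot-null r []              v n        = []
quot-null {p} r (c ∷ [])    v []       = subst (+ p ∣ℤ_) (const c (+ r)) v ∷ []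
  where
  const : ∀ c r → c ℤ.+ r ℤ.* 0ℤ ≡ c
  const = ℤ-solve-∀
quot-null r (c ∷ P@(d ∷ _)) v (n ∷ ns) = ℤ.∣m+n∣n⇒∣m {m = c} v (ℤ.∣n⇒∣m*n (+ r) n) ∷ quot-null r P n ns

distinct-residues : ∀ {p x r} → x < p → r < p → x ≢ r → ¬ (+ p ∣ℤ (+ x ℤ.- + r))
distinct-residues {p} {x} {r} x<p r<p x≢r p∣x-r = x≢r (ℤ.+-injective (ℤ.i-j≡0⇒i≡j (+ x) (+ r) (ℤ.∣i∣≡0⇒i≡0 ∣x-r∣≡0)))
  where
  p∣ : p ∣ ℤ.∣ + x ℤ.- + r ∣
  p∣ = ℤ.∣⇒∣ᵤ p∣x-r
  ∣x-r∣<p : ℤ.∣ + x ℤ.- + r ∣ < p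
  ∣x-r∣<p = ℕ.≤-<-trans (≤-reflexive (cong ℤ.∣_∣ (ℤ.[+m]-[+n]≡m⊖n x r)))
            (ℕ.≤-<-trans (ℤ.∣m⊝n∣≤m⊔n x r) (ℕ.⊔-lub x<p r<p))
  ∣x-r∣≡0 : ℤ.∣ + x ℤ.- + r ∣ ≡ 0
  ∣x-r∣≡0 with ℤ.∣ + x ℤ.- + r ∣ in eq
  ... | zero  = refl
  ... | suc m = ⊥-elim (ℕ.<⇒≱ ∣x-r∣<p (subst (p ≤_) (sym eq) (∣⇒≤ (subst (p ∣_) eq p∣))))

-- Induction on the list of roots: the factor X - r is split off, and as the prime p does not divide
-- x - r for another root x below p, the quotient still vanishes at x. Since `length P` counts
-- coefficients, the hypothesis says that the degree is less than the number of roots.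
many-roots⇒null : ∀ {p} → Prime p → ∀ P xs → Unique xs → All (_< p) xs →
                  All (λ x → Vanishes p x P) xs → length P ≤ length xs → Null p P
many-roots⇒null pr []      xs       u       bs      v       l = []
many-roots⇒null {p} pr P@(c ∷ P′) (r ∷ xs) (u ∷ us) (r<p ∷ bs) (v ∷ vs) (s≤s l) =
  quot-null r P v (many-roots⇒null pr (quot (+ r) P) xs us bs
    (All.zipWith root (All.zip (u , bs) , vs)) (subst (_≤ length xs) (sym (length-quot (+ r) c P′)) l))
  where
  root : ∀ {x} → (r ≢ x × x < p) × Vanishes p x P → Vanishes p x (quot (+ r) P)
  root {x} ((r≢x , x<p) , w) with euclidsLemma ℤ.∣ + x ℤ.- + r ∣ ℤ.∣ ev (+ x) (quot (+ r) P) ∣ pr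
    (subst (p ∣_) (trans (cong ℤ.∣_∣ (ev-quot (+ r) (+ x) P))
      (ℤ.abs-* (+ x ℤ.- + r) (ev (+ x) (quot (+ r) P)))) (ℤ.∣⇒∣ᵤ (ℤ.∣m∣n⇒∣m-n {m = ev (+ x) P} w v)))
  ... | inj₁ d = ⊥-elim (distinct-residues x<p r<p (λ e → r≢x (sym e)) (ℤ.∣ᵤ⇒∣ d))
  ... | inj₂ d = ℤ.∣ᵤ⇒∣ d

null⇒coef : ∀ {p P} → Null p P → ∀ j → + p ∣ℤ coef P j
null⇒coef {p} []   j       = ℤ.divides 0ℤ (sym (ℤ.*-zeroˡ (+ p)))
null⇒coef (n ∷ ns) zero    = n
null⇒coef (n ∷ ns) (suc j) = null⇒coef ns j

-- The algorithm with hashes as polynomials in α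

data Step : Set where
  opening closing : Bool → Step

opposite : Step → Step
opposite (opening c)  = closing c
opposite (closing c) = opening c

-- Binary subdivisions of the padded word into blocks; a pad is a block of padding.
data Tree : ℕ → Set where
  leaf : Step → Tree 0
  pad  : ∀ {i} → Tree (suc i)
  node : ∀ {i} → Tree i → Tree i → Tree (suc i)

yield : ∀ {i} → Tree i → List Step
yield (leaf y)   = y ∷ []
yield pad        = []
yield (node l r) = yield l ++ yield r

mirror : ∀ {i} → Tree i → Tree i
mirror (leaf y)   = leaf (opposite y)
mirror pad        = pad
mirror (node l r) = node (mirror r) (mirror l)

yield-mirror : ∀ {i} (τ : Tree i) → yield (mirror τ) ≡ map opposite (reverse (yield τ))
yield-mirror (leaf y)   = refl
yield-mirror pad        = refl
yield-mirror (node l r) = begin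
  yield (mirror r) ++ yield (mirror l)  ≡⟨ cong₂ _++_ (yield-mirror r) (yield-mirror l) ⟩
  map opposite (reverse (yield r)) ++ map opposite (reverse (yield l))  ≡⟨ List.map-++ opposite (reverse (yield r)) _ ⟨
  map opposite (reverse (yield r) ++ reverse (yield l))  ≡⟨ cong (map opposite) (List.reverse-++ (yield l) (yield r)) ⟨
  map opposite (reverse (yield l ++ yield r))  ∎
  where open ≡-Reasoning

-- item P q f encodes a subsequence with first letter f, height q + 1 and
-- hash P(α), where the hash is kept as a polynomial in the random α.
record Item : Set where
  constructor item
  field
    poly  : Poly
    depth : ℕ
    first : ℕ

open Item public

Stack : Set
Stack = List Item

-- The heights of the items add up to the height of the word read so far. This number supplies the
-- exponents of the hashes and is the content of the register `H`.
height : Stack → ℕ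
height []      = 0
height (I ∷ S) = suc (depth I + height S)

-- The list holds the polynomials whose values the algorithm compares with 0.
Result : Set
Result = Maybe (Stack × List Poly)

emit : List Poly → Result → Result
emit D nothing         = nothing
emit D (just (S , E)) = just (S , D ++ E)

bind : Result → (Stack → Result) → Result
bind nothing         k = nothing
bind (just (S , D)) k = emit D (k S)

mapStack : (Stack → Stack) → Result → Result
mapStack g nothing         = nothing
mapStack g (just (S , D)) = just (g S , D)

-- `true` stands for the pair a, ā and `false` for b, b̄. A letter of the second type still
-- contributes a monomial, with coefficient 0, so that a mismatch leaves 1 or -1 in either
-- direction.
val : Bool → ℤ
val true  = 1ℤ
val false = 0ℤ

pushUp : Bool → ℕ → Stack → Stack
pushUp c t S = item (mono (val c) (suc (height S))) 0 (suc t) ∷ S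

lower : Poly → ℕ → ℕ → Stack → Result
lower P zero    f S = just (S , P ∷ [])
lower P (suc q) f S = just (item P q f ∷ S , [])

popDown : Bool → Stack → Result
popDown c []               = nothing
popDown c (item P q f ∷ S) = lower (P ⊕ mono (- val c) (suc (q + height S))) q f S

-- The test concerns the lower end s of the block. The upper end, which the program tests as well,
-- is implied: no item starts after the letters read so far (`srun-old`).
mergeTop : ℕ → Stack → Stack
mergeTop s (item P q f ∷ item P′ q′ f′ ∷ S) with s ℕ.<? f | s ℕ.<? f′
... | yes _ | yes _ = item (P′ ⊕ P) (q′ + suc q) f′ ∷ S
... | _     | _     = item P q f ∷ item P′ q′ f′ ∷ S
mergeTop s S = S

srun : ∀ {i} → Tree i → ℕ → Stack → Result
srun (leaf (opening c))  t S = just (pushUp c t S , [])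
srun (leaf (closing c)) t S = popDown c S
srun pad               t S = just (S , [])
srun (node {i} l r)    t S = mapStack (mergeTop t) (bind (srun l t S) (srun r (t + 2 ^ i)))

Old : ℕ → Stack → Set
Old t = All (λ I → first I ≤ t)

downs : List Bool → Stack → Result
downs []       S = just (S , [])
downs (c ∷ ds) S = bind (popDown c S) (downs ds)

mergeTop-yes : ∀ {s P q f P′ q′ f′ S} → s < f → s < f′ →
  mergeTop s (item P q f ∷ item P′ q′ f′ ∷ S) ≡ item (P′ ⊕ P) (q′ + suc q) f′ ∷ S
mergeTop-yes {s} {f = f} {f′ = f′} s<f s<f′ with s ℕ.<? f | s ℕ.<? f′
... | yes _ | yes _ = refl
... | no n  | _     = ⊥-elim (n s<f)
... | yes _ | no n  = ⊥-elim (n s<f′)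

mergeTop-no : ∀ {s I S} → Old s S → mergeTop s (I ∷ S) ≡ I ∷ S
mergeTop-no {S = []}              []        = refl
mergeTop-no {s} {I} {item _ _ f ∷ S} (f≤s ∷ _) with s ℕ.<? first I | s ℕ.<? f
... | yes _ | yes s<f = ⊥-elim (ℕ.<⇒≱ s<f f≤s)
... | yes _ | no _    = refl
... | no _  | yes _   = refl
... | no _  | no _    = refl

mergeTop-old : ∀ {s S} → Old s S → mergeTop s S ≡ S
mergeTop-old []      = refl
mergeTop-old (_ ∷ o) = mergeTop-no o

emit-++ : ∀ D E R → emit D (emit E R) ≡ emit (D ++ E) R
emit-++ D E nothing         = refl
emit-++ D E (just (S , F)) = cong (λ z → just (S , z)) (sym (List.++-assoc D E F))

bind-emit : ∀ D R k → bind (emit D R) k ≡ emit D (bind R k)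
bind-emit D nothing         k = refl
bind-emit D (just (S , E)) k = sym (emit-++ D E (k S))

emit-[] : ∀ R → emit [] R ≡ R
emit-[] nothing  = refl
emit-[] (just _) = refl

downs-++ : ∀ ds es S → downs (ds ++ es) S ≡ bind (downs ds S) (downs es)
downs-++ []       es S = sym (emit-[] (downs es S))
downs-++ (c ∷ ds) es S with popDown c S
... | nothing        = refl
... | just (S′ , D) = trans (cong (emit D) (downs-++ ds es S′)) (sym (bind-emit D (downs ds S′) (downs es)))

-- Comparing runs up to identically zero polynomials

infix 4 _≈_

_≈_ : Poly → Poly → Set
P ≈ Q = ∀ j → coef P j ≡ coef Q j

-- A block whose types match discards, besides what its pending downsteps discard, the items that
-- are matched within it. The latter emit identically zero polynomials, which are the insertions
-- made by `skip`.
data Pad : List Poly → List Poly → Set where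
  []   : Pad [] []
  keep : ∀ {P D E} → Pad D E → Pad (P ∷ D) (P ∷ E)
  skip : ∀ {P D E} → P ≈ [] → Pad D E → Pad D (P ∷ E)

pad-refl : ∀ D → Pad D D
pad-refl []      = []
pad-refl (P ∷ D) = keep (pad-refl D)

pad-++ : ∀ {D E D′ E′} → Pad D E → Pad D′ E′ → Pad (D ++ D′) (E ++ E′)
pad-++ []         y = y
pad-++ (keep x)   y = keep (pad-++ x y)
pad-++ (skip z x) y = skip z (pad-++ x y)

pad-trans : ∀ {D E F} → Pad D E → Pad E F → Pad D F
pad-trans x          []         = x
pad-trans x          (skip z y) = skip z (pad-trans x y)
pad-trans (keep x)   (keep y)   = keep (pad-trans x y)
pad-trans (skip z x) (keep y)   = skip z (pad-trans x y)

pad-all : ∀ {Q : Poly → Set} {D E} → Pad D E → All Q E → All Q D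
pad-all []         []       = []
pad-all (keep x)   (q ∷ qs) = q ∷ pad-all x qs
pad-all (skip _ x) (_ ∷ qs) = pad-all x qs

pad-zero : ∀ {E} → Pad [] E → All (_≈ []) E
pad-zero []         = []
pad-zero (skip z x) = z ∷ pad-zero x

data Sim (R : Stack → Stack → Set) : Result → Result → Set where
  both-fail : Sim R nothing nothing
  both-ok   : ∀ {S T D E} → R S T → Pad D E → Sim R (just (S , D)) (just (T , E))

sim-emit : ∀ {R D E A B} → Pad D E → Sim R A B → Sim R (emit D A) (emit E B)
sim-emit x both-fail     = both-fail
sim-emit x (both-ok r y) = both-ok r (pad-++ x y)

sim-bind : ∀ {Q R A B f g} → Sim Q A B → (∀ {S T} → Q S T → Sim R (f S) (g T)) → Sim R (bind A f) (bind B g)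
sim-bind both-fail     h = both-fail
sim-bind (both-ok q x) h = sim-emit x (h q)

sim-trans : ∀ {Q R T A B C} → (∀ {X Y Z} → Q X Y → R Y Z → T X Z) → Sim Q A B → Sim R B C → Sim T A C
sim-trans h both-fail     both-fail     = both-fail
sim-trans h (both-ok q x) (both-ok r y) = both-ok (h q r) (pad-trans x y)

sim-mapʳ : ∀ {R T A B g} → (∀ {X Y} → R X Y → T X (g Y)) → Sim R A B → Sim T A (mapStack g B)
sim-mapʳ h both-fail     = both-fail
sim-mapʳ h (both-ok r x) = both-ok (h r) x

-- Cancellations, and the item that encodes pending upsteps

-- The cancellation stops when one side is used up. Two heads of different types have no
-- constructor, so a derivation certifies that no mismatch occurs where the two lists meet.
data Cancel : List Bool → List Bool → List Bool → List Bool → Set where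
  nilˡ : ∀ {ds} → Cancel [] ds [] ds
  nilʳ : ∀ {us} → Cancel us [] us []
  same : ∀ {c us ds us′ ds′} → Cancel us ds us′ ds′ → Cancel (c ∷ us) (c ∷ ds) us′ ds′

cancel-sym : ∀ {us ds us′ ds′} → Cancel us ds us′ ds′ → Cancel ds us ds′ us′
cancel-sym nilˡ     = nilʳ
cancel-sym nilʳ     = nilˡ
cancel-sym (same x) = same (cancel-sym x)

-- Red τ ds us: the well-typed cancellations inside τ leave the downsteps ds
-- followed by the upsteps us, where ds starts with the first downstep and us with
-- the last upstep.
data Red : ∀ {i} → Tree i → List Bool → List Bool → Set where
  up   : ∀ {c} → Red (leaf (opening c)) [] (c ∷ [])
  down : ∀ {c} → Red (leaf (closing c)) (c ∷ []) []
  pad  : ∀ {i} → Red (pad {i}) [] []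
  node : ∀ {i} {l r : Tree i} {ds us ds₁ us₁ ds₂ us₂} → Red l ds₁ us₁ → Red r ds₂ us₂ →
         Cancel us₁ ds₂ us ds → Red (node l r) (ds₁ ++ ds) (us₂ ++ us)

red-mirror : ∀ {i} {τ : Tree i} {ds us} → Red τ ds us → Red (mirror τ) us ds
red-mirror up           = down
red-mirror down         = up
red-mirror pad          = pad
red-mirror (node l r x) = node (red-mirror r) (red-mirror l) (cancel-sym x)

-- This is the hash of pending upsteps that stand on height β. The head of the list is the topmost
-- upstep and has the largest exponent.
ups : List Bool → ℕ → Poly
ups []       β = []
ups (c ∷ us) β = ups us β ⊕ mono (val c) (suc (length us + β))

coef-ups-> : ∀ us β {j} → length us + β < j → coef (ups us β) j ≡ 0ℤ
coef-ups-> []       β     l<j = refl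
coef-ups-> (c ∷ us) β {j} l<j = begin
  coef (ups us β ⊕ mono (val c) (suc (length us + β))) j  ≡⟨ coef-⊕ (ups us β) _ j ⟩
  coef (ups us β) j ℤ.+ coef (mono (val c) (suc (length us + β))) j ≡⟨ cong₂ ℤ._+_
    (coef-ups-> us β (ℕ.<-trans (ℕ.n<1+n _) l<j)) (coef-mono-≢ (val c) _ (ℕ.<⇒≢ l<j)) ⟩
  0ℤ  ∎
  where open ≡-Reasoning

ups-++ : ∀ us vs β → ups (us ++ vs) β ≈ ups vs β ⊕ ups us (length vs + β)
ups-++ []       vs β j = trans (sym (ℤ.+-identityʳ _)) (sym (coef-⊕ (ups vs β) [] j))
ups-++ (c ∷ us) vs β j = begin
  coef (ups (us ++ vs) β ⊕ mono (val c) (suc (length (us ++ vs) + β))) j  ≡⟨ coef-⊕ (ups (us ++ vs) β) _ j ⟩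
  coef (ups (us ++ vs) β) j ℤ.+ m (length (us ++ vs) + β)  ≡⟨ cong₂ (λ x y → x ℤ.+ m y) (ups-++ us vs β j) len ⟩
  coef (ups vs β ⊕ U) j ℤ.+ m (length us + (length vs + β))  ≡⟨ cong (ℤ._+ m (length us + (length vs + β)))
    (coef-⊕ (ups vs β) U j) ⟩
  coef (ups vs β) j ℤ.+ coef U j ℤ.+ m (length us + (length vs + β))  ≡⟨ ℤ.+-assoc (coef (ups vs β) j) (coef U j) _ ⟩
  coef (ups vs β) j ℤ.+ (coef U j ℤ.+ m (length us + (length vs + β)))  ≡⟨ cong
    (λ z → coef (ups vs β) j ℤ.+ z) (coef-⊕ U _ j) ⟨
  coef (ups vs β) j ℤ.+ coef (U ⊕ mono (val c) (suc (length us + (length vs + β)))) j ≡⟨ coef-⊕ (ups vs β) _ j ⟨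
  coef (ups vs β ⊕ ups (c ∷ us) (length vs + β)) j  ∎
  where
  open ≡-Reasoning
  U = ups us (length vs + β)
  m : ℕ → ℤ
  m x = coef (mono (val c) (suc x)) j
  len : length (us ++ vs) + β ≡ length us + (length vs + β)
  len = trans (cong (_+ β) (List.length-++ us)) (+-assoc (length us) (length vs) β)

-- Above t t′ us S T: T is S with, if us is non-empty, an item for the pending
-- upsteps us on top, which starts in the block of the positions t+1, …, t′.
data Above (t t′ : ℕ) : List Bool → Stack → Stack → Set where
  same : ∀ {S} → Old t S → Above t t′ [] S S
  over : ∀ {c us P q f S} → Old t S → q ≡ length us → P ≈ ups (c ∷ us) (height S) →
         t < f → f ≤ t′ → Above t t′ (c ∷ us) S (item P q f ∷ S)

lower-top : ∀ {c us P q β} → q ≡ length us → P ≈ ups (c ∷ us) β → P ⊕ mono (- val c) (suc (q + β)) ≈ ups us β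
lower-top {c} {us} {P} {q} {β} refl eq j = begin
  coef (P ⊕ mono (- val c) k) j  ≡⟨ coef-⊕ P _ j ⟩
  coef P j ℤ.+ coef (mono (- val c) k) j  ≡⟨ cong₂ ℤ._+_ (trans (eq j) (coef-⊕ (ups us β) _ j)) (mono-neg k) ⟩
  coef (ups us β) j ℤ.+ coef (mono (val c) k) j ℤ.- coef (mono (val c) k) j ≡⟨ undo (coef (ups us β) j) _ ⟩
  coef (ups us β) j  ∎
  where
  open ≡-Reasoning
  k = suc (length us + β)
  undo : ∀ x y → x ℤ.+ y ℤ.- y ≡ x
  undo = ℤ-solve-∀
  mono-neg : ∀ k → coef (mono (- val c) k) j ≡ - coef (mono (val c) k) j
  mono-neg k with k ℕ.≟ j
  ... | yes refl = trans (coef-mono-≡ (- val c) k) (cong -_ (sym (coef-mono-≡ (val c) k)))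
  ... | no  k≢j  = trans (coef-mono-≢ (- val c) k k≢j) (cong -_ (sym (coef-mono-≢ (val c) k k≢j)))

downs-old : ∀ {t t′} ds {S} → Old t S → Sim (Above t t′ []) (downs ds S) (downs ds S)
downs-old []       o                      = both-ok (same o) []
downs-old (c ∷ ds) []                     = both-fail
downs-old (c ∷ ds) {item P zero f ∷ S} (x ∷ o)    = sim-emit (pad-refl _) (downs-old ds o)
downs-old (c ∷ ds) {item P (suc q) f ∷ S} (x ∷ o) = sim-emit [] (downs-old ds (x ∷ o))

sim-emit-[] : ∀ {R A B} → Sim R A B → Sim R A (emit [] B)
sim-emit-[] {B = B} s = subst (Sim _ _) (sym (emit-[] B)) s

sim-skip : ∀ {R A B P} → P ≈ [] → Sim R A B → Sim R A (emit (P ∷ []) B)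
sim-skip z both-fail     = both-fail
sim-skip z (both-ok r x) = both-ok r (skip z x)

-- Each matching downstep removes the leading monomial of the single new item (`lower-top`). When
-- the last one is gone, the item is discarded with an identically zero polynomial, which `Pad`
-- allows, and the remaining downsteps reach the old items.
cancel-sim : ∀ {t t′ us ds us′ ds′ S T} → Above t t′ us S T → Cancel us ds us′ ds′ →
             Sim (Above t t′ us′) (downs ds′ S) (downs ds T)
cancel-sim {ds = ds} (same o)        nilˡ     = downs-old ds o
cancel-sim x                         nilʳ     = both-ok x []
cancel-sim (over {c} {[]}     {P} o refl eq l g) (same y) =
  sim-skip (lower-top {c} {[]} {P} refl eq) (cancel-sim (same o) y)
cancel-sim (over {c} {_ ∷ us} {P} o refl eq l g) (same y) =
  sim-emit-[] (cancel-sim (over o refl (lower-top {c} {_ ∷ us} {P} refl eq) l g) y)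

above-old : ∀ {t t′ us S T} → t ≤ t′ → Above t t′ us S T → Old t′ T
above-old t≤t′ (same o)         = All.map (λ x → ≤-trans x t≤t′) o
above-old t≤t′ (over o _ _ _ g) = g ∷ All.map (λ x → ≤-trans x t≤t′) o

-- If both halves leave pending upsteps, their items are adjacent on top and both start after t, so
-- `mergeTop` joins them, and by `ups-++` the sum of the polynomials is the hash of the joined list.
-- Otherwise everything below the top item is old and nothing is merged.
above-merge : ∀ {t t₁ t₂ us vs S T U} → t ≤ t₁ → t₁ ≤ t₂ → Above t t₁ us S T → Above t₁ t₂ vs T U →
              Above t t₂ (vs ++ us) S (mergeTop t U)
above-merge {t} t≤t₁ t₁≤t₂ (same o) (same _) = subst (Above t _ [] _) (sym (mergeTop-old o)) (same o)
above-merge {t} {t₂ = t₂} {S = S} t≤t₁ t₁≤t₂ (same o) (over {c} {vs} _ q eq l g) =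
  subst₂ (λ us U → Above t t₂ us S U) (sym (List.++-identityʳ (c ∷ vs))) (sym (mergeTop-no o))
    (over o q eq (ℕ.≤-<-trans t≤t₁ l) g)
above-merge {t} t≤t₁ t₁≤t₂ (over o q eq l g) (same _) =
  subst (Above t _ _ _) (sym (mergeTop-no o)) (over o q eq l (≤-trans g t₁≤t₂))
above-merge {t} t≤t₁ t₁≤t₂ (over {c} {us} {P} {S = S} o refl eq l g) (over {c′} {vs} {P′} _ refl eq′ l′ g′) =
  subst (Above t _ _ _) (sym (mergeTop-yes (ℕ.≤-<-trans t≤t₁ l′) l))
    (over o len both l (≤-trans g t₁≤t₂))
  where
  len : length us + suc (length vs) ≡ length (vs ++ c ∷ us)
  len = trans (+-comm (length us) _) (trans (sym (ℕ.+-suc (length vs) _)) (sym (List.length-++ vs)))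
  both : P ⊕ P′ ≈ ups ((c′ ∷ vs) ++ c ∷ us) (height S)
  both j = trans (coef-⊕ P P′ j) (trans (cong₂ ℤ._+_ (eq j) (eq′ j))
    (trans (sym (coef-⊕ (ups (c ∷ us) (height S)) _ j)) (sym (ups-++ (c′ ∷ vs) (c ∷ us) (height S) j))))

end : ∀ t i → t + 2 ^ i + 2 ^ i ≡ t + 2 ^ suc i
end t i = trans (+-assoc t (2 ^ i) (2 ^ i)) (cong (λ z → t + (2 ^ i + z)) (sym (+-identityʳ (2 ^ i))))

-- A block without type mismatch acts on the old items like its pending
-- downsteps alone, and all other polynomials that it checks vanish identically.
red-sim : ∀ {i} {τ : Tree i} {ds us} → Red τ ds us → ∀ t {S} → Old t S →
          Sim (Above t (t + 2 ^ i) us) (downs ds S) (srun τ t S)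
red-sim up t o = both-ok (over o refl (λ j → refl) ≤-refl (≤-reflexive (+-comm 1 t))) []
red-sim down t []                             = both-fail
red-sim down t {item P zero f ∷ S} (x ∷ o)    = both-ok (same o) (keep [])
red-sim down t {item P (suc q) f ∷ S} (x ∷ o) = both-ok (same (x ∷ o)) []
red-sim pad t o = both-ok (same o) []
red-sim {suc i} (node {ds = ds} {us} {ds₁} {us₁} {ds₂} {us₂} l r x) t {S} o =
  -- The left half acts like `ds₁`. By the cancellation, running `ds` on the bare stack matches
  -- running `ds₂` over the pending `us₁`, and this matches the right half. The intermediate stack Y
  -- links the two `Above` facts that `above-merge` combines.
  subst (λ A → Sim _ A _) (sym (downs-++ ds₁ ds S))
    (sim-mapʳ (λ (T , p , q) → above-merge (m≤m+n t _) ≤end p q)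
      (sim-bind (red-sim l t o) λ a →
        sim-trans {T = λ X Z → ∃[ Y ] (Above t (t + 2 ^ i) us X Y × Above (t + 2 ^ i) (t + 2 ^ suc i) us₂ Y Z)}
          (λ {_} {Y} {Z} p q → Y , p , subst (λ z → Above (t + 2 ^ i) z us₂ Y Z) (end t i) q)
          (cancel-sim a x) (red-sim r (t + 2 ^ i) (above-old (m≤m+n t _) a))))
  where
  ≤end : t + 2 ^ i ≤ t + 2 ^ suc i
  ≤end = subst (t + 2 ^ i ≤_) (end t i) (m≤m+n _ _)

-- From null polynomials back to matching types

bind-just : ∀ {A k S D} → bind A k ≡ just (S , D) →
            ∃[ T ] ∃[ E ] ∃[ F ] (A ≡ just (T , E) × k T ≡ just (S , F) × D ≡ E ++ F)
bind-just {just (T , E)} {k} eq with k T in kT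
bind-just {just (T , E)} {k} refl | just (S , F) = T , E , F , refl , kT , refl

mapStack-just : ∀ {g A S D} → mapStack g A ≡ just (S , D) → ∃[ T ] (A ≡ just (T , D) × S ≡ g T)
mapStack-just {A = just (T , D)} refl = T , refl , refl

node-just : ∀ {i} (l r : Tree i) {t S T D} → srun (node l r) t S ≡ just (T , D) →
            ∃[ S₁ ] ∃[ S₂ ] ∃[ E ] ∃[ F ]
              (srun l t S ≡ just (S₁ , E) × srun r (t + 2 ^ i) S₁ ≡ just (S₂ , F) × T ≡ mergeTop t S₂ × D ≡ E ++ F)
node-just {i} l r {t} {S} eq =
  let S₂ , eq′ , T≡ = mapStack-just {mergeTop t} {bind (srun l t S) (srun r (t + 2 ^ i))} eq
      S₁ , E , F , x , y , D≡ = bind-just {srun l t S} eq′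
  in S₁ , S₂ , E , F , x , y , T≡ , D≡

-- Once the height drops below an item, its coefficients above are final.
downs-emits : ∀ ds {P q f S T D} → suc q ≤ length ds → downs ds (item P q f ∷ S) ≡ just (T , D) →
              Any (λ R → ∀ j → suc (q + height S) < j → coef R j ≡ coef P j) D
downs-emits (c ∷ ds) {P} {zero} {f} {S} le eq with bind-just {just (S , _)} {downs ds} eq
... | _ , _ , F , refl , _ , refl = here λ j l → trans (coef-⊕ P _ j)
  (trans (cong (λ z → coef P j ℤ.+ z) (coef-mono-≢ (- val c) _ (ℕ.<⇒≢ l))) (ℤ.+-identityʳ _))
downs-emits (c ∷ ds) {P} {suc q} {f} {S} (s≤s le) eq with bind-just {just (_ , [])} {downs ds} eq
... | _ , _ , F , refl , eq′ , refl = Any.map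
  (λ h j l → trans (h j (ℕ.<-trans (ℕ.n<1+n _) l)) (trans (coef-⊕ P _ j)
     (trans (cong (λ z → coef P j ℤ.+ z) (coef-mono-≢ (- val c) _ (ℕ.<⇒≢ l))) (ℤ.+-identityʳ _))))
  (downs-emits ds le eq′)

val-≡ : ∀ {p} → 2 ≤ p → ∀ c d → + p ∣ℤ (val c ℤ.- val d) → c ≡ d
val-≡ p≥2 true  true  _ = refl
val-≡ p≥2 false false _ = refl
val-≡ p≥2 true  false x = ⊥-elim (ℕ.<⇒≱ p≥2 (∣⇒≤ (ℤ.∣⇒∣ᵤ x)))
val-≡ p≥2 false true  x = ⊥-elim (ℕ.<⇒≱ p≥2 (∣⇒≤ (ℤ.∣⇒∣ᵤ x)))

null-coef : ∀ {p k j P D} → All (Null p) D → Any (λ R → ∀ i → k < i → coef R i ≡ coef P i) D → k < j → + p ∣ℤ coef P j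
null-coef {p} {j = j} (n ∷ _)  (here h)  l = subst (+ p ∣ℤ_) (h j l) (null⇒coef n j)
null-coef {P = P}     (_ ∷ ns) (there x) l = null-coef {P = P} ns x l

-- At the height of the downstep only the topmost pending upstep and the downstep itself contribute,
-- as the other upsteps of the item stand lower. By `val-≡`, divisibility of this coefficient by p
-- forces equal types.
lower-coef : ∀ {c us P β} d → P ≈ ups (c ∷ us) β →
             coef (P ⊕ mono (- val d) (suc (length us + β))) (suc (length us + β)) ≡ val c ℤ.- val d
lower-coef {c} {us} {P} {β} d eq = begin
  coef (P ⊕ mono (- val d) k) k  ≡⟨ coef-⊕ P _ k ⟩
  coef P k ℤ.+ coef (mono (- val d) k) k  ≡⟨ cong₂ ℤ._+_ (trans (eq k) (coef-⊕ (ups us β) _ k))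
    (coef-mono-≡ (- val d) k) ⟩
  coef (ups us β) k ℤ.+ coef (mono (val c) k) k ℤ.- val d  ≡⟨ cong₂ (λ x y → x ℤ.+ y ℤ.- val d)
    (coef-ups-> us β ≤-refl) (coef-mono-≡ (val c) k) ⟩
  0ℤ ℤ.+ val c ℤ.- val d  ≡⟨ cong (ℤ._- val d) (ℤ.+-identityˡ (val c)) ⟩
  val c ℤ.- val d  ∎
  where
  open ≡-Reasoning
  k = suc (length us + β)

-- The length condition makes the downsteps use up the item, so its polynomial is among those
-- emitted. Later downsteps act at lower heights, hence the coefficient left by an upstep and its
-- downstep survives into the emitted polynomial (`downs-emits`), where its vanishing modulo p gives
-- equal types.
cancel-null : ∀ {p} → 2 ≤ p → ∀ {t t′ us ds S T U D} → Above t t′ us S T → length us ≤ length ds →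
              downs ds T ≡ just (U , D) → All (Null p) D → ∃[ us′ ] ∃[ ds′ ] Cancel us ds us′ ds′
cancel-null p≥2 (same _) _ _ _ = _ , _ , nilˡ
cancel-null {p} p≥2 {ds = d ∷ ds} (over {c} {[]} {P} {S = S} o refl eq l g) (s≤s le) run ns
  with bind-just {just (S , _)} {downs ds} run
... | _ , _ , F , refl , _ , refl
  with val-≡ p≥2 c d (subst (+ p ∣ℤ_) (lower-coef {c} {[]} {P} d eq) (null⇒coef (All.head ns) _))
...   | refl = _ , _ , same nilˡ
cancel-null {p} p≥2 {ds = d ∷ ds} (over {c} {us@(c′ ∷ vs)} {P} {f = f} {S = S} o refl eq l g) (s≤s le) run ns
  with bind-just {just (item (P ⊕ mono (- val d) (suc (length us + height S))) (length vs) f ∷ S , [])} {downs ds} run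
... | _ , _ , F , refl , run′ , refl
  with val-≡ p≥2 c d (subst (+ p ∣ℤ_) (lower-coef {c} {us} {P} d eq)
         (null-coef {P = P ⊕ mono (- val d) (suc (length us + height S))} ns (downs-emits ds le run′) ≤-refl))
...   | refl with cancel-null p≥2 (over o refl (lower-top {c} {us} {P} refl eq) l g) le run′ ns
...     | _ , _ , x = _ , _ , same x

sim-justʳ : ∀ {R A T E} → Sim R A (just (T , E)) → ∃[ S ] ∃[ D ] (A ≡ just (S , D) × R S T × Pad D E)
sim-justʳ (both-ok r x) = _ , _ , refl , r , x

old-mono : ∀ {t t′ S} → t ≤ t′ → Old t S → Old t′ S
old-mono t≤t′ = All.map (λ x → ≤-trans x t≤t′)

mergeTop-preserves-old : ∀ s {t} S → Old t S → Old t (mergeTop s S)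
mergeTop-preserves-old s []      o = o
mergeTop-preserves-old s (I ∷ []) o = o
mergeTop-preserves-old s (I ∷ J ∷ S) (x ∷ o) with s ℕ.<? first I | s ℕ.<? first J
... | yes _ | yes _ = All.head o ∷ All.tail o
... | yes _ | no _  = x ∷ o
... | no _  | yes _ = x ∷ o
... | no _  | no _  = x ∷ o

srun-old : ∀ {i} (τ : Tree i) {t S T D} → Old t S → srun τ t S ≡ just (T , D) → Old (t + 2 ^ i) T
srun-old (leaf (opening c))  {t} o refl = ≤-reflexive (+-comm 1 t) ∷ old-mono (m≤m+n t 1) o
srun-old (leaf (closing c)) {t} {item P zero f ∷ S}    (x ∷ o) refl = old-mono (m≤m+n t 1) o
srun-old (leaf (closing c)) {t} {item P (suc q) f ∷ S} (x ∷ o) refl = old-mono (m≤m+n t 1) (x ∷ o)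
srun-old pad               {t} o refl = old-mono (m≤m+n t _) o
srun-old (node {i} l r)    {t} o eq with node-just l r eq
... | S₁ , S₂ , _ , _ , x , y , refl , _ =
  mergeTop-preserves-old t S₂ (subst (λ z → Old z S₂) (end t i) (srun-old r (srun-old l o x) y))

-- Of the pending upsteps of l and the pending downsteps of r, the shorter list is
-- used up by the other one, and the pass that reads it first checks its item.
null⇒red : ∀ {p} → 2 ≤ p → ∀ {i} (τ : Tree i) {t t′ S S′ T T′ D D′} → Old t S → Old t′ S′ →
           srun τ t S ≡ just (T , D) → srun (mirror τ) t′ S′ ≡ just (T′ , D′) →
           All (Null p) D → All (Null p) D′ → ∃[ ds ] ∃[ us ] Red τ ds us
null⇒red p≥2 (leaf (opening c))  _ _ _ _ _ _ = _ , _ , up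
null⇒red p≥2 (leaf (closing c)) _ _ _ _ _ _ = _ , _ , down
null⇒red p≥2 pad               _ _ _ _ _ _ = _ , _ , pad
null⇒red p≥2 (node {i} l r) {t} {t′} o o′ run run′ ns ns′
  with node-just l r run | node-just (mirror r) (mirror l) run′
... | S₁ , S₂ , E , F , x , y , _ , refl | S₁′ , S₂′ , F′ , E′ , y′ , x′ , _ , refl
  with All.++⁻ E ns | All.++⁻ F′ ns′
...   | nE , nF | nF′ , nE′
  with null⇒red p≥2 l o (srun-old (mirror r) o′ y′) x x′ nE nE′ | null⇒red p≥2 r (srun-old l o x) o′ y y′ nF nF′
...   | ds₁ , us₁ , redˡ | ds₂ , us₂ , redʳ with ℕ.≤-total (length us₁) (length ds₂)
...     | inj₁ le
  with sim-justʳ (subst (Sim _ _) x (red-sim redˡ t o))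
     | sim-justʳ (subst (Sim _ _) y (red-sim redʳ (t + 2 ^ i) (srun-old l o x)))
...       | _ , _ , _ , above , _ | _ , _ , dn , _ , pd =
  -- By `red-sim`, whatever the bare downsteps `ds₂` emit occurs among the polynomials F of the
  -- right half, so it is null as well.
  let _ , _ , c = cancel-null p≥2 above le dn (pad-all pd nF) in _ , _ , node redˡ redʳ c
null⇒red p≥2 (node {i} l r) {t} {t′} o o′ run run′ ns ns′
    | S₁ , S₂ , E , F , x , y , _ , refl | S₁′ , S₂′ , F′ , E′ , y′ , x′ , _ , refl
      | nE , nF | nF′ , nE′
      | ds₁ , us₁ , redˡ | ds₂ , us₂ , redʳ
        | inj₂ le
  with sim-justʳ (subst (Sim _ _) y′ (red-sim (red-mirror redʳ) t′ o′))
     | sim-justʳ (subst (Sim _ _) x′ (red-sim (red-mirror redˡ) (t′ + 2 ^ i) (srun-old (mirror r) o′ y′)))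
...       | _ , _ , _ , above , _ | _ , _ , dn , _ , pd =
  let _ , _ , c = cancel-null p≥2 above le dn (pad-all pd nE′) in _ , _ , node redˡ redʳ (cancel-sym c)

red-complete : ∀ {i} {τ : Tree i} → Red τ [] [] → ∃[ D ] (srun τ 0 [] ≡ just ([] , D) × All (_≈ []) D)
red-complete {τ = τ} x with srun τ 0 [] | red-sim x 0 []
... | just (_ , D) | both-ok (same _) y = D , refl , pad-zero y

-- A pending downstep would fail on the empty initial stack, and pending upsteps would leave an item
-- on the final one.
red-closed : ∀ {i} {τ : Tree i} {ds us D} → Red τ ds us → srun τ 0 [] ≡ just ([] , D) → Red τ [] []
red-closed {ds = ds} x eq with sim-justʳ (subst (Sim _ _) eq (red-sim x 0 []))
red-closed {ds = []} x eq | _ , _ , _ , same _ , _ = x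

-- Heights, sizes, and well-parenthesized words

mergeTop-height : ∀ s S → height (mergeTop s S) ≡ height S
mergeTop-height s []       = refl
mergeTop-height s (I ∷ []) = refl
mergeTop-height s (item P q f ∷ item P′ q′ f′ ∷ S) with s ℕ.<? f | s ℕ.<? f′
... | yes _ | yes _ = cong suc (trans (cong (_+ height S) (trans (ℕ.+-suc q′ q) (cong suc (+-comm q′ q))))
                        (trans (cong suc (+-assoc q q′ (height S))) (sym (ℕ.+-suc q (q′ + height S)))))
... | yes _ | no _  = refl
... | no _  | yes _ = refl
... | no _  | no _  = refl

srun-height : ∀ {i} (τ : Tree i) {t S T D} → srun τ t S ≡ just (T , D) → height T ≤ height S + length (yield τ)
srun-height (leaf (opening c))  {S = S} refl = ≤-reflexive (+-comm 1 (height S))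
srun-height (leaf (closing c)) {S = item P zero f ∷ S} refl = ℕ.m≤n⇒m≤1+n (m≤m+n _ 1)
srun-height (leaf (closing c)) {S = item P (suc q) f ∷ S} refl = ℕ.m≤n⇒m≤1+n (m≤m+n _ 1)
srun-height pad               {S = S} refl = m≤m+n _ 0
srun-height (node l r) {t} {S} eq with node-just l r eq
... | S₁ , S₂ , _ , _ , x , y , refl , _ = begin
  height (mergeTop t S₂)  ≡⟨ mergeTop-height t S₂ ⟩
  height S₂  ≤⟨ srun-height r y ⟩
  height S₁ + length (yield r)  ≤⟨ +-monoˡ-≤ _ (srun-height l x) ⟩
  height S + length (yield l) + length (yield r)  ≡⟨ +-assoc (height S) _ _ ⟩
  height S + (length (yield l) + length (yield r))  ≡⟨ cong (λ z → height S + z) (List.length-++ (yield l)) ⟨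
  height S + length (yield l ++ yield r)  ∎
  where open ℕ.≤-Reasoning

Short : ℕ → Poly → Set
Short m P = length P ≤ m

mergeTop-short : ∀ {m} s S → All (λ I → Short m (poly I)) S → All (λ I → Short m (poly I)) (mergeTop s S)
mergeTop-short s []       x = x
mergeTop-short s (I ∷ []) x = x
mergeTop-short s (I ∷ J ∷ S) (x ∷ y ∷ z) with s ℕ.<? first I | s ℕ.<? first J
... | yes _ | yes _ = length-⊕ (poly J) (poly I) y x ∷ z
... | yes _ | no _  = x ∷ y ∷ z
... | no _  | yes _ = x ∷ y ∷ z
... | no _  | no _  = x ∷ y ∷ z

-- Every exponent that is added is a height reached during the run, and the height grows by at most
-- one per letter. For an empty stack and n letters, m = n + 1 is allowed, so degrees are at most n.
srun-short : ∀ {i m} (τ : Tree i) {t S T D} → height S + length (yield τ) < m → All (λ I → Short m (poly I)) S →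
             srun τ t S ≡ just (T , D) → All (λ I → Short m (poly I)) T × All (Short m) D
srun-short {m = m} (leaf (opening c)) {S = S} h<m x refl =
  subst (_≤ m) (sym (length-mono (val c) (suc (height S)))) (subst (_≤ m) (cong suc (+-comm (height S) 1)) h<m) ∷ x , []
srun-short {m = m} (leaf (closing c)) {S = item P q f ∷ S} h<m (x ∷ xs) eq with
  length-⊕ P (mono (- val c) (suc (q + height S))) x
    (subst (_≤ m) (sym (length-mono (- val c) (suc (q + height S)))) (≤-trans (s≤s (m≤m+n _ 1)) h<m))
srun-short (leaf (closing c)) {S = item P zero f ∷ S}    h<m (x ∷ xs) refl | le = xs , le ∷ []
srun-short (leaf (closing c)) {S = item P (suc q) f ∷ S} h<m (x ∷ xs) refl | le = le ∷ xs , []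
srun-short pad h<m x refl = x , []
srun-short {m = m} (node l r) {t} {S} h<m x eq with node-just l r eq
... | S₁ , S₂ , _ , _ , y , z , refl , refl
  with srun-short l (ℕ.≤-<-trans (+-monoʳ-≤ (height S) (≤-trans (m≤m+n _ _)
    (≤-reflexive (sym (List.length-++ (yield l)))))) h<m) x y
... | x₁ , d₁
  with srun-short r (ℕ.≤-<-trans (≤-trans (+-monoˡ-≤ _ (srun-height l y))
                       (≤-reflexive (trans (+-assoc (height S) _ _)
                         (cong (λ z → height S + z) (sym (List.length-++ (yield l))))))) h<m) x₁ z
... | x₂ , d₂ = mergeTop-short t S₂ x₂ , All.++⁺ d₁ d₂

-- At most one new item per block

infix 4 _⊒_

-- The positions of the items of the second stack form a sublist of those of the first.
data _⊒_ : Stack → Stack → Set where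
  []   : [] ⊒ []
  keep : ∀ {I J S T} → first I ≡ first J → S ⊒ T → I ∷ S ⊒ J ∷ T
  drop : ∀ {I S T} → S ⊒ T → I ∷ S ⊒ T

⊒-refl : ∀ {S} → S ⊒ S
⊒-refl {[]}    = []
⊒-refl {I ∷ S} = keep refl ⊒-refl

⊒-trans : ∀ {S T U} → S ⊒ T → T ⊒ U → S ⊒ U
⊒-trans []         y          = y
⊒-trans (keep e x) (keep d y) = keep (trans e d) (⊒-trans x y)
⊒-trans (keep e x) (drop y)   = drop (⊒-trans x y)
⊒-trans (drop x)   y          = drop (⊒-trans x y)

⊒-old : ∀ {t S T} → S ⊒ T → Old t S → Old t T
⊒-old []            []      = []
⊒-old (keep refl x) (p ∷ o) = p ∷ ⊒-old x o
⊒-old (drop x)      (_ ∷ o) = ⊒-old x o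

⊒-length : ∀ {S T} → S ⊒ T → length T ≤ length S
⊒-length []         = z≤n
⊒-length (keep _ x) = s≤s (⊒-length x)
⊒-length (drop x)   = ℕ.m≤n⇒m≤1+n (⊒-length x)

data AtMostOneNew (t : ℕ) (S : Stack) : Stack → Set where
  old : ∀ {T} → S ⊒ T → AtMostOneNew t S T
  new : ∀ {I T} → t < first I → S ⊒ T → AtMostOneNew t S (I ∷ T)

atMostOneNew-length : ∀ {t S T} → AtMostOneNew t S T → length T ≤ suc (length S)
atMostOneNew-length (old x)   = ℕ.m≤n⇒m≤1+n (⊒-length x)
atMostOneNew-length (new _ x) = s≤s (⊒-length x)

-- This keeps the stack logarithmic. The cases are whether each half leaves an item of its own, and
-- whether the right half uses up that of the left. If both items remain, they are adjacent on top
-- and start in the block, so the merge turns them into one.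
srun-new : ∀ {i} (τ : Tree i) {t S T D} → Old t S → srun τ t S ≡ just (T , D) → AtMostOneNew t S T
srun-new (leaf (opening c))  o refl = new ≤-refl ⊒-refl
srun-new (leaf (closing c)) {S = item P zero f ∷ S}    o refl = old (drop ⊒-refl)
srun-new (leaf (closing c)) {S = item P (suc q) f ∷ S} o refl = old (keep refl ⊒-refl)
srun-new pad               o refl = old ⊒-refl
srun-new (node {i} l r) {t} {S} o eq with node-just l r eq
... | S₁ , S₂ , _ , _ , x , y , refl , _ with srun-new l o x | srun-new r (srun-old l o x) y
... | old u   | old v rewrite mergeTop-old (⊒-old (⊒-trans u v) o) = old (⊒-trans u v)
... | old u   | new {I} {T} l v = subst (AtMostOneNew t S) (sym (mergeTop-no {I = I} (⊒-old (⊒-trans u v) o)))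
                                    (new (ℕ.≤-<-trans (m≤m+n t _) l) (⊒-trans u v))
... | new l u | old (keep {J = J} refl v) = subst (AtMostOneNew t S)
  (sym (mergeTop-no {I = J} (⊒-old (⊒-trans u v) o))) (new l (⊒-trans u v))
... | new l u | old (drop v) rewrite mergeTop-old (⊒-old (⊒-trans u v) o) = old (⊒-trans u v)
... | new l u | new l′ (keep refl v) = subst (AtMostOneNew t S)
  (sym (mergeTop-yes (ℕ.≤-<-trans (m≤m+n t _) l′) l)) (new l (⊒-trans u v))
... | new l u | new {I} l′ (drop v) = subst (AtMostOneNew t S) (sym (mergeTop-no {I = I} (⊒-old (⊒-trans u v) o)))
                                        (new (ℕ.≤-<-trans (m≤m+n t _) l′) (⊒-trans u v))

-- Well-parenthesized words and reductions

step : Letter → Step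
step a = opening true
step ā = closing true
step b = opening false
step b̄ = closing false

swap : Letter → Letter
swap a = ā
swap ā = a
swap b = b̄
swap b̄ = b

step-swap : ∀ y → step (swap y) ≡ opposite (step y)
step-swap a = refl
step-swap ā = refl
step-swap b = refl
step-swap b̄ = refl

-- Chk st w st′: reading w turns the stack st of pending upsteps into st′.
data Chk : List Bool → List Step → List Bool → Set where
  []    : ∀ {st} → Chk st [] st
  opening  : ∀ {c st w st′} → Chk (c ∷ st) w st′ → Chk st (opening c ∷ w) st′
  closing : ∀ {c st w st′} → Chk st w st′ → Chk (c ∷ st) (closing c ∷ w) st′

chk-++ : ∀ {u w st st′ st″} → Chk st u st′ → Chk st′ w st″ → Chk st (u ++ w) st″
chk-++ []         y = y
chk-++ (opening x)  y = opening (chk-++ x y)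
chk-++ (closing x) y = closing (chk-++ x y)

chk-++⁻ : ∀ u {w st st″} → Chk st (u ++ w) st″ → ∃[ st′ ] (Chk st u st′ × Chk st′ w st″)
chk-++⁻ []             x          = _ , [] , x
chk-++⁻ (opening c ∷ u)  (opening x)  = let _ , y , z = chk-++⁻ u x in _ , opening y , z
chk-++⁻ (closing c ∷ u) (closing x) = let _ , y , z = chk-++⁻ u x in _ , closing y , z

-- Both sides describe the pending upsteps between two neighbouring blocks: as left by the first
-- block, and as met by the second. The converse is `cancel-exists`.
cancel-++ : ∀ {us ds us′ ds′} → Cancel us ds us′ ds′ → ∀ st → us ++ ds′ ++ st ≡ ds ++ us′ ++ st
cancel-++ nilˡ         st = refl
cancel-++ nilʳ         st = refl
cancel-++ (same {c} x) st = cong (c ∷_) (cancel-++ x st)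

cancel-exists : ∀ us ds {st st′} → us ++ st ≡ ds ++ st′ →
                ∃[ us′ ] ∃[ ds′ ] ∃[ rest ] (Cancel us ds us′ ds′ × st ≡ ds′ ++ rest × st′ ≡ us′ ++ rest)
cancel-exists []       ds       eq = [] , ds , _ , nilˡ , eq , refl
cancel-exists (u ∷ us) []       eq = u ∷ us , [] , _ , nilʳ , refl , sym eq
cancel-exists (u ∷ us) (d ∷ ds) eq with List.∷-injective eq
... | refl , eq′ with cancel-exists us ds eq′
...   | _ , _ , _ , x , y , z = _ , _ , _ , same x , y , z

red⇒chk : ∀ {i} {τ : Tree i} {ds us} → Red τ ds us → ∀ st → Chk (ds ++ st) (yield τ) (us ++ st)
red⇒chk up   st = opening []
red⇒chk down st = closing []
red⇒chk pad  st = []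
red⇒chk (node {ds = ds} {us} {ds₁} {us₁} {ds₂} {us₂} x y c) st
  rewrite List.++-assoc ds₁ ds st | List.++-assoc us₂ us st =
  chk-++ (red⇒chk x (ds ++ st)) (subst (λ z → Chk z _ _) (sym (cancel-++ c st)) (red⇒chk y (us ++ st)))

chk⇒red : ∀ {i} (τ : Tree i) {st st′} → Chk st (yield τ) st′ →
          ∃[ ds ] ∃[ us ] ∃[ rest ] (Red τ ds us × st ≡ ds ++ rest × st′ ≡ us ++ rest)
chk⇒red (leaf (opening c))  (opening [])  = _ , _ , _ , up , refl , refl
chk⇒red (leaf (closing c)) (closing []) = _ , _ , _ , down , refl , refl
chk⇒red pad               []          = _ , _ , _ , pad , refl , refl
chk⇒red (node l r) x with chk-++⁻ (yield l) x
... | _ , y , z with chk⇒red l y | chk⇒red r z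
...   | ds₁ , us₁ , rest₁ , p , refl , eq | ds₂ , us₂ , rest₂ , q , refl , refl with cancel-exists us₁ ds₂ (sym eq)
...     | us , ds , rest , c , refl , refl =
  _ , _ , rest , node p q c , sym (List.++-assoc ds₁ ds rest) , sym (List.++-assoc us₂ us rest)

dyck⇒chk : ∀ {x} → Dyck₂ x → ∀ st → Chk st (map step x) st
dyck⇒chk ε st = []
dyck⇒chk (aLāL {u} {v} p q) st rewrite List.map-++ step u (ā ∷ v) = opening
  (chk-++ (dyck⇒chk p (true ∷ st)) (closing (dyck⇒chk q st)))
dyck⇒chk (bLb̄L {u} {v} p q) st rewrite List.map-++ step u (b̄ ∷ v) = opening
  (chk-++ (dyck⇒chk p (false ∷ st)) (closing (dyck⇒chk q st)))

openL closeL : Bool → Letter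
openL true   = a
openL false  = b
closeL true  = ā
closeL false = b̄

dyck-cons : ∀ c {u v} → Dyck₂ u → Dyck₂ v → Dyck₂ (openL c ∷ u ++ closeL c ∷ v)
dyck-cons true  = aLāL
dyck-cons false = bLb̄L

-- A suffix of a well-parenthesized word is cut at the letters that close the pending upsteps; the
-- pieces in between are well-parenthesized.
data Closes : List Bool → List Letter → Set where
  []  : ∀ {v} → Dyck₂ v → Closes [] v
  _∷_ : ∀ {c st u v} → Dyck₂ u → Closes st v → Closes (c ∷ st) (u ++ closeL c ∷ v)

-- The new upstep is matched by the first closing letter, so the first two pieces join into one.
closes-open : ∀ c {st x} → Closes (c ∷ st) x → Closes st (openL c ∷ x)
closes-open c (p ∷ [] q) = [] (dyck-cons c p q)
closes-open c (_∷_ {u = u} p (_∷_ {c = d} {st} {u = u′} {v} q r)) =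
  subst (Closes (d ∷ st)) (cong (openL c ∷_) (List.++-assoc u (closeL c ∷ u′) (closeL d ∷ v))) (dyck-cons c p q ∷ r)

chk⇒closes : ∀ x {st} → Chk st (map step x) [] → Closes st x
chk⇒closes []      []         = [] ε
chk⇒closes (a ∷ x) (opening y)  = closes-open true (chk⇒closes x y)
chk⇒closes (ā ∷ x) (closing y) = ε ∷ chk⇒closes x y
chk⇒closes (b ∷ x) (opening y)  = closes-open false (chk⇒closes x y)
chk⇒closes (b̄ ∷ x) (closing y) = ε ∷ chk⇒closes x y

dyck⇒red : ∀ {i} (τ : Tree i) {x} → map step x ≡ yield τ → Dyck₂ x → Red τ [] []
dyck⇒red τ eq p with chk⇒red τ (subst (λ w → Chk [] w []) eq (dyck⇒chk p []))
... | [] , [] , [] , r , refl , refl = r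

red⇒dyck : ∀ {i} (τ : Tree i) {x} → map step x ≡ yield τ → Red τ [] [] → Dyck₂ x
red⇒dyck τ {x} eq r with chk⇒closes x (subst (λ w → Chk [] w []) (sym eq) (red⇒chk r []))
... | [] p = p

-- Resources of loop programs

n<2^bits : ∀ n → n < 2 ^ bits n
n<2^bits n = ℕ.≰⇒> λ le → ℕ.1+n≰n (≤-trans (≤-reflexive (sym (⌊log₂[2^n]⌋≡n (bits n)))) (⌊log₂⌋-mono-≤ le))

bits-< : ∀ {n} j → n < 2 ^ suc j → bits n ≤ suc j
bits-< {zero}        zero    l             = s≤s z≤n
bits-< {suc zero}    zero    l             = s≤s z≤n
bits-< {suc (suc n)} zero    (s≤s (s≤s ()))
bits-< {n}           (suc j) l = s≤s (begin
  ⌊log₂ n ⌋  ≤⟨ ℕ.m≤n+m∸n ⌊log₂ n ⌋ 1 ⟩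
  suc (⌊log₂ n ⌋ ∸ 1)  ≡⟨ cong suc (⌊log₂⌊n/2⌋⌋≡⌊log₂n⌋∸1 n) ⟨
  bits ⌊ n /2⌋  ≤⟨ bits-< j half ⟩
  suc j  ∎)
  where
  open ℕ.≤-Reasoning
  half : ⌊ n /2⌋ < 2 ^ suc j
  half = ℕ.≰⇒> λ le → ℕ.<⇒≱ l (begin
    2 ^ suc j + (2 ^ suc j + 0)  ≡⟨ cong (λ z → 2 ^ suc j + z) (+-identityʳ _) ⟩
    2 ^ suc j + 2 ^ suc j  ≤⟨ +-mono-≤ le (≤-trans le (ℕ.⌊n/2⌋≤⌈n/2⌉ n)) ⟩
    ⌊ n /2⌋ + ⌈ n /2⌉  ≡⟨ ℕ.⌊n/2⌋+⌈n/2⌉≡n n ⟩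
    n  ∎)

bits-mono : ∀ {m n} → m ≤ n → bits m ≤ bits n
bits-mono m≤n = s≤s (⌊log₂⌋-mono-≤ m≤n)

bits-* : ∀ m n → bits (m * n) ≤ bits m + bits n
bits-* m n = bits-< (⌊log₂ m ⌋ + bits n) (subst (m * n <_) (sym (ℕ.^-distribˡ-+-* 2 (bits m) (bits n)))
  (ℕ.*-mono-< (n<2^bits m) (n<2^bits n)))

bits-+ : ∀ m n → bits (m + n) ≤ bits m + bits n
bits-+ m n = bits-< (⌊log₂ m ⌋ + bits n) (ℕ.<-≤-trans (ℕ.+-mono-< (n<2^bits m) (n<2^bits n)) (begin
  2 ^ bits m + 2 ^ bits n  ≤⟨ sum≤product (2 ^ ⌊log₂ m ⌋) (2 ^ ⌊log₂ n ⌋) (>-nonZero (ℕ.m^n>0 2 ⌊log₂ m ⌋))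
    (>-nonZero (ℕ.m^n>0 2 ⌊log₂ n ⌋)) ⟩
  2 ^ bits m * 2 ^ bits n  ≡⟨ ℕ.^-distribˡ-+-* 2 (bits m) (bits n) ⟨
  2 ^ (bits m + bits n)  ∎))
  where
  open ℕ.≤-Reasoning
  sum≤product : ∀ x y → NonZero x → NonZero y → 2 * x + 2 * y ≤ (2 * x) * (2 * y)
  sum≤product (suc x) (suc y) _ _ = subst (2 * suc x + 2 * suc y ≤_) (expand x y) (m≤m+n _ _)
    where
    expand : ∀ x y → 2 * suc x + 2 * suc y + (2 * x + 2 * y + 4 * (x * y)) ≡ (2 * suc x) * (2 * suc y)
    expand = solve-∀

n≤2^⌈log₂n⌉ : ∀ n → n ≤ 2 ^ ⌈log₂ n ⌉
n≤2^⌈log₂n⌉ n = go ⌈log₂ n ⌉ n refl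
  where
  open ℕ.≤-Reasoning
  go : ∀ j n → ⌈log₂ n ⌉ ≡ j → n ≤ 2 ^ j
  go zero    zero          eq = z≤n
  go zero    (suc zero)    eq = s≤s z≤n
  go zero    (suc (suc n)) eq = ⊥-elim (ℕ.<⇒≢ (⌈log₂⌉-mono-≤ {2} {suc (suc n)} (s≤s (s≤s z≤n))) (sym eq))
  go (suc j) n             eq = begin
    n  ≡⟨ ℕ.⌊n/2⌋+⌈n/2⌉≡n n ⟨
    ⌊ n /2⌋ + ⌈ n /2⌉  ≤⟨ +-mono-≤ (≤-trans (ℕ.⌊n/2⌋≤⌈n/2⌉ n) half) half ⟩
    2 ^ j + 2 ^ j  ≡⟨ cong (λ z → 2 ^ j + z) (+-identityʳ _) ⟨
    2 ^ suc j  ∎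
    where
    half : ⌈ n /2⌉ ≤ 2 ^ j
    half = go j ⌈ n /2⌉ (trans (⌈log₂⌈n/2⌉⌉≡⌈log₂n⌉∸1 n) (cong (_∸ 1) eq))

⌈log₂n⌉≤bits : ∀ n → ⌈log₂ n ⌉ ≤ bits n
⌈log₂n⌉≤bits n = subst (⌈log₂ n ⌉ ≤_) (⌈log₂2^n⌉≡n (bits n)) (⌈log₂⌉-mono-≤ (<⇒≤ (n<2^bits n)))

n<2^n : ∀ n → n < 2 ^ n
n<2^n zero    = s≤s z≤n
n<2^n (suc n) = subst (λ z → suc n < 2 ^ n + z) (sym (+-identityʳ _)) (+-mono-≤ (ℕ.m^n>0 2 n) (n<2^n n))

⌈log₂n⌉≤n : ∀ n → ⌈log₂ n ⌉ ≤ n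
⌈log₂n⌉≤n n = subst (⌈log₂ n ⌉ ≤_) (⌈log₂2^n⌉≡n n) (⌈log₂⌉-mono-≤ (<⇒≤ (n<2^n n)))

module _ {A : Set} (P : A → Set) where

  lookup-update : ∀ {n} (xs : Vec A n) i {x} → (∀ j → P (lookup xs j)) → P x → ∀ j → P (lookup (xs [ i ]≔ x) j)
  lookup-update xs i {x} ps px j with j Fin.≟ i
  ... | yes refl = subst P (sym (Vec.lookup∘update i xs x)) px
  ... | no  j≢i  = subst P (sym (Vec.lookup∘update′ j≢i xs x)) (ps j)

sum-map-≤ : ∀ {A : Set} (g : A → ℕ) {m} {n} (xs : Vec A n) → (∀ j → g (lookup xs j) ≤ m) → Vec.sum
  (Vec.map g xs) ≤ n * m
sum-map-≤ g []       h = z≤n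
sum-map-≤ g (x ∷ xs) h = +-mono-≤ (h zero) (sum-map-≤ g xs (λ j → h (suc j)))

sum-bits-≤ : ∀ {m v xs} → All (_≤ v) xs → length xs ≤ m → sum (List.map bits xs) ≤ m * bits v
sum-bits-≤ []       l       = z≤n
sum-bits-≤ (x ∷ xs) (s≤s l) = +-mono-≤ (bits-mono x) (sum-bits-≤ xs l)

open Machine 21 2 letterCode renaming (Stack to StackName; run to runMachine)

-- Static bounds: with all registers of at most w bits, the value of e has at most
-- width e * w bits, and its cost is at most weight e * w².
width : Expr → ℕ
width (lit x)  = bits x
width (var x)  = 1
width (e :+ f) = width e + width f
width (e :- f) = width e
width (e :* f) = width e + width f
width (e :/ f) = width e
width (e :% f) = width e
width ⌈lg e ⌉  = width e

weight : Expr → ℕ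
weight (lit x)  = bits x
weight (var x)  = 1
weight (e :+ f) = weight e + weight f + width e * width f
weight (e :- f) = weight e + weight f + width e * width f
weight (e :* f) = weight e + weight f + width e * width f
weight (e :/ f) = weight e + weight f + width e * width f
weight (e :% f) = weight e + weight f + width e * width f
weight ⌈lg e ⌉  = weight e + width e

width≤weight : ∀ e → width e ≤ weight e
width≤weight (lit x)  = ≤-refl
width≤weight (var x)  = ≤-refl
width≤weight (e :+ f) = ≤-trans (+-mono-≤ (width≤weight e) (width≤weight f)) (m≤m+n _ _)
width≤weight (e :- f) = ≤-trans (width≤weight e) (≤-trans (m≤m+n _ _) (m≤m+n _ _))
width≤weight (e :* f) = ≤-trans (+-mono-≤ (width≤weight e) (width≤weight f)) (m≤m+n _ _)
width≤weight (e :/ f) = ≤-trans (width≤weight e) (≤-trans (m≤m+n _ _) (m≤m+n _ _))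
width≤weight (e :% f) = ≤-trans (width≤weight e) (≤-trans (m≤m+n _ _) (m≤m+n _ _))
width≤weight ⌈lg e ⌉  = m≤n+m (width e) (weight e)

testWeight : Test → ℕ
testWeight (e :≤ f)     = weight e + weight f + width e * width f
testWeight (e :≡ f)     = weight e + weight f + width e * width f
testWeight (s :∧ t)     = testWeight s + testWeight t
testWeight (s :∨ t)     = testWeight s + testWeight t
testWeight (nonEmpty K) = 1

-- The time bound gives each loop a factor w, so this is the exponent added to w². Loops are added
-- up even over the branches of a conditional: the step for a letter contains `power` in both
-- branches, which brings its exponent to 4.
loops : Cmd → ℕ
loops (c ⨾ d)               = loops c + loops d
loops (if t then c else d) = loops c + loops d
loops (repeat e c)         = suc (loops c)
loops _                    = 0

cmdWeight : Cmd → ℕ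
cmdWeight skip                   = 0
cmdWeight reject                 = 1
cmdWeight (x ≔ e)                = weight e
cmdWeight (push K e)             = weight e
cmdWeight (pop K x)              = 1
cmdWeight (c ⨾ d)                = cmdWeight c + cmdWeight d
cmdWeight (if t then c else d)  = testWeight t + (cmdWeight c + cmdWeight d)
cmdWeight (repeat e c)          = weight e + (width e + cmdWeight c)
cmdWeight _                     = 0

-- Values and tests depend only on the registers and stacks, so preconditions can be predicates on
-- these two, independent of the clock, the input and the meters.
at : Vec ℕ 21 → Vec (List ℕ) 2 → Config
at r s = config r s [] 0 0 0

eval-at : ∀ e σ → eval e σ ≡ eval e (at (regs σ) (stks σ))
eval-at (lit x)  σ = refl
eval-at (var x)  σ = refl
eval-at (e :+ f) σ = cong₂ _+_ (eval-at e σ) (eval-at f σ)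
eval-at (e :- f) σ = cong₂ _∸_ (eval-at e σ) (eval-at f σ)
eval-at (e :* f) σ = cong₂ _*_ (eval-at e σ) (eval-at f σ)
eval-at (e :/ f) σ = cong₂ _/₀_ (eval-at e σ) (eval-at f σ)
eval-at (e :% f) σ = cong₂ _%₀_ (eval-at e σ) (eval-at f σ)
eval-at ⌈lg e ⌉  σ = cong ⌈log₂_⌉ (eval-at e σ)

test-at : ∀ t σ → test t σ ≡ test t (at (regs σ) (stks σ))
test-at (e :≤ f)     σ = cong₂ _≤ᵇ_ (eval-at e σ) (eval-at f σ)
test-at (e :≡ f)     σ = cong₂ _≡ᵇ_ (eval-at e σ) (eval-at f σ)
test-at (s :∧ t)     σ = cong₂ Bool._∧_ (test-at s σ) (test-at t σ)
test-at (s :∨ t)     σ = cong₂ Bool._∨_ (test-at s σ) (test-at t σ)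
test-at (nonEmpty K) σ = refl

/₀-≤ : ∀ x y → x /₀ y ≤ x
/₀-≤ x zero    = z≤n
/₀-≤ x (suc y) = ℕ.m/n≤m x (suc y)

%₀-≤ : ∀ x y → x %₀ y ≤ x
%₀-≤ x zero    = z≤n
%₀-≤ x (suc y) = ℕ.m%n≤m x (suc y)

-- Weakest preconditions with limits on time and space

data Sat : Outcome → (Config → Set) → (Config → Set) → Set₁ where
  runs  : ∀ {σ P R} → P σ → Sat (running σ) P R
  halts : ∀ {σ P R} → R σ → Sat (rejected σ) P R

sat-bind : ∀ {o g P P′ R R′} → Sat o P R → (∀ {σ} → P σ → Sat (g σ) P′ R′) → (∀ {σ} → R σ → R′ σ) → Sat (o >>= g) P′ R′
sat-bind (runs p)  h k = h p
sat-bind (halts r) h k = halts (k r)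

sat-map : ∀ {o P P′ R R′} → Sat o P R → (∀ {σ} → P σ → P′ σ) → (∀ {σ} → R σ → R′ σ) → Sat o P′ R′
sat-map (runs p)  h k = runs (h p)
sat-map (halts r) h k = halts (k r)

-- V bounds all values, w their numbers of bits, L the lengths of the stacks, TM the
-- time and SM the space.
module Limits (V w L TM SM : ℕ) (w≡ : bits V ≡ w) where

  instance
    w≢0 : NonZero w
    w≢0 = subst NonZero w≡ _

  Pred : Set₁
  Pred = Vec ℕ 21 → Vec (List ℕ) 2 → Set

  iter : ℕ → (Pred → Pred) → Pred → Pred
  iter zero    T Q = Q
  iter (suc i) T Q = T (iter i T Q)

  afterPop : StackName → Reg → List ℕ → Pred → Pred
  afterPop K x []       Q r s = Q r s
  afterPop K x (v ∷ vs) Q r s = Q (r [ x ]≔ v) (s [ K ]≔ vs)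

  -- Weakest preconditions for the commands without read, rec and self, which also ask
  -- for the limits: R is to hold on rejection.
  wp : Cmd → Pred → Set → Pred
  wp skip                   Q R r s = Q r s
  wp reject                 Q R r s = R
  wp (x ≔ e)                Q R r s = eval e (at r s) ≤ V × Q (r [ x ]≔ eval e (at r s)) s
  wp (push K e)             Q R r s = eval e (at r s) ≤ V × suc (length (lookup s K)) ≤ L ×
                                      Q r (s [ K ]≔ (eval e (at r s) ∷ lookup s K))
  wp (pop K x)              Q R r s = afterPop K x (lookup s K) Q r s
  wp (c ⨾ d)                Q R r s = wp c (wp d Q R) R r s
  wp (if t then c else d)  Q R r s = (test t (at r s) ≡ true → wp c Q R r s) ×
                                      (test t (at r s) ≡ false → wp d Q R r s)
  wp (repeat e c)          Q R r s = eval e (at r s) ≤ w × iter (eval e (at r s)) (λ P → wp c P R) Q r s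
  wp _                     Q R r s = ⊥

  StackOk : List ℕ → Set
  StackOk xs = All (_≤ V) xs × length xs ≤ L

  record Ok (σ : Config) : Set where
    field
      regsOk  : ∀ x → lookup (regs σ) x ≤ V
      stksOk  : ∀ K → StackOk (lookup (stks σ) K)
      timeOk  : time σ ≤ TM
      spaceOk : space σ ≤ SM

  open Ok

  bits-≤w : ∀ {v} → v ≤ V → bits v ≤ w
  bits-≤w {v} v≤V = subst (bits v ≤_) w≡ (bits-mono v≤V)

  Z : ℕ
  Z = 21 * w + 2 * (L * w)

  sizeOf-≤ : ∀ {σ} → Ok σ → sizeOf σ ≤ Z
  sizeOf-≤ {σ} ok = +-mono-≤ (sum-map-≤ bits (regs σ) (λ x → bits-≤w (regsOk ok x)))
    (sum-map-≤ (λ xs → sum (List.map bits xs)) (stks σ) (λ K → subst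
      (λ z → sum (List.map bits (lookup (stks σ) K)) ≤ L * z) w≡
      (sum-bits-≤ (proj₁ (stksOk ok K)) (proj₂ (stksOk ok K)))))

  RegsOk : Config → Set
  RegsOk σ = ∀ x → lookup (regs σ) x ≤ V

  x≤x*w : ∀ x → x ≤ x * w
  x≤x*w x = ℕ.m≤m*n x w

  bits-eval : ∀ e {σ} → RegsOk σ → bits (eval e σ) ≤ width e * w
  bits-eval (lit x)  {σ} h = x≤x*w (bits x)
  bits-eval (var x)  {σ} h = ≤-trans (bits-≤w (h x)) (≤-reflexive (sym (*-identityˡ w)))
  bits-eval (e :+ f) {σ} h = ≤-trans (bits-+ (eval e σ) (eval f σ))
    (≤-trans (+-mono-≤ (bits-eval e h) (bits-eval f h)) (≤-reflexive (sym (ℕ.*-distribʳ-+ w (width e) _))))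
  bits-eval (e :- f) {σ} h = ≤-trans (bits-mono (ℕ.m∸n≤m (eval e σ) (eval f σ))) (bits-eval e h)
  bits-eval (e :* f) {σ} h = ≤-trans (bits-* (eval e σ) (eval f σ))
    (≤-trans (+-mono-≤ (bits-eval e h) (bits-eval f h)) (≤-reflexive (sym (ℕ.*-distribʳ-+ w (width e) _))))
  bits-eval (e :/ f) {σ} h = ≤-trans (bits-mono (/₀-≤ (eval e σ) (eval f σ))) (bits-eval e h)
  bits-eval (e :% f) {σ} h = ≤-trans (bits-mono (%₀-≤ (eval e σ) (eval f σ))) (bits-eval e h)
  bits-eval ⌈lg e ⌉  {σ} h = ≤-trans (bits-mono (⌈log₂n⌉≤n (eval e σ))) (bits-eval e h)

  x*w≤x*w² : ∀ x → x * w ≤ x * (w * w)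
  x*w≤x*w² x = *-monoʳ-≤ x (x≤x*w w)

  op-≤ : ∀ e f {σ x y} → RegsOk σ → x ≤ weight e * (w * w) → y ≤ weight f * (w * w) →
         x + y + opCost e f σ ≤ (weight e + weight f + width e * width f) * (w * w)
  op-≤ e f {σ} {x} {y} h p q = begin
    x + y + bits (eval e σ) * bits (eval f σ)
      ≤⟨ +-mono-≤ (+-mono-≤ p q) (*-mono-≤ (bits-eval e h) (bits-eval f h)) ⟩
    weight e * (w * w) + weight f * (w * w) + width e * w * (width f * w)
      ≡⟨ collect (weight e) (weight f) (width e) (width f) w ⟩
    (weight e + weight f + width e * width f) * (w * w) ∎
    where
    open ℕ.≤-Reasoning
    collect : ∀ a b c d w → a * (w * w) + b * (w * w) + c * w * (d * w) ≡ (a + b + c * d) * (w * w)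
    collect = solve-∀

  cost-≤ : ∀ e {σ} → RegsOk σ → cost e σ ≤ weight e * (w * w)
  cost-≤ (lit x)  h = ≤-trans (x≤x*w (bits x)) (x*w≤x*w² (bits x))
  cost-≤ (var x)  {σ} h = ≤-trans (bits-eval (var x) {σ} h) (x*w≤x*w² 1)
  cost-≤ (e :+ f) h = op-≤ e f h (cost-≤ e h) (cost-≤ f h)
  cost-≤ (e :- f) h = op-≤ e f h (cost-≤ e h) (cost-≤ f h)
  cost-≤ (e :* f) h = op-≤ e f h (cost-≤ e h) (cost-≤ f h)
  cost-≤ (e :/ f) h = op-≤ e f h (cost-≤ e h) (cost-≤ f h)
  cost-≤ (e :% f) h = op-≤ e f h (cost-≤ e h) (cost-≤ f h)
  cost-≤ ⌈lg e ⌉  h = ≤-trans (+-mono-≤ (cost-≤ e h) (≤-trans (bits-eval e h) (x*w≤x*w² (width e))))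
                        (≤-reflexive (sym (ℕ.*-distribʳ-+ (w * w) (weight e) _)))

  testCost-≤ : ∀ t {σ} → RegsOk σ → testCost t σ ≤ testWeight t * (w * w)
  testCost-≤ (e :≤ f)     h = op-≤ e f h (cost-≤ e h) (cost-≤ f h)
  testCost-≤ (e :≡ f)     h = op-≤ e f h (cost-≤ e h) (cost-≤ f h)
  testCost-≤ (s :∧ t)     h = ≤-trans (+-mono-≤ (testCost-≤ s h) (testCost-≤ t h))
    (≤-reflexive (sym (ℕ.*-distribʳ-+ (w * w) (testWeight s) _)))
  testCost-≤ (s :∨ t)     h = ≤-trans (+-mono-≤ (testCost-≤ s h) (testCost-≤ t h))
    (≤-reflexive (sym (ℕ.*-distribʳ-+ (w * w) (testWeight s) _)))
  testCost-≤ (nonEmpty K) h = ≤-trans (x≤x*w 1) (x*w≤x*w² 1)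

  charge-ok : ∀ {σ k c c′} → Ok σ → c ≤ c′ → k + Z + c′ ≤ SM → clock σ + c ≤ TM → Ok (charge k c σ)
  charge-ok {σ} {k} {c} ok c≤ sp tm = record
    { regsOk  = regsOk ok
    ; stksOk  = stksOk ok
    ; timeOk  = ℕ.⊔-lub (timeOk ok) tm
    ; spaceOk = ℕ.⊔-lub (spaceOk ok) (≤-trans (≤-reflexive (sym (+-assoc k (sizeOf σ) c)))
                  (≤-trans (+-mono-≤ (+-monoʳ-≤ k (sizeOf-≤ ok)) c≤) sp))
    }

  setReg-ok : ∀ {σ x v} → Ok σ → v ≤ V → Ok (setReg x v σ)
  setReg-ok {σ} {x} ok v≤V = record
    { regsOk = lookup-update (_≤ V) (regs σ) x (regsOk ok) v≤V ; stksOk = stksOk ok ; timeOk = timeOk ok ;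
      spaceOk = spaceOk ok }

  setStack-ok : ∀ {σ K xs} → Ok σ → StackOk xs → Ok (setStack K xs σ)
  setStack-ok {σ} {K} ok xs = record
    { regsOk = regsOk ok ; stksOk = lookup-update StackOk (stks σ) K (stksOk ok) xs ; timeOk = timeOk ok ;
      spaceOk = spaceOk ok }

  record Spent (d : ℕ) (σ σ′ : Config) : Set where
    constructor spent
    field
      ok    : Ok σ′
      clk   : clock σ′ ≤ clock σ + d
      input≡ : input σ′ ≡ input σ

  spent-trans : ∀ {d d′ σ σ′ σ″} → Spent d σ σ′ → Spent d′ σ′ σ″ → Spent (d + d′) σ σ″
  spent-trans {d} {d′} {σ} (spent _ c i) (spent o c′ i′) =
    spent o (≤-trans c′ (≤-trans (+-monoˡ-≤ d′ c) (≤-reflexive (+-assoc (clock σ) d d′)))) (trans i′ i)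

  spent-mono : ∀ {d d′ σ σ′} → d ≤ d′ → Spent d σ σ′ → Spent d′ σ σ′
  spent-mono {σ = σ} le (spent o c i) = spent o (≤-trans c (+-monoʳ-≤ (clock σ) le)) i

  Within : Config → Set
  Within σ = time σ ≤ TM × space σ ≤ SM

  -- Every loop runs at most w times.
  cmdTime : Cmd → ℕ
  cmdTime c = cmdWeight c * w ^ (2 + loops c)

  w^-mono : ∀ {i j} → i ≤ j → w ^ i ≤ w ^ j
  w^-mono = ℕ.^-monoʳ-≤ w

  w*w≤ : ∀ i → w * w ≤ w ^ (2 + i)
  w*w≤ i = ≤-trans (≤-reflexive (cong (λ z → w * z) (sym (*-identityʳ w)))) (w^-mono {2} {2 + i} (s≤s (s≤s z≤n)))

  weaken : ∀ {x i} y j → x * w ^ (2 + i) ≤ x * w ^ (2 + (i + j)) × y * w ^ (2 + j) ≤ y * w ^ (2 + (i + j))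
  weaken {x} {i} y j = *-monoʳ-≤ x (w^-mono (s≤s (s≤s (m≤m+n i j)))) , *-monoʳ-≤ y (w^-mono (s≤s (s≤s (m≤n+m j i))))

  cmdTime-+ : ∀ c d → cmdTime c + cmdTime d ≤ (cmdWeight c + cmdWeight d) * w ^ (2 + (loops c + loops d))
  cmdTime-+ c d = ≤-trans (+-mono-≤ (proj₁ (weaken {cmdWeight c} {loops c} (cmdWeight d) (loops d)))
    (proj₂ (weaken {cmdWeight c} {loops c} (cmdWeight d) (loops d))))
    (≤-reflexive (sym (ℕ.*-distribʳ-+ (w ^ (2 + (loops c + loops d))) (cmdWeight c) _)))

  Post : Pred → ℕ → Config → Config → Set
  Post Q d σ σ′ = Q (regs σ′) (stks σ′) × Spent d σ σ′

  spaceˡ : ∀ {k} x y → k + Z + (x + y) * (w * w) ≤ SM → k + Z + x * (w * w) ≤ SM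
  spaceˡ {k} x y sp = ≤-trans (+-monoʳ-≤ (k + Z) (*-monoˡ-≤ (w * w) (m≤m+n x y))) sp

  spaceʳ : ∀ {k} x y → k + Z + (x + y) * (w * w) ≤ SM → k + Z + y * (w * w) ≤ SM
  spaceʳ {k} x y sp = ≤-trans (+-monoʳ-≤ (k + Z) (*-monoˡ-≤ (w * w) (m≤n+m y x))) sp

  assign-≤ : ∀ x → x * (w * w) ≤ x * w ^ 2
  assign-≤ x = *-monoʳ-≤ x (w*w≤ 0)

  iterate-sound : ∀ {c : Behaviour} {T : Pred → Pred} {R k v d x} →
    (∀ {Q σ} → T Q (regs σ) (stks σ) → Ok σ → clock σ + d ≤ TM → Sat (c k σ) (Post Q d σ) (λ σ′ → R × Within σ′)) →
    v ≤ x → k + Z + x ≤ SM →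
    ∀ i {Q σ} → iter i T Q (regs σ) (stks σ) → Ok σ → clock σ + i * (v + d) ≤ TM →
    Sat (iterateFor v i c k σ) (Post Q (i * (v + d)) σ) (λ σ′ → R × Within σ′)
  iterate-sound body v≤ sp zero    {σ = σ} q ok tm = runs (q , spent ok (m≤m+n (clock σ) 0) refl)
  iterate-sound {c} {R = R} {k} {v} {d} body v≤ sp (suc i) {Q} {σ} q ok tm =
    sat-bind (body q ok₁ (≤-trans (≤-reflexive (+-assoc (clock σ) v d)) (≤-trans (+-monoʳ-≤ (clock σ) (m≤m+n _ _)) tm)))
      (λ (q′ , s) → sat-map (iterate-sound {c = c} {R = R} body v≤ sp i q′ (Spent.ok s)
          (≤-trans (+-monoˡ-≤ (i * (v + d)) (Spent.clk s))
            (≤-trans (≤-reflexive (assoc₂ (clock σ) v d (i * (v + d)))) tm)))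
          (λ (q″ , s′) → q″ , spent-trans (spent (Spent.ok s)
            (≤-trans (Spent.clk s) (≤-reflexive (+-assoc (clock σ) v d))) (Spent.input≡ s)) s′)
          (λ r → r))
      (λ r → r)
    where
    assoc₂ : ∀ a b c d → a + b + c + d ≡ a + (b + c + d)
    assoc₂ = solve-∀
    ok₁ : Ok (charge k v σ)
    ok₁ = charge-ok {k = k} ok v≤ sp (≤-trans (+-monoʳ-≤ (clock σ) (≤-trans (m≤m+n v d) (m≤m+n (v + d) _))) tm)

  repeat-≤ : ∀ e c {i v x} → x ≤ weight e * (w * w) → i ≤ w → v ≤ width e * w →
             x + i * (v + cmdTime c) ≤ (weight e + (width e + cmdWeight c)) * w ^ (2 + suc (loops c))
  repeat-≤ e c {i} {v} {x} p q r = begin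
    x + i * (v + cmdTime c)
      ≤⟨ +-mono-≤ (≤-trans p (*-monoʳ-≤ (weight e) (w*w≤ (suc l))))
        (*-mono-≤ q (+-monoˡ-≤ (cmdTime c) (≤-trans r (*-monoʳ-≤ (width e) w≤)))) ⟩
    weight e * (w * w ^ (2 + l)) + w * (width e * w ^ (2 + l) + cmdWeight c * w ^ (2 + l))
      ≡⟨ collect (weight e) (width e) (cmdWeight c) w (w ^ (2 + l)) ⟩
    (weight e + (width e + cmdWeight c)) * (w * w ^ (2 + l)) ∎
    where
    open ℕ.≤-Reasoning
    l = loops c
    w≤ : w ≤ w ^ (2 + l)
    w≤ = ≤-trans (≤-reflexive (sym (*-identityʳ w))) (w^-mono {1} {2 + l} (s≤s z≤n))
    collect : ∀ a b c w y → a * (w * y) + w * (b * y + c * y) ≡ (a + (b + c)) * (w * y)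
    collect = solve-∀

  popped-sound : ∀ {K x k σ} xs {Q} → StackOk xs → afterPop K x xs Q (regs σ) (stks σ) → Ok σ → k + Z + 1 *
    (w * w) ≤ SM → clock σ + 1 * w ^ 2 ≤ TM →
    Post Q (1 * w ^ 2) σ (popped K x xs k σ)
  popped-sound {K} {x} {k} {σ} [] s q ok sp tm = q , spent
    (charge-ok {k = k} ok one sp (≤-trans (+-monoʳ-≤ (clock σ) (≤-trans one (assign-≤ 1))) tm))
    (+-monoʳ-≤ (clock σ) (≤-trans one (assign-≤ 1))) refl
    where
    one : 1 ≤ 1 * (w * w)
    one = ≤-trans (x≤x*w 1) (x*w≤x*w² 1)
  popped-sound {K} {x} {k} {σ} (v ∷ vs) (v≤V ∷ vs≤V , len) q ok sp tm =
    q , spent (setStack-ok (setReg-ok (charge-ok {k = k} ok le sp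
      (≤-trans (+-monoʳ-≤ (clock σ) (≤-trans le (assign-≤ 1))) tm)) v≤V) (vs≤V , <⇒≤ len))
          (+-monoʳ-≤ (clock σ) (≤-trans le (assign-≤ 1))) refl
    where
    le : bits v ≤ 1 * (w * w)
    le = ≤-trans (≤-trans (bits-≤w v≤V) (≤-reflexive (sym (*-identityˡ w)))) (x*w≤x*w² 1)

  -- Space is a maximum and time a sum. At any moment registers and stacks take at most Z bits, so
  -- the space hypothesis only has to cover single steps and loop counters, by
  -- `cmdWeight c * (w * w)`; the time needs a further factor w for each loop.
  wp-sound : ∀ c {Q R self′ k σ} → wp c Q R (regs σ) (stks σ) → Ok σ →
             k + Z + cmdWeight c * (w * w) ≤ SM → clock σ + cmdTime c ≤ TM →
             Sat (exec c self′ k σ) (Post Q (cmdTime c) σ) (λ σ′ → R × Within σ′)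
  wp-sound skip {σ = σ} q ok sp tm = runs (q , spent ok (m≤m+n (clock σ) 0) refl)
  wp-sound reject {k = k} {σ} q ok sp tm = halts (q , timeOk ok′ , spaceOk ok′)
    where
    one : 1 ≤ 1 * (w * w)
    one = ≤-trans (x≤x*w 1) (x*w≤x*w² 1)
    ok′ = charge-ok {k = k} ok one sp (≤-trans (+-monoʳ-≤ (clock σ) (≤-trans one (assign-≤ 1))) tm)
  wp-sound (x ≔ e) {Q} {k = k} {σ} (v , q) ok sp tm rewrite eval-at e σ =
    runs (q , spent (setReg-ok (charge-ok {k = k} ok (cost-≤ e (regsOk ok)) sp
      (≤-trans (+-monoʳ-≤ (clock σ) le) tm)) v) (+-monoʳ-≤ (clock σ) le) refl)
    where le = ≤-trans (cost-≤ e (regsOk ok)) (assign-≤ (weight e))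
  wp-sound (push K e) {Q} {k = k} {σ} (v , l , q) ok sp tm rewrite eval-at e σ =
    runs (q , spent (setStack-ok (charge-ok {k = k} ok (cost-≤ e (regsOk ok)) sp
      (≤-trans (+-monoʳ-≤ (clock σ) le) tm)) (v ∷ proj₁ (stksOk ok K) , l)) (+-monoʳ-≤ (clock σ) le) refl)
    where le = ≤-trans (cost-≤ e (regsOk ok)) (assign-≤ (weight e))
  wp-sound (pop K x) {σ = σ} q ok sp tm = runs (popped-sound (lookup (stks σ) K) (stksOk ok K) q ok sp tm)
  wp-sound (c ⨾ d) {Q} {R} {self′} {k} {σ} q ok sp tm =
    sat-bind (wp-sound c {wp d Q R} {R} {self′} {k} {σ} q ok (spaceˡ {k} (cmdWeight c) (cmdWeight d) sp)
      (≤-trans (+-monoʳ-≤ (clock σ) (≤-trans (m≤m+n _ (cmdTime d)) (cmdTime-+ c d))) tm))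
      (λ {σ′} (q′ , s) → sat-map (wp-sound d {Q} {R} {self′} {k} {σ′} q′ (Spent.ok s)
        (spaceʳ {k} (cmdWeight c) (cmdWeight d) sp)
            (≤-trans (+-monoˡ-≤ (cmdTime d) (Spent.clk s))
              (≤-trans (≤-reflexive (+-assoc (clock σ) _ _))
              (≤-trans (+-monoʳ-≤ (clock σ) (cmdTime-+ c d)) tm))))
         (λ (q″ , s′) → q″ , spent-mono (cmdTime-+ c d) (spent-trans s s′)) (λ r → r))
      (λ r → r)
  wp-sound (if t then c else d) {Q} {R} {self′} {k} {σ} (qt , qf) ok sp tm rewrite test-at t σ = branch
    (test t (at (regs σ) (stks σ))) refl
    where
    tc : testCost t σ ≤ testWeight t * (w * w)
    tc = testCost-≤ t (regsOk ok)
    σ₁ = charge k (testCost t σ) σ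
    total : testCost t σ + (cmdTime c + cmdTime d) ≤ cmdTime (if t then c else d)
    total = ≤-trans (+-mono-≤ (≤-trans tc (*-monoʳ-≤ (testWeight t) (w*w≤ (loops c + loops d)))) (cmdTime-+ c d))
      (≤-reflexive (sym (ℕ.*-distribʳ-+ (w ^ (2 + (loops c + loops d))) (testWeight t) _)))
    spent₁ : Ok σ₁
    spent₁ = charge-ok {k = k} ok tc (spaceˡ {k} (testWeight t) (cmdWeight c + cmdWeight d) sp)
      (≤-trans (+-monoʳ-≤ (clock σ) (≤-trans (m≤m+n _ _) total)) tm)
    leˡ : testCost t σ + cmdTime c ≤ cmdTime (if t then c else d)
    leˡ = ≤-trans (+-monoʳ-≤ (testCost t σ) (m≤m+n (cmdTime c) _)) total
    leʳ : testCost t σ + cmdTime d ≤ cmdTime (if t then c else d)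
    leʳ = ≤-trans (+-monoʳ-≤ (testCost t σ) (m≤n+m (cmdTime d) _)) total
    clock₁ : ∀ {x} → testCost t σ + x ≤ cmdTime (if t then c else d) → clock σ₁ + x ≤ TM
    clock₁ le = ≤-trans (≤-reflexive (+-assoc (clock σ) _ _)) (≤-trans (+-monoʳ-≤ (clock σ) le) tm)
    step₁ : Spent (testCost t σ) σ σ₁
    step₁ = spent spent₁ ≤-refl refl
    branch : ∀ x → test t (at (regs σ) (stks σ)) ≡ x →
      Sat ((Bool.if x then exec c self′ k else exec d self′ k) σ₁) (Post Q (cmdTime (if t then c else d)) σ)
        (λ σ′ → R × Within σ′)
    branch true  eq = sat-map (wp-sound c {Q} {R} {self′} {k} {σ₁} (qt eq) spent₁
      (spaceˡ {k} (cmdWeight c) (cmdWeight d) (spaceʳ {k} (testWeight t) _ sp)) (clock₁ leˡ))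
      (λ (q , s) → q , spent-mono leˡ (spent-trans step₁ s)) (λ r → r)
    branch false eq = sat-map (wp-sound d {Q} {R} {self′} {k} {σ₁} (qf eq) spent₁
      (spaceʳ {k} (cmdWeight c) (cmdWeight d) (spaceʳ {k} (testWeight t) _ sp)) (clock₁ leʳ))
      (λ (q , s) → q , spent-mono leʳ (spent-trans step₁ s)) (λ r → r)
  wp-sound (repeat e c) {Q} {R} {self′} {k} {σ} (i≤ , q) ok sp tm rewrite sym (eval-at e σ) =
    sat-map (iterate-sound {exec c self′} {λ P → wp c P R} {R} {k + v} {v} {cmdTime c} {v}
        (λ {P} {σ′} q′ ok′ tm′ → wp-sound c {P} {R} {self′} {k + v} {σ′} q′ ok′
          (≤-trans (≤-reflexive (rot k v Z _)) (≤-trans (+-monoʳ-≤ (k + Z) inner) sp)) tm′)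
        ≤-refl
        (≤-trans (≤-reflexive (rot k v Z v)) (≤-trans (+-monoʳ-≤ (k + Z) counter) sp)) (eval e σ) {Q} {σ₁} q
        ok₁ (≤-trans (≤-reflexive (+-assoc (clock σ) _ _)) (≤-trans (+-monoʳ-≤ (clock σ) total) tm)))
      (λ (q′ , s) → q′ , spent-mono total (spent-trans (spent {cost e σ} ok₁ ≤-refl refl) s)) (λ r → r)
    where
    v = bits (eval e σ)
    σ₁ = charge k (cost e σ) σ
    ce = cost-≤ e (regsOk ok)
    ve = bits-eval e (regsOk ok)
    total : cost e σ + eval e σ * (v + cmdTime c) ≤ cmdTime (repeat e c)
    total = repeat-≤ e c ce i≤ ve
    ok₁ : Ok σ₁
    ok₁ = charge-ok {k = k} ok ce (spaceˡ {k} (weight e) _ sp)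
      (≤-trans (+-monoʳ-≤ (clock σ) (≤-trans (m≤m+n _ _) total)) tm)
    rot : ∀ a b c d → a + b + c + d ≡ a + c + (b + d)
    rot = solve-∀
    inner : v + cmdWeight c * (w * w) ≤ (weight e + (width e + cmdWeight c)) * (w * w)
    inner = begin
      v + cmdWeight c * (w * w)  ≤⟨ +-monoˡ-≤ _ (≤-trans ve (x*w≤x*w² (width e))) ⟩
      width e * (w * w) + cmdWeight c * (w * w)  ≡⟨ ℕ.*-distribʳ-+ (w * w) (width e) _ ⟨
      (width e + cmdWeight c) * (w * w)  ≤⟨ *-monoˡ-≤ (w * w) (m≤n+m _ (weight e)) ⟩
      (weight e + (width e + cmdWeight c)) * (w * w)  ∎
      where open ℕ.≤-Reasoning
    counter : v + v ≤ (weight e + (width e + cmdWeight c)) * (w * w)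
    counter = begin
      v + v  ≤⟨ +-mono-≤ (≤-trans ve (x*w≤x*w² (width e))) (≤-trans ve (x*w≤x*w² (width e))) ⟩
      width e * (w * w) + width e * (w * w)  ≡⟨ ℕ.*-distribʳ-+ (w * w) (width e) _ ⟨
      (width e + width e) * (w * w)  ≤⟨ *-monoˡ-≤ (w * w) (+-mono-≤ (width≤weight e) (m≤m+n (width e) (cmdWeight c))) ⟩
      (weight e + (width e + cmdWeight c)) * (w * w)  ∎
      where open ℕ.≤-Reasoning

-- The machine on one block

module A = Algorithm₃

≡ᵇ-true : ∀ {m n} → (m ≡ᵇ n) ≡ true → m ≡ n
≡ᵇ-true {m} {n} eq = ℕ.≡ᵇ⇒≡ m n (subst T (sym eq) tt)

≡ᵇ-false : ∀ {m n} → (m ≡ᵇ n) ≡ false → m ≢ n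
≡ᵇ-false {m} {n} eq m≡n = subst T eq (ℕ.≡⇒≡ᵇ m n m≡n)

≤ᵇ-true : ∀ {m n} → m ≤ n → (m ≤ᵇ n) ≡ true
≤ᵇ-true {m} {n} le with m ≤ᵇ n | ℕ.≤⇒≤ᵇ le
... | true | _ = refl

≤ᵇ-false : ∀ {m n} → n < m → (m ≤ᵇ n) ≡ false
≤ᵇ-false {m} {n} lt with m ≤ᵇ n in eq
... | false = refl
... | true  = ⊥-elim (ℕ.<⇒≱ lt (≤ᵇ⇒≤ m n (subst T (sym eq) tt)))

%₀≡% : ∀ x p .{{_ : NonZero p}} → x %₀ p ≡ x % p
%₀≡% x (suc p) = refl

module _ (p : ℕ) .{{_ : NonZero p}} where

  %-*ˡ : ∀ x y → (x % p * y) % p ≡ (x * y) % p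
  %-*ˡ x y = trans (ℕ.%-distribˡ-* (x % p) y p) (trans (cong (λ z → (z * (y % p)) % p) (ℕ.m%n%n≡m%n x p))
    (sym (ℕ.%-distribˡ-* x y p)))

  %-^ : ∀ x j → (x % p) ^ j % p ≡ x ^ j % p
  %-^ x zero    = refl
  %-^ x (suc j) = trans (%-*ˡ x ((x % p) ^ j)) (trans (cong (_% p) (ℕ.*-comm x _)) (trans (sym (%-*ˡ ((x % p) ^ j) x))
    (trans (cong (λ z → (z * x) % p) (%-^ x j)) (trans (%-*ˡ (x ^ j) x) (cong (_% p) (ℕ.*-comm (x ^ j) x))))))

  %-cong-*ˡ : ∀ x x′ y → x % p ≡ x′ % p → (x * y) % p ≡ (x′ * y) % p
  %-cong-*ˡ x x′ y eq = trans (sym (%-*ˡ x y)) (trans (cong (λ z → (z * y) % p) eq) (%-*ˡ x′ y))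

  %-cong-*ʳ : ∀ x y y′ → y % p ≡ y′ % p → (x * y) % p ≡ (x * y′) % p
  %-cong-*ʳ x y y′ eq = trans (cong (_% p) (ℕ.*-comm x y)) (trans (%-cong-*ˡ y y′ x eq) (cong (_% p) (ℕ.*-comm y′ x)))

sq^ : ∀ s q → s ^ (q * 2) ≡ (s * s) ^ q
sq^ s zero    = refl
sq^ s (suc q) = trans (cong (λ z → s * (s * z)) (sq^ s q)) (sym (ℕ.*-assoc s s _))

module Blocks (V w L TM SM : ℕ) (w≡ : bits V ≡ w) where
  open Limits V w L TM SM w≡

  module Hash (n p α k N lo hi : ℕ) .{{_ : NonZero p}} (p≥2 : 2 ≤ p) (α<p : α < p) (p≤V : p ≤ V) where

    regsAt : (t H s m : ℕ) → Vec ℕ 10 → Vec ℕ 21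
    regsAt t H s m junk = n ∷ p ∷ α ∷ k ∷ N ∷ t ∷ H ∷ lo ∷ hi ∷ s ∷ m ∷ junk

    %₀-≤V : ∀ x → x %₀ p ≤ V
    %₀-≤V x = ≤-trans (≤-reflexive (%₀≡% x p)) (≤-trans (<⇒≤ (ℕ.m%n<n x p)) p≤V)

    -- As the postcondition Q is arbitrary, the command can have no other effect than replacing the
    -- code of the letter z by that of `g z`.
    Interprets : Cmd → (Letter → Letter) → Set₁
    Interprets c g = ∀ R Q t H s m st z (junk : Vec ℕ 9) → Q (regsAt t H s m (letterCode (g z) ∷ junk)) st →
                     wp c Q R (regsAt t H s m (letterCode z ∷ junk)) st

    loopBody : Cmd
    loopBody =
      A.when var A.e :% lit 2 :≡ lit 1 do′ (A.r ≔ (var A.r :* var A.sq) :% var A.p) ⨾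
      A.sq ≔ (var A.sq :* var A.sq) :% var A.p ⨾
      A.e ≔ var A.e :/ lit 2

    -- Invariant of repeated squaring: `r * sq ^ e` modulo p is preserved while e is halved, so i
    -- rounds suffice for e below 2^i. In the end e is 0 and r is the power.
    power-loop : ∀ i {R Q t H s m y h ℓ f h′ ℓ′ f′ r sq e st} → r < p → e < 2 ^ i → e ≤ V →
      (∀ {r′ sq′ e′} → r′ < p → r′ % p ≡ (r * sq ^ e) % p →
        Q (regsAt t H s m (y ∷ h ∷ ℓ ∷ f ∷ h′ ∷ ℓ′ ∷ f′ ∷ r′ ∷ sq′ ∷ e′ ∷ [])) st) →
      iter i (λ P → wp loopBody P R) Q (regsAt t H s m (y ∷ h ∷ ℓ ∷ f ∷ h′ ∷ ℓ′ ∷ f′ ∷ r ∷ sq ∷ e ∷ [])) st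
    power-loop zero {r = r} {sq} {zero} r<p e<1 e≤V q = q r<p (cong (_% p) (sym (*-identityʳ r)))
    power-loop zero {e = suc e} r<p (s≤s ()) e≤V q
    power-loop (suc i) {R} {r = r} {sq} {e} r<p e<2^ e≤V q =
      (λ odd → %₀-≤V (r * sq) , %₀-≤V (sq * sq) , half≤V ,
        power-loop i {R} (subst (_< p) (sym (%₀≡% (r * sq) p)) (ℕ.m%n<n _ p)) half<2^ half≤V λ {r′} r′<p eq → q r′<p
          (trans eq (trans (cong₂ (λ x y → (x * y ^ (e / 2)) % p) (%₀≡% (r * sq) p) (%₀≡% (sq * sq) p))
            (trans (%-*ˡ p (r * sq) _) (trans (%-cong-*ʳ p (r * sq) _ _ (%-^ p (sq * sq) (e / 2)))
              (cong (_% p) (trans (ℕ.*-assoc r sq _) (cong (r *_) (trans (cong (sq *_) (sym (sq^ sq (e / 2))))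
                 (cong (sq ^_) (trans (cong (_+ e / 2 * 2) (sym (≡ᵇ-true odd))) (sym (ℕ.m≡m%n+[m/n]*n e 2))))))))))))) ,
      (λ even → %₀-≤V (sq * sq) , half≤V ,
        power-loop i {R} r<p half<2^ half≤V λ {r′} r′<p eq → q r′<p
          (trans eq (trans (cong (λ y → (r * y ^ (e / 2)) % p) (%₀≡% (sq * sq) p))
            (trans (%-cong-*ʳ p r _ _ (%-^ p (sq * sq) (e / 2)))
              (cong (λ z → (r * z) % p) (trans (sym (sq^ sq (e / 2)))
                 (cong (sq ^_) (trans (cong (_+ e / 2 * 2) (sym (even-0 (≡ᵇ-false even))))
                   (sym (ℕ.m≡m%n+[m/n]*n e 2))))))))))
      where
      half≤V : e / 2 ≤ V
      half≤V = ≤-trans (ℕ.m/n≤m e 2) e≤V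
      half<2^ : e / 2 < 2 ^ i
      half<2^ = ℕ.m<n*o⇒m/o<n (subst (e <_) (ℕ.*-comm 2 (2 ^ i)) e<2^)
      even-0 : e % 2 ≢ 1 → e % 2 ≡ 0
      even-0 ne with e % 2 | ℕ.m%n<n e 2
      ... | zero        | _ = refl
      ... | suc zero    | _ = ⊥-elim (ne refl)
      ... | suc (suc _) | s≤s (s≤s ())

    power-wp : ∀ {R Q t H s m y h ℓ f h′ ℓ′ f′ r sq e st} → suc H ≤ V →
      (∀ {sq′ e′} → Q (regsAt t H s m (y ∷ h ∷ ℓ ∷ f ∷ h′ ∷ ℓ′ ∷ f′ ∷ α ^ H % p ∷ sq′ ∷ e′ ∷ [])) st) →
      wp A.power Q R (regsAt t H s m (y ∷ h ∷ ℓ ∷ f ∷ h′ ∷ ℓ′ ∷ f′ ∷ r ∷ sq ∷ e ∷ [])) st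
    power-wp {R} {Q} {t} {H} {s} {m} {y} {h} {ℓ} {f} {h′} {ℓ′} {f′} {st = st} H<V q =
      ≤-trans (≤-trans (n≤1+n 1) p≥2) p≤V , ≤-trans (<⇒≤ α<p) p≤V , <⇒≤ H<V ,
      ≤-trans (⌈log₂n⌉≤bits (H + 1)) (bits-≤w (subst (_≤ V) (+-comm 1 H) H<V)) ,
      power-loop ⌈log₂ H + 1 ⌉ {R} {Q} p≥2 (subst (_≤ 2 ^ ⌈log₂ H + 1 ⌉) (+-comm H 1) (n≤2^⌈log₂n⌉ (H + 1))) (<⇒≤ H<V)
        λ {r′} r′<p eq → subst (λ r → Q (regsAt t H s m (y ∷ h ∷ ℓ ∷ f ∷ h′ ∷ ℓ′ ∷ f′ ∷ r ∷ _ ∷ _ ∷ [])) st)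
          (trans (trans (cong (_% p) (sym (*-identityˡ (α ^ H)))) (sym eq)) (ℕ.m<n⇒m%n≡m r′<p)) q

    absHash : Bool → ℕ → ℕ
    absHash true  H = α ^ H % p
    absHash false H = 0

    absHash<p : ∀ c H → absHash c H < p
    absHash<p true  H = ℕ.m%n<n (α ^ H) p
    absHash<p false H = ℕ.<-trans z<s p≥2

    absHash≤V : ∀ c H → absHash c H ≤ V
    absHash≤V c H = ≤-trans (<⇒≤ (absHash<p c H)) p≤V

    colour : Letter → Bool
    colour a = true
    colour ā = true
    colour b = false
    colour b̄ = false

    absHash-wp : ∀ {R Q t H s m h ℓ f h′ ℓ′ f′ r sq e st} z → suc H ≤ V →
      (∀ {sq′ e′} → Q (regsAt t H s m (letterCode z ∷ h ∷ ℓ ∷ f ∷ h′ ∷ ℓ′ ∷ f′ ∷ absHash (colour z) H ∷ sq′ ∷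
        e′ ∷ [])) st) →
      wp A.absHash Q R (regsAt t H s m (letterCode z ∷ h ∷ ℓ ∷ f ∷ h′ ∷ ℓ′ ∷ f′ ∷ r ∷ sq ∷ e ∷ [])) st
    absHash-wp {R} {r = r} {sq} {e} a H<V q = (λ _ → power-wp {R} {r = r} {sq} {e} H<V q) , λ ()
    absHash-wp {R} {r = r} {sq} {e} ā H<V q = (λ _ → power-wp {R} {r = r} {sq} {e} H<V q) , λ ()
    absHash-wp b H<V q = (λ ()) , λ _ → z≤n , q
    absHash-wp b̄ H<V q = (λ ()) , λ _ → z≤n , q

    upstep-wp : ∀ {R Q t H s m h ℓ f h′ ℓ′ f′ r sq e xs fr} z → suc (suc H) ≤ V → t ≤ V → 3 + length xs ≤ L →
      (∀ {junk} → Q (regsAt t (H + 1) s m junk) ((absHash (colour z) (H + 1) ∷ 1 ∷ t ∷ xs) ∷ fr ∷ [])) →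
      wp A.upstep Q R (regsAt t H s m (letterCode z ∷ h ∷ ℓ ∷ f ∷ h′ ∷ ℓ′ ∷ f′ ∷ r ∷ sq ∷ e ∷ [])) (xs ∷ fr ∷ [])
    upstep-wp {R} {H = H} {r = r} {sq} {e} z H<V t≤V len q =
      subst (_≤ V) (+-comm 1 H) (<⇒≤ H<V) ,
      absHash-wp {R} {r = r} {sq} {e} z (subst (λ x → suc x ≤ V) (+-comm 1 H) H<V)
        (t≤V , ≤-trans (n≤1+n _) (≤-trans (n≤1+n _) len) ,
         ≤-trans (s≤s z≤n) H<V , ≤-trans (n≤1+n _) len , absHash≤V (colour z) (H + 1) , len , q)

    downstep-wp : ∀ {R Q t H s m y₁ y₂ y₃ h′ ℓ′ f′ r sq e h ℓ f xs fr} z → suc H ≤ V → 3 + length xs ≤ L →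
      ℓ ≤ V → f ≤ V →
      let h₁ = (h + (p ∸ absHash (colour z) H)) % p in
      (ℓ ∸ 1 ≢ 0 → ∀ {junk} → Q (regsAt t (H ∸ 1) s m junk) ((h₁ ∷ ℓ ∸ 1 ∷ f ∷ xs) ∷ fr ∷ [])) →
      (ℓ ∸ 1 ≡ 0 → h₁ ≡ 0 → ∀ {junk} → Q (regsAt t (H ∸ 1) s m junk) (xs ∷ fr ∷ [])) →
      (ℓ ∸ 1 ≡ 0 → h₁ ≢ 0 → R) →
      wp A.downstep Q R (regsAt t H s m (letterCode z ∷ y₁ ∷ y₂ ∷ y₃ ∷ h′ ∷ ℓ′ ∷ f′ ∷ r ∷ sq ∷ e ∷ []))
        ((h ∷ ℓ ∷ f ∷ xs) ∷ fr ∷ [])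
    downstep-wp {R} {Q} {t} {H} {s} {m} {r = r} {sq} {e} {h = h} {ℓ} {f} {xs} {fr} z H<V len ℓ≤V f≤V q₁ q₂ q₃ =
      (λ _ → ≤-trans (ℕ.m∸n≤m ℓ 1) ℓ≤V ,
        absHash-wp {R} {r = r} {sq} {e} z H<V λ {sq′} {e′} →
          %₀-≤V _ , ≤-trans (ℕ.m∸n≤m H 1) (<⇒≤ H<V) ,
          f≤V , ≤-trans (n≤1+n _) (≤-trans (n≤1+n _) len) ,
          ≤-trans (ℕ.m∸n≤m ℓ 1) ℓ≤V , ≤-trans (n≤1+n _) len ,
          %₀-≤V _ , len ,
          (λ ℓ0 → (λ h0 → q₂ (≡ᵇ-true ℓ0) (trans (sym %p) (≡ᵇ-true h0))) ,
                   λ h0 → q₃ (≡ᵇ-true ℓ0) λ h≡0 → ≡ᵇ-false h0 (trans %p h≡0)) ,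
          λ ℓ0 → subst (λ h → ∀ {junk} → Q (regsAt t (H ∸ 1) s m junk) ((h ∷ ℓ ∸ 1 ∷ f ∷ xs) ∷ fr ∷ []))
            (sym %p) (q₁ (≡ᵇ-false ℓ0))) ,
      λ ()
      where
      %p : ∀ {x} → x %₀ p ≡ x % p
      %p {x} = %₀≡% x p

-- Hash values as residues of polynomial values

pos-^ : ∀ x j → + (x ^ j) ≡ (+ x) ℤ.^ j
pos-^ x zero    = refl
pos-^ x (suc j) = trans (ℤ.pos-* x (x ^ j)) (cong (λ z → + x ℤ.* z) (pos-^ x j))

pos-∸ : ∀ {m n} → n ≤ m → + (m ∸ n) ≡ + m ℤ.- + n
pos-∸ {m} {n} n≤m = trans (sym (ℤ.⊖-≥ n≤m)) (sym (ℤ.[+m]-[+n]≡m⊖n m n))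

module _ (p : ℕ) .{{_ : NonZero p}} where

  %-∣ : ∀ x y → + p ∣ℤ (+ x ℤ.- y) → + p ∣ℤ (+ (x % p) ℤ.- y)
  %-∣ x y d = subst (+ p ∣ℤ_) (sym eq) (ℤ.∣m∣n⇒∣m-n d (ℤ.∣n⇒∣m*n (+ (x / p)) (ℤ.∣-refl {+ p})))
    where
    collect : ∀ r u y → r ℤ.- y ≡ r ℤ.+ u ℤ.- y ℤ.- u
    collect = ℤ-solve-∀
    eq : + (x % p) ℤ.- y ≡ + x ℤ.- y ℤ.- + (x / p) ℤ.* + p
    eq = trans (collect (+ (x % p)) (+ (x / p) ℤ.* + p) y)
      (cong (λ z → z ℤ.- y ℤ.- + (x / p) ℤ.* + p)
        (sym (trans (cong +_ (ℕ.m≡m%n+[m/n]*n x p)) (trans (ℤ.pos-+ (x % p) (x / p * p))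
          (cong (λ z → + (x % p) ℤ.+ z) (ℤ.pos-* (x / p) p))))))

  +-∣ : ∀ h h′ e e′ → + p ∣ℤ (+ h ℤ.- e) → + p ∣ℤ (+ h′ ℤ.- e′) → + p ∣ℤ (+ ((h + h′) % p) ℤ.- (e ℤ.+ e′))
  +-∣ h h′ e e′ d d′ = %-∣ (h + h′) (e ℤ.+ e′) (subst (+ p ∣ℤ_)
      (trans (collect (+ h) (+ h′) e e′) (cong (ℤ._- (e ℤ.+ e′)) (sym (ℤ.pos-+ h h′))))
      (ℤ.∣m∣n⇒∣m+n d d′))
    where
    collect : ∀ h h′ e e′ → h ℤ.- e ℤ.+ (h′ ℤ.- e′) ≡ h ℤ.+ h′ ℤ.- (e ℤ.+ e′)
    collect = ℤ-solve-∀

  -- The program adds `p ∸ r` to stay within the natural numbers. As r ≤ p, the subtraction is not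
  -- truncated, and the extra p disappears modulo p.
  -∣ : ∀ h r e e′ → r ≤ p → + p ∣ℤ (+ h ℤ.- e) → + p ∣ℤ (+ r ℤ.- e′) → + p ∣ℤ (+ ((h + (p ∸ r)) % p) ℤ.- (e ℤ.- e′))
  -∣ h r e e′ r≤p d d′ = %-∣ (h + (p ∸ r)) (e ℤ.- e′) (subst (+ p ∣ℤ_)
      (trans (collect (+ h) (+ r) (+ p) e e′) (cong (ℤ._- (e ℤ.- e′))
        (trans (cong (λ z → + h ℤ.+ z) (sym (pos-∸ r≤p))) (sym (ℤ.pos-+ h (p ∸ r))))))
      (ℤ.∣m∣n⇒∣m+n (ℤ.∣m∣n⇒∣m-n d d′) (ℤ.∣-refl {+ p})))
    where
    collect : ∀ h r p e e′ → h ℤ.- e ℤ.- (r ℤ.- e′) ℤ.+ p ≡ h ℤ.+ (p ℤ.- r) ℤ.- (e ℤ.- e′)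
    collect = ℤ-solve-∀

mergeTop-no₁ : ∀ {s I J S} → first I ≤ s → mergeTop s (I ∷ J ∷ S) ≡ I ∷ J ∷ S
mergeTop-no₁ {s} {I} {J} f≤s with s ℕ.<? first I | s ℕ.<? first J
... | yes s<f | _     = ⊥-elim (ℕ.<⇒≱ s<f f≤s)
... | no _    | yes _ = refl
... | no _    | no _  = refl

mergeTop-no₂ : ∀ {s I J S} → first J ≤ s → mergeTop s (I ∷ J ∷ S) ≡ I ∷ J ∷ S
mergeTop-no₂ {s} {I} {J} f≤s with s ℕ.<? first I | s ℕ.<? first J
... | _     | yes s<f = ⊥-elim (ℕ.<⇒≱ s<f f≤s)
... | yes _ | no _    = refl
... | no _  | no _    = refl

module Simulation (V w L TM SM : ℕ) (w≡ : bits V ≡ w)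
  (n p α k N lo hi : ℕ) .{{_ : NonZero p}} (p≥2 : 2 ≤ p) (α<p : α < p) (p≤V : p ≤ V) where
  open Limits V w L TM SM w≡
  open Blocks V w L TM SM w≡
  open Hash n p α k N lo hi p≥2 α<p p≤V

  -- Since h is a reduced residue of P(α), the test h = 0 decides whether P vanishes at α (`∣-zero`,
  -- `∣-nonzero`). The stored height is `suc q`, as items of height zero are not kept.
  data Enc : Stack → List ℕ → Set where
    []  : Enc [] []
    enc : ∀ {h P q f S xs} → h < p → + p ∣ℤ (+ h ℤ.- ev (+ α) P) → Enc S xs → Enc (item P q f ∷ S) (h ∷ suc q ∷ f ∷ xs)

  enc-length : ∀ {S xs} → Enc S xs → length xs ≡ length S * 3
  enc-length []          = refl
  enc-length (enc _ _ x) = cong (λ z → 3 + z) (enc-length x)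

  absHash-∣ : ∀ c H → + p ∣ℤ (+ absHash c H ℤ.- val c ℤ.* (+ α) ℤ.^ H)
  absHash-∣ true  H = %-∣ p (α ^ H) (1ℤ ℤ.* (+ α) ℤ.^ H) (subst (+ p ∣ℤ_) (sym zero≡) (ℤ.divides 0ℤ refl))
    where
    zero≡ : + (α ^ H) ℤ.- 1ℤ ℤ.* (+ α) ℤ.^ H ≡ 0ℤ
    zero≡ = trans (cong (λ z → + (α ^ H) ℤ.- z) (trans (ℤ.*-identityˡ _) (sym (pos-^ α H)))) (ℤ.+-inverseʳ (+ (α ^ H)))
  absHash-∣ false H = subst (λ z → + p ∣ℤ (0ℤ ℤ.- z)) (sym (ℤ.*-zeroˡ ((+ α) ℤ.^ H))) (ℤ.divides 0ℤ refl)

  enc-up : ∀ c t {S xs} → Enc S xs → Enc (pushUp c t S) (absHash c (suc (height S)) ∷ 1 ∷ suc t ∷ xs)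
  enc-up c t {S} x = enc (absHash<p c _) (subst (λ z → + p ∣ℤ (+ absHash c (suc (height S)) ℤ.- z))
    (sym (ev-mono (+ α) (val c) (suc (height S)))) (absHash-∣ c _)) x

  lower-∣ : ∀ c H {h} P → + p ∣ℤ (+ h ℤ.- ev (+ α) P) →
            + p ∣ℤ (+ ((h + (p ∸ absHash c H)) % p) ℤ.- ev (+ α) (P ⊕ mono (- val c) H))
  lower-∣ c H {h} P d = subst (λ z → + p ∣ℤ (+ ((h + (p ∸ absHash c H)) % p) ℤ.- z))
    (sym (trans (ev-⊕ (+ α) P _) (cong (λ z → ev (+ α) P ℤ.+ z)
      (trans (ev-mono (+ α) (- val c) H) (sym (ℤ.neg-distribˡ-* (val c) _))))))
    (-∣ p h (absHash c H) (ev (+ α) P) (val c ℤ.* (+ α) ℤ.^ H) (<⇒≤ (absHash<p c H)) d (absHash-∣ c H))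

  Van : Poly → Set
  Van = Vanishes p α

  -- The machine stops at its first failed check while `srun` runs to the end of the block.
  -- Rejection is therefore described by what it excludes: a symbolic run that succeeds and discards
  -- only polynomials vanishing at α. In this form it passes to the enclosing blocks.
  Fails : ∀ {i} → Tree i → ℕ → Stack → Set
  Fails τ t S = ∀ {S′ D} → srun τ t S ≡ just (S′ , D) → ¬ All Van D

  enter : Cmd
  enter = A.t ≔ var A.t :+ lit 1 ⨾
          (if A.y A.is a :∨ A.y A.is b then A.upstep else A.downstep)

  ∣-zero : ∀ {h} P → h ≡ 0 → + p ∣ℤ (+ h ℤ.- ev (+ α) P) → Van P
  ∣-zero P refl d = subst (+ p ∣ℤ_) (ℤ.neg-involutive (ev (+ α) P)) (ℤ.∣m⇒∣-m (subst (+ p ∣ℤ_) (ℤ.+-identityˡ _) d))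

  ∣-nonzero : ∀ {h} P → h < p → h ≢ 0 → + p ∣ℤ (+ h ℤ.- ev (+ α) P) → ¬ Van P
  ∣-nonzero {h} P h<p h≢0 d v = distinct-residues h<p (ℕ.<-trans z<s p≥2) h≢0
    (subst (+ p ∣ℤ_) (undo (+ h) (ev (+ α) P)) (ℤ.∣m∣n⇒∣m+n d v))
    where
    undo : ∀ h e → h ℤ.- e ℤ.+ e ≡ h ℤ.- 0ℤ
    undo = ℤ-solve-∀

  module _ {R : Set} {Q : Pred} {t s m : ℕ} {fr : List ℕ} where

    up-wp : ∀ {S xs h ℓ f h′ ℓ′ f′ r sq e} z c → step z ≡ opening c → colour z ≡ c → suc (suc (height S)) ≤ V
      → t + 1 ≤ V → 3 + length xs ≤ L → Enc S xs →
      (∀ {S′ D xs′ junk} → srun (leaf (step z)) t S ≡ just (S′ , D) → All Van D → Enc S′ xs′ → Q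
        (regsAt (suc t) (height S′) s m junk) (xs′ ∷ fr ∷ [])) →
      wp A.upstep Q R (regsAt (t + 1) (height S) s m (letterCode z ∷ h ∷ ℓ ∷ f ∷ h′ ∷ ℓ′ ∷ f′ ∷ r ∷ sq ∷ e ∷
        [])) (xs ∷ fr ∷ [])
    up-wp {S} {xs} {r = r} {sq} {e} z c eq refl H≤V t≤V len x q = upstep-wp {R} {Q} {r = r} {sq} {e} z H≤V t≤V len
      (λ {junk} → done junk (+-comm t 1) (+-comm (height S) 1))
      where
      done : ∀ junk {t′ H′} → t′ ≡ suc t → H′ ≡ suc (height S) → Q (regsAt t′ H′ s m junk)
        ((absHash (colour z) H′ ∷ 1 ∷ t′ ∷ xs) ∷ fr ∷ [])
      done junk refl refl = q {pushUp c t S} (cong (λ y → srun (leaf y) t S) eq) [] (enc-up c t x)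

    down-wp : ∀ {S xs y₁ y₂ y₃ h′ ℓ′ f′ r sq e} z c → step z ≡ closing c → colour z ≡ c → suc
      (suc (height S)) ≤ V → t + 1 ≤ V → length xs ≤ L → Old V S → Enc S xs →
      (∀ {S′ D xs′ junk} → srun (leaf (step z)) t S ≡ just (S′ , D) → All Van D → Enc S′ xs′ → Q
        (regsAt (suc t) (height S′) s m junk) (xs′ ∷ fr ∷ [])) →
      (Fails (leaf (step z)) t S → R) →
      wp A.downstep Q R (regsAt (t + 1) (height S) s m (letterCode z ∷ y₁ ∷ y₂ ∷ y₃ ∷ h′ ∷ ℓ′ ∷ f′ ∷ r ∷ sq ∷
        e ∷ [])) (xs ∷ fr ∷ [])
    down-wp {S = []} z c eq refl H≤V t≤V len o [] q fl = (λ ()) , λ _ → fl λ eq′ → ⊥-elim (absurd eq′)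
      where
      absurd : ∀ {S′ D} → srun (leaf (step z)) t [] ≢ just (S′ , D)
      absurd eq′ with trans (sym (cong (λ y → srun (leaf y) t []) eq)) eq′
      ... | ()
    down-wp {S = item P zero f ∷ S} {y₁ = y₁} {y₂} {y₃} {r = r} {sq} {e} z c eq refl H≤V t≤V len (f≤V ∷ o)
      (enc {h = h} {xs = xs} h<p d x) q fl =
      downstep-wp {R} {Q} {y₁ = y₁} {y₂} {y₃} {r = r} {sq} {e} z (<⇒≤ H≤V) len (≤-trans (s≤s z≤n) H≤V) f≤V
        (λ ne → ⊥-elim (ne refl))
        (λ _ h0 {junk} → subst (λ t′ → Q (regsAt t′ (height S) s m junk) (xs ∷ fr ∷ [])) (+-comm 1 t)
          (q ran (∣-zero P′ h0 low ∷ []) x))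
        (λ _ h≢0 → fl λ eq′ → fails h≢0 (trans (sym ran) eq′))
      where
      P′ : Poly
      P′ = P ⊕ mono (- val c) (suc (height S))
      low = lower-∣ c (suc (height S)) P d
      ran : srun (leaf (step z)) t (item P zero f ∷ S) ≡ just (S , P ⊕ mono (- val c) (suc (height S)) ∷ [])
      ran = cong (λ y → srun (leaf y) t (item P zero f ∷ S)) eq
      fails : ∀ {S′ D} → (h + (p ∸ absHash c (suc (height S)))) % p ≢ 0 → just
        (S , P ⊕ mono (- val c) (suc (height S)) ∷ []) ≡ just (S′ , D) → ¬ All Van D
      fails h≢0 refl (v ∷ _) = ∣-nonzero P′ (ℕ.m%n<n _ p) h≢0 low v
    down-wp {S = item P (suc q′) f ∷ S} {y₁ = y₁} {y₂} {y₃} {r = r} {sq} {e} z c eq refl H≤V t≤V len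
      (f≤V ∷ o) (enc {h = h} {xs = xs} h<p d x) q fl =
      downstep-wp {R} {Q} {y₁ = y₁} {y₂} {y₃} {r = r} {sq} {e} z (<⇒≤ H≤V) len
        (≤-trans (≤-trans (s≤s (s≤s (m≤m+n q′ _))) (n≤1+n _)) (<⇒≤ H≤V)) f≤V
        (λ _ {junk} → subst (λ t′ → Q (regsAt t′ (suc (q′ + height S)) s m junk)
          (((h + (p ∸ absHash c (suc (suc (q′ + height S))))) % p ∷ suc q′ ∷ f ∷ xs) ∷ fr ∷ [])) (+-comm 1 t)
          (q {item (P ⊕ mono (- val c) (suc (suc (q′ + height S)))) q′ f ∷ S}
            (cong (λ y → srun (leaf y) t (item P (suc q′) f ∷ S)) eq) []
            (enc (ℕ.m%n<n _ p) (lower-∣ c (suc (suc (q′ + height S))) P d) x)))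
        (λ ()) (λ ())

    enter-wp : ∀ {S xs h ℓ f h′ ℓ′ f′ r sq e} z → suc (suc (height S)) ≤ V → t + 1 ≤ V → 3 + length xs ≤ L →
      Old V S → Enc S xs →
      (∀ {S′ D xs′ junk} → srun (leaf (step z)) t S ≡ just (S′ , D) → All Van D → Enc S′ xs′ → Q
        (regsAt (suc t) (height S′) s m junk) (xs′ ∷ fr ∷ [])) →
      (Fails (leaf (step z)) t S → R) →
      wp enter Q R (regsAt t (height S) s m (letterCode z ∷ h ∷ ℓ ∷ f ∷ h′ ∷ ℓ′ ∷ f′ ∷ r ∷ sq ∷ e ∷ [])) (xs ∷ fr ∷ [])
    enter-wp {r = r} {sq} {e} a H t≤V len o x q fl = t≤V ,
      (λ _ → up-wp {r = r} {sq} {e} a true refl refl H t≤V len x q) , λ ()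
    enter-wp {r = r} {sq} {e} b H t≤V len o x q fl = t≤V ,
      (λ _ → up-wp {r = r} {sq} {e} b false refl refl H t≤V len x q) , λ ()
    enter-wp {h = h} {ℓ} {f} {r = r} {sq} {e} ā H t≤V len o x q fl = t≤V , (λ ()) , λ _ → down-wp {y₁ = h}
      {ℓ} {f} {r = r} {sq} {e} ā true refl refl H t≤V (≤-trans (m≤n+m _ 3) len) o x q fl
    enter-wp {h = h} {ℓ} {f} {r = r} {sq} {e} b̄ H t≤V len o x q fl = t≤V , (λ ()) , λ _ → down-wp {y₁ = h}
      {ℓ} {f} {r = r} {sq} {e} b̄ false refl refl H t≤V (≤-trans (m≤n+m _ 3) len) o x q fl

  inBlock-true : ∀ {s m f} → s < f → f ≤ s + m → ((s + 1 ≤ᵇ f) Bool.∧ (f ≤ᵇ s + m)) ≡ true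
  inBlock-true {s} {m} {f} s<f f≤ rewrite ≤ᵇ-true (subst (_≤ f) (+-comm 1 s) s<f) = ≤ᵇ-true f≤

  inBlock-false : ∀ {s m f} → f ≤ s → ((s + 1 ≤ᵇ f) Bool.∧ (f ≤ᵇ s + m)) ≡ false
  inBlock-false {s} {m} {f} f≤s rewrite ≤ᵇ-false {s + 1} {f} (subst (f <_) (+-comm 1 s) (s≤s f≤s)) = refl

  true≢false : ∀ {A : Set} {x} → x ≡ true → x ≡ false → A
  true≢false refl ()

  merge-wp : ∀ {R Q t s m S xs fr} junk → height S ≤ V → s + m ≤ V → length xs ≤ L → Old (s + m) S → Enc S xs →
    (∀ {xs′ junk} → Enc (mergeTop s S) xs′ → Q (regsAt t (height S) s m junk) (xs′ ∷ fr ∷ [])) →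
    wp A.merge Q R (regsAt t (height S) s m junk) (xs ∷ fr ∷ [])
  merge-wp (y ∷ h ∷ ℓ ∷ f ∷ h′ ∷ ℓ′ ∷ f′ ∷ r ∷ sq ∷ e ∷ []) _ _ _ _ [] q = (λ ()) , λ _ → q []
  merge-wp (y ∷ h ∷ ℓ ∷ f ∷ h′ ∷ ℓ′ ∷ f′ ∷ r ∷ sq ∷ e ∷ []) H≤V m≤V len (f≤ ∷ []) (enc h<p d []) q =
    (λ _ → (λ ()) , λ _ →
      ≤-trans f≤ m≤V , ≤-trans (s≤s z≤n) len , ≤-trans (s≤s (m≤m+n _ _)) H≤V , ≤-trans (s≤s (s≤s z≤n)) len ,
      ≤-trans (<⇒≤ h<p) p≤V , len , q (enc h<p d [])) , λ ()
  merge-wp {R} {Q} {t} {s} {m} {S = item P₁ q₁ f₁ ∷ item P₂ q₂ f₂ ∷ S} {xs = h₁ ∷ _ ∷ _ ∷ h₂ ∷ _ ∷ _ ∷ xs}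
    {fr} (y ∷ h ∷ ℓ ∷ f ∷ h′ ∷ ℓ′ ∷ f′ ∷ r ∷ sq ∷ e ∷ []) H≤V m≤V len (f₁≤ ∷ f₂≤ ∷ o)
    (enc h₁<p d₁ (enc h₂<p d₂ x)) q =
    (λ _ →
      (λ in₁ →
        (λ in₂ → f₂≤V , drop₅ , sum≤V , drop₄ , %₀-≤V _ , drop₃ ,
           merged (ℕ.<-≤-connex s f₁) (ℕ.<-≤-connex s f₂) in₁ in₂) ,
        (λ out₂ → f₂≤V , drop₅ , q₂≤V , drop₄ , h₂≤V , drop₃ , f₁≤V , drop₂ , q₁≤V , drop₁ , h₁≤V , len ,
           kept₂ (ℕ.<-≤-connex s f₂) out₂)) ,
      (λ out₁ → f₁≤V , drop₂ , q₁≤V , drop₁ , h₁≤V , len , kept₁ (ℕ.<-≤-connex s f₁) out₁)) , λ ()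
    where
    drop₁ : 5 + length xs ≤ L
    drop₁ = <⇒≤ len
    drop₂ : 4 + length xs ≤ L
    drop₂ = <⇒≤ drop₁
    drop₃ : 3 + length xs ≤ L
    drop₃ = <⇒≤ drop₂
    drop₄ : 2 + length xs ≤ L
    drop₄ = <⇒≤ drop₃
    drop₅ : 1 + length xs ≤ L
    drop₅ = <⇒≤ drop₄
    f₁≤V : f₁ ≤ V
    f₁≤V = ≤-trans f₁≤ m≤V
    f₂≤V : f₂ ≤ V
    f₂≤V = ≤-trans f₂≤ m≤V
    h₁≤V : h₁ ≤ V
    h₁≤V = ≤-trans (<⇒≤ h₁<p) p≤V
    h₂≤V : h₂ ≤ V
    h₂≤V = ≤-trans (<⇒≤ h₂<p) p≤V
    sum≤V : suc q₂ + suc q₁ ≤ V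
    sum≤V = ≤-trans (subst (_≤ suc (q₁ + suc (q₂ + height S))) (+-comm (suc q₁) (suc q₂))
      (s≤s (+-monoʳ-≤ q₁ (s≤s (m≤m+n q₂ _))))) H≤V
    q₁≤V : suc q₁ ≤ V
    q₁≤V = ≤-trans (m≤n+m _ (suc q₂)) sum≤V
    q₂≤V : suc q₂ ≤ V
    q₂≤V = ≤-trans (m≤m+n _ (suc q₁)) sum≤V
    both : Enc (item P₁ q₁ f₁ ∷ item P₂ q₂ f₂ ∷ S) (h₁ ∷ suc q₁ ∷ f₁ ∷ h₂ ∷ suc q₂ ∷ f₂ ∷ xs)
    both = enc h₁<p d₁ (enc h₂<p d₂ x)
    Goal : List ℕ → Set
    Goal xs′ = ∀ {junk} → Q (regsAt t (height (item P₁ q₁ f₁ ∷ item P₂ q₂ f₂ ∷ S)) s m junk) (xs′ ∷ fr ∷ [])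
    merged : s < f₁ ⊎ f₁ ≤ s → s < f₂ ⊎ f₂ ≤ s →
      ((s + 1 ≤ᵇ f₁) Bool.∧ (f₁ ≤ᵇ s + m)) ≡ true → ((s + 1 ≤ᵇ f₂) Bool.∧ (f₂ ≤ᵇ s + m)) ≡ true → Goal
        ((h₂ + h₁) %₀ p ∷ suc q₂ + suc q₁ ∷ f₂ ∷ xs)
    merged (inj₂ l₁) _         in₁ _   = true≢false in₁ (inBlock-false {s} {m} l₁)
    merged (inj₁ _)  (inj₂ l₂) _   in₂ = true≢false in₂ (inBlock-false {s} {m} l₂)
    merged (inj₁ l₁) (inj₁ l₂) _   _   {junk} = q (subst₂ Enc (sym (mergeTop-yes l₁ l₂))
      (cong (_∷ suc q₂ + suc q₁ ∷ f₂ ∷ xs) (sym (%₀≡% (h₂ + h₁) p)))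
      (enc (ℕ.m%n<n _ p) (subst (λ z → + p ∣ℤ (+ ((h₂ + h₁) % p) ℤ.- z)) (sym (ev-⊕ (+ α) P₂ P₁))
        (+-∣ p h₂ h₁ (ev (+ α) P₂) (ev (+ α) P₁) d₂ d₁)) x))
    kept₁ : s < f₁ ⊎ f₁ ≤ s → ((s + 1 ≤ᵇ f₁) Bool.∧ (f₁ ≤ᵇ s + m)) ≡ false → Goal
      (h₁ ∷ suc q₁ ∷ f₁ ∷ h₂ ∷ suc q₂ ∷ f₂ ∷ xs)
    kept₁ (inj₁ l) out = true≢false (inBlock-true l f₁≤) out
    kept₁ (inj₂ l) _   = q (subst (λ T → Enc T _) (sym (mergeTop-no₁ {I = item P₁ q₁ f₁} {item P₂ q₂ f₂} l)) both)
    kept₂ : s < f₂ ⊎ f₂ ≤ s → ((s + 1 ≤ᵇ f₂) Bool.∧ (f₂ ≤ᵇ s + m)) ≡ false → Goal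
      (h₁ ∷ suc q₁ ∷ f₁ ∷ h₂ ∷ suc q₂ ∷ f₂ ∷ xs)
    kept₂ (inj₁ l) out = true≢false (inBlock-true l f₂≤) out
    kept₂ (inj₂ l) _   = q (subst (λ T → Enc T _) (sym (mergeTop-no₂ {I = item P₁ q₁ f₁} {item P₂ q₂ f₂} l)) both)

map-split : ∀ {A B : Set} (g : A → B) {us vs} zs → map g zs ≡ us ++ vs →
            ∃[ xs ] ∃[ ys ] (zs ≡ xs ++ ys × map g xs ≡ us × map g ys ≡ vs)
map-split g {[]}     zs       eq = [] , zs , refl , refl , eq
map-split g {u ∷ us} (z ∷ zs) eq with List.∷-injective eq
... | z≡u , eq′ with map-split g {us} zs eq′
...   | xs , ys , zs≡ , xs≡ , ys≡ = z ∷ xs , ys , cong (z ∷_) zs≡ , cong₂ _∷_ z≡u xs≡ , ys≡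

-- The recursion over blocks, with clock and stacks

data IsPad : ∀ {i} → Tree i → Set where
  pad : ∀ {i} → IsPad (pad {i})

-- The side conditions of `pad` and `node` are the program's test `padding` at position t and its
-- negation, so the shape of the tree dictates the branch taken. At level 0 the program makes no
-- such test.
data Placed (lo hi : ℕ) : ∀ {i} → ℕ → Tree i → Set where
  leaf : ∀ {t y} → Placed lo hi t (leaf y)
  pad  : ∀ {i t} → hi ≤ t ⊎ t + 2 ^ suc i ≤ lo → Placed lo hi t (pad {i})
  node : ∀ {i t} {l r : Tree i} → t < hi → lo < t + 2 ^ suc i → Placed lo hi t l → Placed lo hi (t + 2 ^ i) r →
         Placed lo hi t (node l r)

-- The letters form a non-empty interval that meets the block, hence it meets one of the halves.
-- This limits the time between letters: a block with letters skips at most one of its halves.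
not-both-pads : ∀ {lo hi i t} {l r : Tree i} → lo < hi → Placed lo hi t (node l r) → IsPad l → IsPad r → ⊥
not-both-pads {lo} {hi} {suc i} {t} lo<hi (node t<hi lo<end (pad p) (pad q)) pad pad with p | q
... | inj₁ hi≤t  | _           = ℕ.<⇒≱ t<hi hi≤t
... | inj₂ _     | inj₂ end≤lo = ℕ.<⇒≱ lo<end (subst (_≤ lo) (end t (suc i)) end≤lo)
... | inj₂ mid≤lo | inj₁ hi≤mid = ℕ.<⇒≱ lo<hi (≤-trans hi≤mid mid≤lo)

-- The branches of the body of `block` and the tails of its sequence, named so that the proof can
-- refer to what remains to be executed.
skipBlock finish halves openBlock splitBlock stepCmd : Cmd
skipBlock = A.t ≔ var A.t :+ var A.m
finish    = A.m ≔ var A.m :* lit 2 ⨾ A.merge ⨾ pop A.frames A.s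
halves    = A.m ≔ var A.m :/ lit 2 ⨾ self ⨾ self ⨾ finish
openBlock = A.s ≔ var A.t ⨾ halves
splitBlock = push A.frames (var A.s) ⨾ openBlock
stepCmd = if A.padding then skipBlock else splitBlock

module Block (V w L TM SM : ℕ) (w≡ : bits V ≡ w)
  (n p α k N lo hi : ℕ) .{{_ : NonZero p}} (p≥2 : 2 ≤ p) (α<p : α < p) (p≤V : p ≤ V)
  (interp : Cmd) (g : Letter → Letter)
  (W₀ : ℕ) (W₀≥ : 1000 ≤ W₀) where
  open Limits V w L TM SM w≡
  open Blocks V w L TM SM w≡
  open Hash n p α k N lo hi p≥2 α<p p≤V
  open Simulation V w L TM SM w≡ n p α k N lo hi p≥2 α<p p≤V

  -- U bounds the time between two calls, and B i the clock at the end of a block of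
  -- length 2^i that contains a letter.
  U : ℕ
  U = W₀ * w ^ 4

  -- One level of the recursion spends at most 8 units U up to the start of its second half if the
  -- first is padding, and at most 6 more after the halves. The rest of the 16 leaves room for
  -- initialisation and setup.
  E : ℕ
  E = 16 * U

  B : ℕ → ℕ
  B i = suc i * E

  module Sound
    (interp-wp : Interprets interp g)
    (interp-weight : cmdWeight interp ≤ 100) (interp-loops : loops interp ≡ 0)
    (n≤N : n ≤ N) (N<V : 2 + N ≤ V) (3≤V : 3 ≤ V) (lo<hi : lo < hi) (L≥ : (2 + k) * 3 ≤ L)
    (TM≥ : B k + B k + E ≤ TM) where

    open Ok

    -- The registers from `y` on are scratch: their contents are not relied on from one block to the
    -- next.
    data State (S : Stack) (t s m : ℕ) (fr : List ℕ) : Pred where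
      state : ∀ {junk xs} → Enc S xs → State S t s m fr (regsAt t (height S) s m junk) (xs ∷ fr ∷ [])

    elim : (X : Pred) → ∀ {S t s m fr r st} → State S t s m fr r st →
           (∀ {junk xs} → Enc S xs → X (regsAt t (height S) s m junk) (xs ∷ fr ∷ [])) → X r st
    elim X (state x) h = h x

    w*w≤U : ∀ {x} → x ≤ W₀ → x * (w * w) ≤ U
    w*w≤U x≤ = *-mono-≤ x≤ (w*w≤ 2)

    cmdTime≤U : ∀ c → cmdWeight c ≤ W₀ → loops c ≤ 2 → cmdTime c ≤ U
    cmdTime≤U c x≤ l≤ = *-mono-≤ x≤ (w^-mono (s≤s (s≤s l≤)))

    small : ∀ x {_ : T (x ≤ᵇ 1000)} → x ≤ W₀
    small x {x≤} = ≤-trans (≤ᵇ⇒≤ x 1000 x≤) W₀≥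

    fits-sound : ∀ c {Q R self′ kk σ} → cmdWeight c ≤ W₀ → loops c ≤ 2 → wp c Q R (regs σ) (stks σ) → Ok σ →
                 kk + Z + W₀ * (w * w) ≤ SM → clock σ + U ≤ TM →
                 Sat (exec c self′ kk σ) (Post Q U σ) (λ σ′ → R × Within σ′)
    fits-sound c {Q} {R} {self′} {kk} {σ} x≤ l≤ q ok sp tm =
      sat-map (wp-sound c {Q} {R} {self′} {kk} {σ} q ok (≤-trans (+-monoʳ-≤ (kk + Z) (*-monoˡ-≤ (w * w) x≤)) sp)
                (≤-trans (+-monoʳ-≤ (clock σ) (cmdTime≤U c x≤ l≤)) tm))
        (λ (q′ , s) → q′ , spent-mono (cmdTime≤U c x≤ l≤) s) (λ r → r)

    then-sound : ∀ c d {Q self′ kk σ P′ R′} → cmdWeight c ≤ W₀ → loops c ≤ 2 → wp c Q ⊥ (regs σ) (stks σ) → Ok σ →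
                 kk + Z + W₀ * (w * w) ≤ SM → clock σ + U ≤ TM →
                 (∀ {σ′} → Q (regs σ′) (stks σ′) → Spent U σ σ′ → Sat (exec d self′ kk σ′) P′ R′) →
                 Sat (exec (c ⨾ d) self′ kk σ) P′ R′
    then-sound c d {Q} {self′} {kk} {σ} x≤ l≤ q ok sp tm h =
      sat-bind (fits-sound c {Q} {⊥} {self′} {kk} {σ} x≤ l≤ q ok sp tm) (λ (q′ , s) → h q′ s) (λ (r , _) → ⊥-elim r)

    charged : ∀ {kk c c′ σ} → c ≤ c′ * (w * w) → c′ ≤ W₀ → Ok σ → kk + Z + W₀ * (w * w) ≤ SM → clock σ + U ≤
      TM → Spent U σ (charge kk c σ)
    charged {kk} {c} {c′} {σ} c≤ c′≤ ok sp tm =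
      spent (charge-ok {k = kk} ok (≤-trans c≤ (*-monoˡ-≤ (w * w) c′≤)) sp
        (≤-trans (+-monoʳ-≤ (clock σ) c≤U) tm)) (+-monoʳ-≤ (clock σ) c≤U) refl
      where
      c≤U : c ≤ U
      c≤U = ≤-trans c≤ (w*w≤U c′≤)

    -- Only a block of padding leaves the clock running.
    Clk : ∀ {i} → Tree i → ℕ → ℕ → Set
    Clk {i} τ c c′ = (IsPad τ × c′ ≤ c + U + U) ⊎ c′ ≤ B i

    record Done {i} (τ : Tree i) (S : Stack) (t s : ℕ) (fr : List ℕ) (rest : List Letter) (c : ℕ)
      (σ′ : Config) : Set where
      constructor done
      field
        {S′}   : Stack
        {D}    : List Poly
        ran    : srun τ t S ≡ just (S′ , D)
        van    : All Van D
        final≡ : State S′ (t + 2 ^ i) s (2 ^ i) fr (regs σ′) (stks σ′)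
        ok     : Ok σ′
        inp    : input σ′ ≡ rest
        clk    : Clk τ c (clock σ′)

    Failed : ∀ {i} (τ : Tree i) (S : Stack) (t : ℕ) → Config → Set
    Failed τ S t σ′ = Fails τ t S × Within σ′

    bump : ∀ {c j x y} → x ≤ c + j * U → y ≤ x + U → y ≤ c + suc j * U
    bump {c} {j} x≤ y≤ = ≤-trans y≤ (≤-trans (+-monoˡ-≤ U x≤)
      (≤-reflexive (trans (+-assoc c (j * U) U) (cong (λ z → c + z) (+-comm (j * U) U)))))

    code≤V : ∀ z → letterCode z ≤ V
    code≤V a = z≤n
    code≤V ā = ≤-trans (s≤s z≤n) 3≤V
    code≤V b = ≤-trans (s≤s (s≤s z≤n)) 3≤V
    code≤V b̄ = 3≤V

    -- The bound k + 1 on the number of items is that just before a merge, and L leaves room for one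
    -- more item; each takes three numbers.
    enc-≤L : ∀ {S xs} → length S ≤ suc k → Enc S xs → 3 + length xs ≤ L
    enc-≤L {S} {xs} l x = ≤-trans (subst (λ z → 3 + z ≤ (2 + k) * 3) (sym (enc-length x)) (*-monoˡ-≤ 3 (s≤s l))) L≥

    i≤k⇒B≤ : ∀ {i} → i ≤ k → B i ≤ B k
    i≤k⇒B≤ i≤k = *-monoˡ-≤ E (s≤s i≤k)

    module _ {self₀ : Behaviour} {v : ℕ} (v≤w : v ≤ w) where

      Blk : ℕ → Behaviour
      Blk i = recurse v i (exec stepCmd) (exec (A.readLetter interp) self₀)

      -- The read resets the clock, so the bound `B 0` at the end is absolute and nothing is asked
      -- of the clock on entry.
      leaf-sound : ∀ {y kk σ t S s fr zs rest} → State S t s 1 fr (regs σ) (stks σ) → Ok σ → Old t S → t + 1 ≤ N →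
        height S + 1 ≤ n → length S ≤ k → input σ ≡ zs ++ rest → map (λ z → step (g z)) zs ≡ y ∷ [] →
        kk + Z + W₀ * (w * w) ≤ SM → Sat (Blk 0 kk σ) (Done (leaf y) S t s fr rest (clock σ)) (Failed (leaf y) S t)
      leaf-sound {kk = kk} {σ} {t} {S} {s} {fr} {z ∷ []} {rest} st ok o t≤N h≤n len inp refl sp =
        subst (λ u → Sat (exec (interp ⨾ enter) self₀ kk (consumed A.y u kk σ))
          (Done (leaf (step (g z))) S t s fr rest (clock σ)) (Failed (leaf (step (g z))) S t)) (sym inp)
          (sat-map
            (fits-sound (interp ⨾ enter) {Q} {Fails (leaf (step (g z))) t S} {self₀} {kk} {σ₁}
              -- The lower bound 1000 on `W₀` comes from here: 100 for the exchange of letters and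
              -- 900 for the step itself.
              (≤-trans (+-mono-≤ interp-weight (≤ᵇ⇒≤ (cmdWeight enter) 900 tt)) W₀≥)
              (subst (λ l → l + loops enter ≤ 2) (sym interp-loops) (≤ᵇ⇒≤ (loops enter) 2 tt))
              wp₁ ok₁ sp tm₁)
            (λ {σ′} ((S′ , D , ran , van , x) , d) → done ran van
              (subst (λ t′ → State S′ t′ s 1 fr (regs σ′) (stks σ′)) (+-comm 1 t) x) (Spent.ok d)
              (Spent.input≡ d) (inj₂ (clk₁ (Spent.clk d))))
            (λ r → r))
        where
        σ₀ σ₁ : Config
        σ₀ = record σ { input = rest ; clock = 0 }
        σ₁ = setReg A.y (letterCode z) (charge kk (bits (letterCode z)) σ₀)
        Q : Pred
        Q r st = ∃[ S′ ] ∃[ D ] (srun (leaf (step (g z))) t S ≡ just (S′ , D) × All Van D × State S′ (suc t)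
          s 1 fr r st)
        H≤V : suc (suc (height S)) ≤ V
        H≤V = ≤-trans (s≤s (subst (_≤ n) (+-comm (height S) 1) h≤n)) (≤-trans (s≤s n≤N) (<⇒≤ N<V))
        t≤V : t + 1 ≤ V
        t≤V = ≤-trans t≤N (<⇒≤ (<⇒≤ N<V))
        wp₁ : wp (interp ⨾ enter) Q (Fails (leaf (step (g z))) t S) (regs σ₁) (stks σ₁)
        wp₁ = elim (λ r st → wp (interp ⨾ enter) Q (Fails (leaf (step (g z))) t S) (r [ A.y ]≔ letterCode z) st) st
          λ { {y ∷ junk@(h ∷ ℓ ∷ f ∷ h′ ∷ ℓ′ ∷ f′ ∷ r ∷ sq ∷ e ∷ [])} x →
              interp-wp (Fails (leaf (step (g z))) t S) (wp enter Q (Fails (leaf (step (g z))) t S)) t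
                (height S) s 1 _ z junk (enter-wp {R = Fails (leaf (step (g z))) t S} {Q = Q} {h = h} {ℓ} {f}
                {r = r} {sq} {e} (g z) H≤V t≤V (enc-≤L (ℕ.m≤n⇒m≤1+n len) x)
                (old-mono (≤-trans (m≤m+n t 1) t≤V) o) x
                (λ ran van x′ → _ , _ , ran , van , state x′) (λ f → f)) }
        U≤TM : U + U ≤ TM
        U≤TM = ≤-trans (+-mono-≤ U≤E (≤-refl {U})) (≤-trans (+-mono-≤ (m≤m+n E _) U≤E)
          (≤-trans (+-monoˡ-≤ E (m≤m+n (B k) (B k))) TM≥))
          where
          U≤E : U ≤ E
          U≤E = m≤m+n U _
        bits≤ : bits (letterCode z) ≤ 1 * (w * w)
        bits≤ = ≤-trans (bits-≤w (code≤V z)) (≤-trans (x≤x*w w) (≤-reflexive (sym (*-identityˡ _))))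
        ok₀ : Ok σ₀
        ok₀ = record { regsOk = regsOk ok ; stksOk = stksOk ok ; timeOk = timeOk ok ; spaceOk = spaceOk ok }
        spent₁ : Spent U σ₀ (charge kk (bits (letterCode z)) σ₀)
        spent₁ = charged {kk} {c′ = 1} bits≤ (small 1) ok₀ sp (≤-trans (m≤m+n U U) U≤TM)
        ok₁ : Ok σ₁
        ok₁ = setReg-ok (Spent.ok spent₁) (code≤V z)
        tm₁ : clock σ₁ + U ≤ TM
        tm₁ = ≤-trans (+-monoˡ-≤ U (Spent.clk spent₁)) U≤TM
        clk₁ : ∀ {c} → c ≤ clock σ₁ + U → c ≤ B 0
        clk₁ c≤ = ≤-trans c≤ (≤-trans (+-monoˡ-≤ U (Spent.clk spent₁))
          (≤-trans (≤-trans (+-monoʳ-≤ U (m≤m+n U _)) ≤-refl) (m≤m+n E _)))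

      half : ∀ i → (2 ^ suc i) / 2 ≡ 2 ^ i
      half i = trans (cong (_/ 2) (ℕ.*-comm 2 (2 ^ i))) (ℕ.m*n/n≡m (2 ^ i) 2)

      padding-test : ∀ {S t s m fr r st} → State S t s m fr r st → test A.padding (at r st) ≡
        ((hi ≤ᵇ t) Bool.∨ (t + m ≤ᵇ lo))
      padding-test (state _) = refl

      padding-true : ∀ {i t} → hi ≤ t ⊎ t + 2 ^ suc i ≤ lo → ((hi ≤ᵇ t) Bool.∨ (t + 2 ^ suc i ≤ᵇ lo)) ≡ true
      padding-true (inj₁ hi≤t) rewrite ≤ᵇ-true hi≤t = refl
      padding-true {i} {t} (inj₂ end≤lo) rewrite ≤ᵇ-true end≤lo with hi ≤ᵇ t
      ... | true  = refl
      ... | false = refl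

      padding-false : ∀ {t e} → t < hi → lo < e → ((hi ≤ᵇ t) Bool.∨ (e ≤ᵇ lo)) ≡ false
      padding-false {t} {e} t<hi lo<e rewrite ≤ᵇ-false t<hi = ≤ᵇ-false lo<e

      if-sound : ∀ t c d {x self′ kk σ P R} → testWeight t ≤ W₀ → test t (at (regs σ) (stks σ)) ≡ x → Ok σ →
        kk + Z + W₀ * (w * w) ≤ SM → clock σ + U ≤ TM →
        (Spent U σ (charge kk (testCost t σ) σ) →
          Sat ((Bool.if x then exec c self′ kk else exec d self′ kk) (charge kk (testCost t σ) σ)) P R) →
        Sat (exec (if t then c else d) self′ kk σ) P R
      if-sound t c d {x} {self′} {kk} {σ} {P} {R} t≤ eq ok sp tm h =
        subst (λ x → Sat ((Bool.if x then exec c self′ kk else exec d self′ kk) (charge kk (testCost t σ) σ)) P R)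
          (sym (trans (test-at t σ) eq)) (h (charged {kk} {testCost t σ} (testCost-≤ t (regsOk ok)) t≤ ok sp tm))

      pad-sound : ∀ {i kk σ t S s fr rest} → State S t s (2 ^ suc i) fr (regs σ) (stks σ) → Ok σ →
        hi ≤ t ⊎ t + 2 ^ suc i ≤ lo → t + 2 ^ suc i ≤ N → input σ ≡ rest →
        kk + Z + W₀ * (w * w) ≤ SM → clock σ + B (suc i) ≤ TM →
        Sat (Blk (suc i) kk σ) (Done (pad {i}) S t s fr rest (clock σ)) (Failed (pad {i}) S t)
      pad-sound {i} {kk} {σ} {t} {S} {s} {fr} {rest} st ok pd t≤N inp sp tm =
        if-sound A.padding skipBlock splitBlock {self′ = λ k′ → Blk i (k′ + v)} {kk} (small (testWeight A.padding))
          (trans (padding-test st) (padding-true {i} pd)) ok sp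
            (≤-trans (+-monoʳ-≤ (clock σ) (≤-trans (m≤m+n U U) U+U≤B)) tm)
          λ d → sat-map
            (fits-sound skipBlock {λ r st → State S (t + 2 ^ suc i) s (2 ^ suc i) fr r st} {⊥}
              {λ k′ → Blk i (k′ + v)} {kk} (small (cmdWeight skipBlock)) z≤n
              (elim (wp skipBlock (State S (t + 2 ^ suc i) s (2 ^ suc i) fr) ⊥) st (λ x → t≤V , state x))
                (Spent.ok d) sp
              (≤-trans (+-monoˡ-≤ U (Spent.clk d)) (≤-trans (≤-reflexive (+-assoc (clock σ) U U))
                (≤-trans (+-monoʳ-≤ (clock σ) U+U≤B) tm))))
            (λ (x , d′) → done refl [] x (Spent.ok d′) (trans (Spent.input≡ d′) (trans (Spent.input≡ d) inp))
               (inj₁ (pad , ≤-trans (Spent.clk d′) (+-monoˡ-≤ U (Spent.clk d)))))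
            (λ (r , _) → ⊥-elim r)
        where
        U+U≤B : U + U ≤ B (suc i)
        U+U≤B = ≤-trans (+-monoʳ-≤ U (m≤m+n U _)) (m≤m+n E _)
        t≤V : t + 2 ^ suc i ≤ V
        t≤V = ≤-trans t≤N (<⇒≤ (<⇒≤ N<V))

      node-fails-left : ∀ {i} {l r : Tree i} {t S} → Fails l t S → Fails (node l r) t S
      node-fails-left {l = l} {r} fl eq vans with node-just l r eq
      ... | _ , _ , E₁ , _ , x , _ , _ , refl = fl x (All.++⁻ˡ E₁ vans)

      node-fails-right : ∀ {i} {l r : Tree i} {t S S₁ D₁} → srun l t S ≡ just (S₁ , D₁) → Fails r (t + 2 ^ i)
        S₁ → Fails (node l r) t S
      node-fails-right {l = l} {r} eq₁ fl eq vans with node-just l r eq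
      ... | _ , _ , E₁ , _ , x , y , _ , refl with trans (sym eq₁) x
      ...   | refl = fl y (All.++⁻ʳ E₁ vans)

      node-run : ∀ {i} {l r : Tree i} {t S S₁ D₁ S₂ D₂} → srun l t S ≡ just (S₁ , D₁) → srun r (t + 2 ^ i) S₁
        ≡ just (S₂ , D₂) →
                 srun (node l r) t S ≡ just (mergeTop t S₂ , D₁ ++ D₂)
      node-run {i} {l} {r} {t} {S₁ = S₁} x y rewrite x | y = refl

      -- A block of level i has k - i blocks around it. Each accounts for at most one item of S,
      -- left by a finished left half, and for one saved value in `frames`. The term `i * w`
      -- reserves control stack for the calls still to be nested, and `B i` time until the clock is
      -- reset or the padding is skipped.
      Sound : ∀ {i} → Tree i → Set₁
      Sound {i} τ = ∀ {kk σ t S s fr zs rest} → State S t s (2 ^ i) fr (regs σ) (stks σ) → Ok σ → Old t S →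
        Placed lo hi t τ →
        t + 2 ^ i ≤ N → height S + length (yield τ) ≤ n → length S + i ≤ k → length fr + i ≤ k →
        input σ ≡ zs ++ rest → map (λ z → step (g z)) zs ≡ yield τ →
        kk + i * w + Z + W₀ * (w * w) ≤ SM → clock σ + B i ≤ TM →
        Sat (Blk i kk σ) (Done τ S t s fr rest (clock σ)) (Failed τ S t)

      -- The clock when the second half-block has been read.
      clk-node : ∀ {i t} {l r : Tree i} {c c₁ c₂ c₃ c₄} → Placed lo hi t (node l r) → c₁ ≤ c + 5 * U → Clk l
        c₁ c₂ → c₃ ≤ c₂ + U → Clk r c₃ c₄ →
                 c₄ ≤ B i + 3 * U
      clk-node {i} {c₃ = c₃} {c₄} pl h₁ _ h₃ (inj₂ live) = ≤-trans live (m≤m+n _ _)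
      clk-node {i} pl h₁ (inj₂ live) h₃ (inj₁ (_ , h₄)) =
        ≤-trans h₄ (bump {B i} {2} (bump {B i} {1} (≤-trans h₃
          (≤-trans (+-monoˡ-≤ U live) (≤-reflexive (cong (λ z → B i + z) (sym (+-identityʳ U)))))) ≤-refl)
          ≤-refl)
      clk-node pl h₁ (inj₁ (p , _)) h₃ (inj₁ (q , _)) = ⊥-elim (not-both-pads lo<hi pl p q)

      -- The clock when the second half-block starts.
      clk-mid : ∀ {i} {l : Tree i} {c c₁ c₂ c₃} → i ≤ k → c + B (suc i) ≤ TM → c₁ ≤ c + 5 * U → Clk l c₁ c₂ →
        c₃ ≤ c₂ + U → c₃ + B i ≤ TM
      clk-mid {i} {c = c} i≤k tm h₁ (inj₁ (_ , h₂)) h₃ = ≤-trans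
        (+-monoˡ-≤ (B i) (bump {c} {7} (≤-trans h₂ (bump {c} {6} (bump {c} {5} h₁ ≤-refl) ≤-refl)) h₃))
        (≤-trans (≤-reflexive (+-assoc c (8 * U) (B i)))
          (≤-trans (+-monoʳ-≤ c (+-monoˡ-≤ (B i) (*-monoˡ-≤ U (≤ᵇ⇒≤ 8 16 tt)))) tm))
      -- After a letter the clock restarts from an absolute bound `B i`, and another `B i` is
      -- reserved for the second half; hence the limit `B k + B k + E` on the time.
      clk-mid {i} i≤k tm h₁ (inj₂ live) h₃ = ≤-trans (+-mono-≤
        (≤-trans h₃ (+-mono-≤ (≤-trans live (i≤k⇒B≤ i≤k)) (m≤m+n U _))) (i≤k⇒B≤ i≤k))
        (≤-trans (≤-reflexive (rot (B k) E (B k))) TM≥)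
        where
        rot : ∀ a b c → a + b + c ≡ a + c + b
        rot = solve-∀

      finish-sound : ∀ {i self′ kk σ S t s fr} → State S (t + 2 ^ suc i) t (2 ^ i) (s ∷ fr) (regs σ) (stks σ) → Ok σ →
        t + 2 ^ suc i ≤ N → height S ≤ n → length S ≤ suc k → Old (t + 2 ^ suc i) S →
        kk + Z + W₀ * (w * w) ≤ SM → clock σ + 3 * U ≤ TM →
        Sat (exec finish self′ kk σ) (Post (State (mergeTop t S) (t + 2 ^ suc i) s (2 ^ suc i) fr) (3 * U) σ) (λ _ → ⊥)
      finish-sound {i} {self′} {kk} {σ} {S} {t} {s} {fr} st ok t≤N h≤n len o sp tm =
        then-sound double (A.merge ⨾ pop A.frames A.s) {Q₁} {self′} {kk} {σ} (small (cmdWeight double)) z≤n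
          (elim (wp double Q₁ ⊥) st λ {junk} {xs} x →
            subst (_≤ V) (ℕ.*-comm 2 (2 ^ i)) 2^≤V ,
            subst (λ m → State S t′ t m (s ∷ fr) (regsAt t′ (height S) t (2 ^ i * 2) junk)
              (xs ∷ (s ∷ fr) ∷ [])) (ℕ.*-comm (2 ^ i) 2) (state x))
          ok sp (early 0 tt (≤-reflexive (sym (+-identityʳ _))))
        λ {σ₁} st₁ d₁ → then-sound A.merge (pop A.frames A.s) {Q₂} {self′} {kk} {σ₁} (small (cmdWeight A.merge)) z≤n
          (elim (wp A.merge Q₂ ⊥) st₁ λ {junk} {xs} x →
            merge-wp {⊥} {Q₂} {t′} {t} {2 ^ suc i} {S} {xs} {s ∷ fr} junk (≤-trans h≤n (≤-trans n≤N N≤V))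
              (≤-trans t≤N N≤V)
              (≤-trans (m≤n+m _ 3) (enc-≤L len x)) o x
              (λ {xs′} {junk′} x′ → subst (λ H → State (mergeTop t S) t′ t (2 ^ suc i) (s ∷ fr)
                (regsAt t′ H t (2 ^ suc i) junk′) (xs′ ∷ (s ∷ fr) ∷ [])) (mergeTop-height t S) (state x′)))
          (Spent.ok d₁) sp (early 1 tt (after 0 {σ₂ = σ₁} (≤-reflexive (sym (+-identityʳ _))) (Spent.clk d₁)))
        λ {σ₂} st₂ d₂ → sat-map
          (fits-sound (pop A.frames A.s) {Q₃} {⊥} {self′} {kk} {σ₂} (small 1) z≤n
            (elim (wp (pop A.frames A.s) Q₃ ⊥) st₂ λ x → state x)
            (Spent.ok d₂) sp (early 2 tt (after 1 {σ₂ = σ₂}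
              (after 0 {σ₂ = σ₁} (≤-reflexive (sym (+-identityʳ _))) (Spent.clk d₁)) (Spent.clk d₂))))
          (λ (q , d₃) → q , spent-mono (≤-reflexive (add U)) (spent-trans d₁ (spent-trans d₂ d₃)))
          proj₁
        where
        double : Cmd
        double = A.m ≔ var A.m :* lit 2
        t′ : ℕ
        t′ = t + 2 ^ suc i
        Q₁ Q₂ Q₃ : Pred
        Q₁ = State S t′ t (2 ^ suc i) (s ∷ fr)
        Q₂ = State (mergeTop t S) t′ t (2 ^ suc i) (s ∷ fr)
        Q₃ = State (mergeTop t S) t′ s (2 ^ suc i) fr
        N≤V : N ≤ V
        N≤V = <⇒≤ (<⇒≤ N<V)
        2^≤V : 2 ^ suc i ≤ V
        2^≤V = ≤-trans (m≤n+m _ t) (≤-trans t≤N N≤V)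
        early : ∀ j {c} → T (suc j ≤ᵇ 3) → c ≤ clock σ + j * U → c + U ≤ TM
        early j j≤ c≤ = ≤-trans (bump {clock σ} {j} c≤ ≤-refl)
          (≤-trans (+-monoʳ-≤ (clock σ) (*-monoˡ-≤ U (≤ᵇ⇒≤ (suc j) 3 j≤))) tm)
        after : ∀ j {c σ₂} → c ≤ clock σ + j * U → clock σ₂ ≤ c + U → clock σ₂ ≤ clock σ + suc j * U
        after j c≤ d = bump {clock σ} {j} c≤ d
        add : ∀ u → u + (u + u) ≡ 3 * u
        add = solve-∀

      node-sound : ∀ {i} (l r : Tree i) → Sound l → Sound r →
        ∀ {kk σ t S s fr zs₁ zs₂ rest} → State S t s (2 ^ suc i) fr (regs σ) (stks σ) → Ok σ → Old t S →
          Placed lo hi t (node l r) →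
        t + 2 ^ suc i ≤ N → height S + length (yield (node l r)) ≤ n → length S + suc i ≤ k → length fr + suc i ≤ k →
        input σ ≡ zs₁ ++ zs₂ ++ rest → map (λ z → step (g z)) zs₁ ≡ yield l → map (λ z → step (g z)) zs₂ ≡ yield r →
        kk + suc i * w + Z + W₀ * (w * w) ≤ SM → clock σ + B (suc i) ≤ TM →
        Sat (Blk (suc i) kk σ) (Done (node l r) S t s fr rest (clock σ)) (Failed (node l r) S t)
      node-sound {i} l r soundˡ soundʳ {kk} {σ} {t} {S} {s} {fr} {zs₁} {zs₂} {rest} st ok o
        pl@(node t<hi lo<e plˡ plʳ) t≤N h≤n len frl inp zs₁≡ zs₂≡ sp tm =
        if-sound A.padding skipBlock splitBlock {self′ = self′} {kk} {σ} (small (testWeight A.padding))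
          (trans (padding-test st) (padding-false t<hi lo<e)) ok sp₀ (early 0 tt start)
        λ d₁ → let c₁ = bump {clock σ} {0} start (Spent.clk d₁) in
        then-sound (push A.frames (var A.s)) openBlock {State S t s (2 ^ suc i) (s ∷ fr)} {self′} {kk} (small 1) z≤n
          (elim (λ r st → (∀ x → lookup r x ≤ V) → wp (push A.frames (var A.s))
            (State S t s (2 ^ suc i) (s ∷ fr)) ⊥ r st) st
            (λ x regs≤ → regs≤ A.s , frames≤ , state x) (regsOk ok))
          (Spent.ok d₁) sp₀ (early 1 tt c₁)
        λ {σ₂} st₂ d₂ → let c₂ = bump {clock σ} {1} c₁ (Spent.clk d₂) in
        then-sound (A.s ≔ var A.t) halves {State S t t (2 ^ suc i) (s ∷ fr)} {self′} {kk} {σ₂} (small 1) z≤n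
          (elim (wp (A.s ≔ var A.t) (State S t t (2 ^ suc i) (s ∷ fr)) ⊥) st₂ (λ x → t≤V , state x))
          (Spent.ok d₂) sp₀ (early 2 tt c₂)
        λ {σ₃} st₃ d₃ → let c₃ = bump {clock σ} {2} c₂ (Spent.clk d₃) in
        then-sound (A.m ≔ var A.m :/ lit 2) (self ⨾ self ⨾ finish) {State S t t (2 ^ i) (s ∷ fr)} {self′}
          {kk} {σ₃} (small (cmdWeight (A.m ≔ var A.m :/ lit 2))) z≤n
          (elim (wp (A.m ≔ var A.m :/ lit 2) (State S t t (2 ^ i) (s ∷ fr)) ⊥) st₃ λ {junk} {xs} x →
            subst (_≤ V) (sym (half i)) 2^≤V ,
            subst (λ m → State S t t m (s ∷ fr) (regsAt t (height S) t (2 ^ suc i / 2) junk)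
              (xs ∷ (s ∷ fr) ∷ [])) (half i) (state x))
          (Spent.ok d₃) sp₀ (early 3 tt c₃)
        λ {σ₄} st₄ d₄ →
          let c₄ = bump {clock σ} {3} c₃ (Spent.clk d₄)
              d₅ = charged {kk} {1} {1} {σ₄} 1≤w² (small 1) (Spent.ok d₄) sp₀ (early 4 tt c₄)
              c₅ = bump {clock σ} {4} c₄ (Spent.clk d₅)
              inp₅ = trans (Spent.input≡ d₄) (trans (Spent.input≡ d₃)
                (trans (Spent.input≡ d₂) (trans (Spent.input≡ d₁) inp)))
          in sat-bind
            (soundˡ {kk + v} {charge kk 1 σ₄} {t} {S} {t} {s ∷ fr} {zs₁} {zs₂ ++ rest} st₄ (Spent.ok d₅) o plˡ t₁≤N hˡ
              (≤-trans (+-monoʳ-≤ (length S) (n≤1+n i)) len) (subst (_≤ k) (ℕ.+-suc (length fr) i) frl) inp₅ zs₁≡ spᵢ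
              (≤-trans (+-monoˡ-≤ (B i) c₅) (≤-trans (≤-reflexive (+-assoc (clock σ) (5 * U) (B i)))
                (≤-trans (+-monoʳ-≤ (clock σ) (+-monoˡ-≤ (B i) (*-monoˡ-≤ U (≤ᵇ⇒≤ 5 16 tt)))) tm))))
            (λ {σ₆} D₁ → second {charge kk 1 σ₄} {σ₆} D₁ c₅)
            (λ (fl , within) → node-fails-left {l = l} {r} {t} {S} fl , within)
        where
        self′ : Behaviour
        self′ k′ = Blk i (k′ + v)
        start : clock σ ≤ clock σ + 0 * U
        start = ≤-reflexive (sym (+-identityʳ _))
        N≤V : N ≤ V
        N≤V = <⇒≤ (<⇒≤ N<V)
        t≤V : t ≤ V
        t≤V = ≤-trans (m≤m+n t _) (≤-trans t≤N N≤V)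
        2^≤V : 2 ^ i ≤ V
        2^≤V = ≤-trans (m≤m+n (2 ^ i) _) (≤-trans (m≤n+m _ t) (≤-trans t≤N N≤V))
        t₂≤N : t + 2 ^ i + 2 ^ i ≤ N
        t₂≤N = subst (_≤ N) (sym (end t i)) t≤N
        t₁≤N : t + 2 ^ i ≤ N
        t₁≤N = ≤-trans (m≤m+n _ _) t₂≤N
        i≤k : i ≤ k
        i≤k = ≤-trans (n≤1+n i) (≤-trans (m≤n+m (suc i) (length S)) len)
        frames≤ : suc (length fr) ≤ L
        frames≤ = ≤-trans (s≤s (≤-trans (m≤m+n _ _) frl)) (≤-trans (≤-trans (n≤1+n (suc k)) (ℕ.m≤m*n (2 + k) 3)) L≥)
        sp₀ : kk + Z + W₀ * (w * w) ≤ SM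
        sp₀ = ≤-trans (+-monoˡ-≤ _ (+-monoˡ-≤ Z (m≤m+n kk _))) sp
        spᵢ : kk + v + i * w + Z + W₀ * (w * w) ≤ SM
        spᵢ = ≤-trans (+-monoˡ-≤ _ (+-monoˡ-≤ Z (≤-trans (+-monoˡ-≤ (i * w) (+-monoʳ-≤ kk v≤w))
          (≤-reflexive (+-assoc kk w (i * w)))))) sp
        1≤w² : 1 ≤ 1 * (w * w)
        1≤w² = ≤-trans (x≤x*w 1) (x*w≤x*w² 1)
        early : ∀ j {c} → T (suc j ≤ᵇ 16) → c ≤ clock σ + j * U → c + U ≤ TM
        early j j≤ c≤ = ≤-trans (bump {clock σ} {j} c≤ ≤-refl) (≤-trans (+-monoʳ-≤ (clock σ)
          (≤-trans (*-monoˡ-≤ U (≤ᵇ⇒≤ (suc j) 16 j≤)) (m≤m+n E _))) tm)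
        h≤n′ : height S + length (yield l) + length (yield r) ≤ n
        h≤n′ = subst (_≤ n) (trans (cong (λ z → height S + z) (List.length-++ (yield l)))
          (sym (+-assoc (height S) _ _))) h≤n
        hˡ : height S + length (yield l) ≤ n
        hˡ = ≤-trans (m≤m+n _ _) h≤n′
        second : ∀ {σ₅ σ₆} → Done l S t t (s ∷ fr) (zs₂ ++ rest) (clock σ₅) σ₆ → clock σ₅ ≤ clock σ + 5 * U →
                 Sat (exec (self ⨾ finish) self′ kk σ₆) (Done (node l r) S t s fr rest (clock σ))
                   (Failed (node l r) S t)
        second {σ₅} {σ₆} D₁ c₅ =
          sat-bind
            (soundʳ {kk + v} {charge kk 1 σ₆} {t + 2 ^ i} {S₁} {t} {s ∷ fr} {zs₂} {rest} (Done.final≡ D₁)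
              (Spent.ok d₇) (srun-old l o (Done.ran D₁)) plʳ t₂≤N hʳ
              (≤-trans (+-monoˡ-≤ i (atMostOneNew-length (srun-new l o (Done.ran D₁))))
                (subst (_≤ k) (ℕ.+-suc (length S) i) len))
              (subst (_≤ k) (ℕ.+-suc (length fr) i) frl) (Done.inp D₁) zs₂≡ spᵢ tm₇)
            (λ {σ₈} D₂ → sat-map
              (finish-sound {i} {self′} {kk} {σ₈} {Done.S′ D₂} {t} {s} {fr}
                (subst (λ t′ → State (Done.S′ D₂) t′ t (2 ^ i) (s ∷ fr) (regs σ₈) (stks σ₈)) (end t i)
                  (Done.final≡ D₂)) (Done.ok D₂) t≤N
                (≤-trans (srun-height r (Done.ran D₂)) hʳ)
                (≤-trans (atMostOneNew-length (srun-new r (srun-old l o (Done.ran D₁)) (Done.ran D₂)))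
                  (s≤s (≤-trans (atMostOneNew-length (srun-new l o (Done.ran D₁)))
                    (≤-trans (≤-trans (s≤s (m≤m+n _ i)) (≤-reflexive (sym (ℕ.+-suc _ i)))) len))))
                (subst (λ t′ → Old t′ (Done.S′ D₂)) (end t i) (srun-old r (srun-old l o (Done.ran D₁)) (Done.ran D₂)))
                sp₀ (≤-trans (+-monoˡ-≤ (3 * U) (c₈ D₂)) (B≤TM′)))
              (λ (x , d) → done (node-run {l = l} {r} (Done.ran D₁) (Done.ran D₂))
                (All.++⁺ (Done.van D₁) (Done.van D₂)) x (Spent.ok d)
                 (trans (Spent.input≡ d) (Done.inp D₂))
                 (inj₂ (≤-trans (Spent.clk d) (≤-trans (+-monoˡ-≤ (3 * U) (c₈ D₂)) 6U≤E))))
              (λ ()))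
            (λ (fl , within) → node-fails-right {l = l} {r} {t} {S} (Done.ran D₁) fl , within)
          where
          S₁ : Stack
          S₁ = Done.S′ D₁
          tm₆ : clock σ₆ + U ≤ TM
          tm₆ = ≤-trans (m≤m+n _ (B i)) (clk-mid {i} {l} {clock σ} {clock σ₅} {clock σ₆} i≤k tm c₅ (Done.clk D₁) ≤-refl)
          d₇ : Spent U σ₆ (charge kk 1 σ₆)
          d₇ = charged {kk} {1} {1} {σ₆} 1≤w² (small 1) (Done.ok D₁) sp₀ tm₆
          tm₇ : clock (charge kk 1 σ₆) + B i ≤ TM
          tm₇ = clk-mid {i} {l} {clock σ} {clock σ₅} {clock σ₆} i≤k tm c₅ (Done.clk D₁) (Spent.clk d₇)
          hʳ : height S₁ + length (yield r) ≤ n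
          hʳ = ≤-trans (+-monoˡ-≤ _ (srun-height l (Done.ran D₁))) h≤n′
          c₈ : ∀ {σ₈} → Done r S₁ (t + 2 ^ i) t (s ∷ fr) rest (clock (charge kk 1 σ₆)) σ₈ → clock σ₈ ≤ B i + 3 * U
          c₈ {σ₈} D₂ = clk-node {i} {t} {l} {r} {clock σ} {clock σ₅} {clock σ₆} {clock (charge kk 1 σ₆)}
            {clock σ₈} pl c₅ (Done.clk D₁) (Spent.clk d₇) (Done.clk D₂)
          6U≤E : B i + 3 * U + 3 * U ≤ B (suc i)
          6U≤E = ≤-trans (≤-reflexive (trans (+-assoc (B i) (3 * U) (3 * U))
            (trans (cong (λ z → B i + z) (sym (ℕ.*-distribʳ-+ U 3 3))) (+-comm (B i) (6 * U)))))
            (+-monoˡ-≤ (B i) (*-monoˡ-≤ U (≤ᵇ⇒≤ 6 16 tt)))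
          B≤TM′ : B i + 3 * U + 3 * U ≤ TM
          B≤TM′ = ≤-trans 6U≤E (≤-trans (≤-reflexive (+-comm E (B i)))
            (≤-trans (+-monoˡ-≤ E (≤-trans (i≤k⇒B≤ i≤k) (m≤m+n (B k) (B k)))) TM≥))

      block-sound : ∀ {i} (τ : Tree i) → Sound τ
      block-sound (leaf y) {kk} {σ} {t} {S} {s} {fr} {zs} {rest} st ok o pl t≤N h≤n len frl inp zs≡ sp tm =
        leaf-sound {y} {kk} {σ} {t} {S} {s} {fr} {zs} {rest} st ok o t≤N h≤n (subst (_≤ k) (+-identityʳ _) len) inp zs≡
          (subst (λ z → z + Z + W₀ * (w * w) ≤ SM) (+-identityʳ kk) sp)
      block-sound (pad {i}) {kk} {σ} {t} {S} {s} {fr} {[]} {rest} st ok o (pad pd) t≤N h≤n len frl inp zs≡ sp tm =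
        pad-sound {i} {kk} {σ} {t} {S} {s} {fr} {rest} st ok pd t≤N inp
          (≤-trans (+-monoˡ-≤ _ (+-monoˡ-≤ Z (m≤m+n kk _))) sp) tm
      block-sound (node l r) {zs = zs} {rest} st ok o pl t≤N h≤n len frl inp zs≡ sp tm =
        let zs₁ , zs₂ , eq , zs₁≡ , zs₂≡ = map-split (λ z → step (g z)) {yield l} zs zs≡
        in node-sound l r (block-sound l) (block-sound r) {zs₁ = zs₁} {zs₂} {rest} st ok o pl t≤N h≤n len frl
             (trans inp (trans (cong (_++ rest) eq) (List.++-assoc zs₁ zs₂ rest))) zs₁≡ zs₂≡ sp tm

-- The two passes

-- The subdivision of a word that starts a block of length 2^i, followed by padding.
build : ∀ i → List Letter → Tree i
-- A placeholder: under `Fits`, no block of length 1 is empty.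
build zero    []       = leaf (opening true)
build zero    (y ∷ _)  = leaf (step y)
build (suc i) []       = pad
build (suc i) (y ∷ ys) = node (build i (take (2 ^ i) (y ∷ ys))) (build i (List.drop (2 ^ i) (y ∷ ys)))

Even : ℕ → Set
Even m = ∃[ j ] m ≡ j * 2

even-⊓ : ∀ {m n} → Even m → Even n → Even (m ⊓ n)
even-⊓ (i , refl) (j , refl) = i ⊓ j , sym (ℕ.*-distribʳ-⊓ 2 i j)

even-∸ : ∀ {m n} → Even m → Even n → Even (m ∸ n)
even-∸ (i , refl) (j , refl) = i ∸ j , sym (ℕ.*-distribʳ-∸ 2 i j)

-- The admissible numbers of letters in a block. As the length of the word is even, its end never
-- separates the two letters of a block of length 2, so padding only occurs in blocks of length at
-- least 2, as `Tree` demands.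
Fits : ℕ → ℕ → Set
Fits zero    m = m ≡ 1
Fits (suc i) m = Even m × m ≤ 2 ^ suc i

even-2^ : ∀ i → Even (2 ^ suc i)
even-2^ i = 2 ^ i , ℕ.*-comm 2 (2 ^ i)

fits-two : ∀ {m} → Fits 1 (suc m) → suc m ≡ 2
fits-two {zero}        ((zero , ()) , _)
fits-two {zero}        ((suc j , ()) , _)
fits-two {suc zero}    _ = refl
fits-two {suc (suc m)} (_ , s≤s (s≤s ()))

fits-take : ∀ i {m} → Fits (suc i) (suc m) → Fits i (2 ^ i ⊓ suc m)
fits-take zero    {m} f = cong (1 ⊓_) (fits-two {m} f)
fits-take (suc i) (ev , le) = even-⊓ (even-2^ i) ev , ℕ.m⊓n≤m _ _

fits-drop : ∀ i {m} → Fits (suc i) (suc m) → Fits i (suc m ∸ 2 ^ i)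
fits-drop zero    {m} f = cong (_∸ 1) (fits-two {m} f)
fits-drop (suc i) {m} (ev , le) = even-∸ ev (even-2^ i) ,
  ≤-trans (ℕ.∸-monoˡ-≤ (2 ^ suc i) le) (≤-reflexive (trans
    (cong (λ z → 2 ^ suc i + z ∸ 2 ^ suc i) (+-identityʳ _)) (ℕ.m+n∸n≡m (2 ^ suc i) (2 ^ suc i))))

yield-build : ∀ i xs → Fits i (length xs) → yield (build i xs) ≡ map step xs
yield-build zero    (y ∷ [])  f = refl
yield-build (suc i) []        f = refl
yield-build (suc i) xs@(y ∷ ys) f = begin
  yield (build i (take (2 ^ i) xs)) ++ yield (build i (List.drop (2 ^ i) xs))
    ≡⟨ cong₂ _++_ (yield-build i (take (2 ^ i) xs) (subst (Fits i) (sym (List.length-take (2 ^ i) xs)) (fits-take i f)))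
                  (yield-build i (List.drop (2 ^ i) xs) (subst (Fits i) (sym (List.length-drop (2 ^ i) xs))
                    (fits-drop i f))) ⟩
  map step (take (2 ^ i) xs) ++ map step (List.drop (2 ^ i) xs)
    ≡⟨ List.map-++ step (take (2 ^ i) xs) _ ⟨
  map step (take (2 ^ i) xs ++ List.drop (2 ^ i) xs)
    ≡⟨ cong (map step) (List.take++drop≡id (2 ^ i) xs) ⟩
  map step xs ∎
  where open ≡-Reasoning

placed-build : ∀ i xs hi t → length xs ≡ (hi ∸ t) ⊓ 2 ^ i → Placed 0 hi t (build i xs)
placed-build zero    []       hi t eq = leaf
placed-build zero    (y ∷ ys) hi t eq = leaf
placed-build (suc i) []       hi t eq = pad (inj₁ (ℕ.m∸n≡0⇒m≤n
  (zero-⊓ (hi ∸ t) (2 ^ suc i) (ℕ.m^n>0 2 (suc i)) (sym eq))))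
  where
  zero-⊓ : ∀ m n → 0 < n → m ⊓ n ≡ 0 → m ≡ 0
  zero-⊓ zero    n       _ _  = refl
  zero-⊓ (suc m) (suc n) _ ()
placed-build (suc i) xs@(y ∷ ys) hi t eq = node t<hi (ℕ.<-≤-trans (ℕ.m^n>0 2 (suc i)) (m≤n+m _ t))
  (placed-build i (take (2 ^ i) xs) hi t (trans (List.length-take (2 ^ i) xs) (trans (cong (2 ^ i ⊓_) eq) left)))
  (placed-build i (List.drop (2 ^ i) xs) hi (t + 2 ^ i) (trans (List.length-drop (2 ^ i) xs)
    (trans (cong (_∸ 2 ^ i) eq) right)))
  where
  t<hi : t < hi
  t<hi = ℕ.≰⇒> λ hi≤t → ℕ.1+n≢0 (trans eq (cong (_⊓ 2 ^ suc i) (ℕ.m≤n⇒m∸n≡0 hi≤t)))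
  left : 2 ^ i ⊓ ((hi ∸ t) ⊓ 2 ^ suc i) ≡ (hi ∸ t) ⊓ 2 ^ i
  left = trans (ℕ.⊓-comm (2 ^ i) _) (trans (ℕ.⊓-assoc (hi ∸ t) (2 ^ suc i) (2 ^ i))
    (cong ((hi ∸ t) ⊓_) (ℕ.m≥n⇒m⊓n≡n (m≤m+n (2 ^ i) _))))
  right : (hi ∸ t) ⊓ 2 ^ suc i ∸ 2 ^ i ≡ (hi ∸ (t + 2 ^ i)) ⊓ 2 ^ i
  right = trans (ℕ.∸-distribʳ-⊓ (2 ^ i) (hi ∸ t) (2 ^ suc i)) (cong₂ _⊓_ (ℕ.∸-+-assoc hi t (2 ^ i))
            (trans (cong (_∸ 2 ^ i) (cong (λ z → 2 ^ i + z) (+-identityʳ _))) (ℕ.m+n∸n≡m (2 ^ i) (2 ^ i))))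

-- Reversal sends a boundary x to N - x, which reflects both the block and the interval of letters.
-- The relations are written as sums to avoid truncated subtraction.
placed-mirror : ∀ {N lo hi lo′ hi′ i t t′} {τ : Tree i} → lo + hi′ ≡ N → hi + lo′ ≡ N → t + 2 ^ i + t′ ≡ N →
                Placed lo hi t τ → Placed lo′ hi′ t′ (mirror τ)
placed-mirror e₁ e₂ e₃ leaf = leaf
placed-mirror {lo = lo} {hi} {lo′} {hi′} {t = t} {t′} e₁ e₂ e₃ (pad {i} (inj₁ hi≤t)) =
  pad (inj₂ (ℕ.+-cancelˡ-≤ hi _ _ (≤-trans (+-monoˡ-≤ _ hi≤t)
    (≤-reflexive (trans (rot t t′ (2 ^ suc i)) (trans e₃ (sym e₂)))))))
  where
  rot : ∀ a b c → a + (b + c) ≡ a + c + b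
  rot = solve-∀
placed-mirror {lo = lo} {hi} {lo′} {hi′} {t = t} {t′} e₁ e₂ e₃ (pad {i} (inj₂ end≤lo)) =
  pad (inj₁ (ℕ.+-cancelˡ-≤ lo _ _ (≤-trans (≤-reflexive (trans e₁ (sym e₃))) (+-monoˡ-≤ t′ end≤lo))))
placed-mirror {N} {lo} {hi} {lo′} {hi′} {t = t} {t′} e₁ e₂ e₃ (node {i} t<hi lo<e pl pr) =
  node (ℕ.+-cancelˡ-< lo _ _ (ℕ.<-≤-trans (ℕ.+-monoˡ-< t′ lo<e) (≤-reflexive (trans e₃ (sym e₁)))))
       (ℕ.+-cancelˡ-< hi _ _ (ℕ.≤-<-trans (≤-reflexive (trans e₂ (trans (sym e₃) (rot t (2 ^ suc i) t′))))
         (ℕ.+-monoˡ-< (t′ + 2 ^ suc i) t<hi)))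
       (placed-mirror e₁ e₂ (trans (cong (_+ t′) (end t i)) e₃) pr)
       (placed-mirror e₁ e₂ (trans (rot₂ t (2 ^ i) t′) (trans (cong (_+ t′) (end t i)) e₃)) pl)
  where
  rot : ∀ a b c → a + b + c ≡ a + (c + b)
  rot = solve-∀
  rot₂ : ∀ a b c → a + b + (c + b) ≡ a + b + b + c
  rot₂ = solve-∀

yield-mirror-build : ∀ {i xs} → yield (build i xs) ≡ map step xs → map (λ z → step (swap z)) (reverse xs) ≡
  yield (mirror (build i xs))
yield-mirror-build {i} {xs} eq = begin
  map (λ z → step (swap z)) (reverse xs)  ≡⟨ List.map-cong step-swap (reverse xs) ⟩
  map (λ z → opposite (step z)) (reverse xs)  ≡⟨ List.map-∘ (reverse xs) ⟩
  map opposite (map step (reverse xs))  ≡⟨ cong (map opposite) (List.reverse-map step xs) ⟩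
  map opposite (reverse (map step xs))  ≡⟨ cong (λ ys → map opposite (reverse ys)) eq ⟨
  map opposite (reverse (yield (build i xs)))  ≡⟨ yield-mirror (build i xs) ⟨
  yield (mirror (build i xs))  ∎
  where open ≡-Reasoning

-- From blocks to a whole pass

infixr 3 _⨾*_
_⨾*_ : List Cmd → Cmd → Cmd
cs ⨾* d = List.foldr _⨾_ d cs

data Ready (n p α k N : ℕ) : Vec ℕ 21 → Vec (List ℕ) 2 → Set where
  ready : ∀ {junk} → Ready n p α k N (n ∷ p ∷ α ∷ k ∷ N ∷ junk) ([] ∷ [] ∷ [])

module Scan (V w L TM SM : ℕ) (w≡ : bits V ≡ w)
  (n p α k N lo hi : ℕ) .{{_ : NonZero p}} (p≥2 : 2 ≤ p) (α<p : α < p) (p≤V : p ≤ V)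
  (interp : Cmd) (g : Letter → Letter)
  (W₀ : ℕ) (W₀≥ : 1000 ≤ W₀)
  where
  open Limits V w L TM SM w≡
  open Blocks V w L TM SM w≡
  open Hash n p α k N lo hi p≥2 α<p p≤V
  open Simulation V w L TM SM w≡ n p α k N lo hi p≥2 α<p p≤V
  open Block V w L TM SM w≡ n p α k N lo hi p≥2 α<p p≤V interp g W₀ W₀≥

  module Passes
    (interp-wp : Interprets interp g)
    (interp-weight : cmdWeight interp ≤ 100) (interp-loops : loops interp ≡ 0)
    (n≤N : n ≤ N) (N<V : 2 + N ≤ V) (3≤V : 3 ≤ V) (lo<hi : lo < hi) (L≥ : (2 + k) * 3 ≤ L)
    (TM≥ : B k + B k + E ≤ TM) (N≡ : 2 ^ k ≡ N) (k≤V : k ≤ V) (hi≤N : hi ≤ N)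
    (SM≥ : w + k * w + Z + W₀ * (w * w) ≤ SM)
    where

    open Sound interp-wp interp-weight interp-loops n≤N N<V 3≤V lo<hi L≥ TM≥

    wps : List Cmd → Pred → Pred
    wps []       Q = Q
    wps (c ∷ cs) Q = wp c (wps cs Q) ⊥

    prefix-sound : ∀ cs d {Q kk σ P′ R′} → All (λ c → cmdWeight c ≤ W₀ × loops c ≤ 2) cs → wps cs Q (regs σ)
      (stks σ) → Ok σ →
      kk + Z + W₀ * (w * w) ≤ SM → clock σ + length cs * U ≤ TM →
      (∀ {σ′} → Q (regs σ′) (stks σ′) → Spent (length cs * U) σ σ′ → Sat (exec d noSelf kk σ′) P′ R′) →
      Sat (exec (cs ⨾* d) noSelf kk σ) P′ R′
    prefix-sound []       d {σ = σ} []             q ok sp tm h = h q (spent ok (m≤m+n (clock σ) 0) refl)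
    prefix-sound (c ∷ cs) d {Q} {kk} {σ} ((x , l) ∷ xs) q ok sp tm h =
      then-sound c (cs ⨾* d) {wps cs Q} {noSelf} {kk} {σ} x l q ok sp (≤-trans (+-monoʳ-≤ (clock σ) (m≤m+n U _)) tm)
        λ {σ′} q′ s → prefix-sound cs d {Q} {kk} {σ′} xs q′ (Spent.ok s) sp
          (≤-trans (+-monoˡ-≤ (length cs * U) (Spent.clk s)) (≤-trans (≤-reflexive (+-assoc (clock σ) U _)) tm))
          λ q″ s′ → h q″ (spent-trans s s′)

    record Scanned {i} (τ : Tree i) (c : ℕ) (σ′ : Config) : Set where
      constructor scanned
      field
        {S′} : Stack
        {D}  : List Poly
        ran  : srun τ 0 [] ≡ just (S′ , D)
        van  : All Van D
        fin  : ∃[ t ] State S′ t 0 N [] (regs σ′) (stks σ′)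
        ok   : Ok σ′
        clk  : clock σ′ ≤ c + 9 * U + B k

    setup : Expr → Expr → List Cmd
    setup first last = (A.t ≔ lit 0) ∷ (A.H ≔ lit 0) ∷ (A.s ≔ lit 0) ∷ (A.m ≔ var A.N) ∷ (A.lo ≔ first) ∷
      (A.hi ≔ last) ∷ []

    blk : Cmd
    blk = A.block interp

    block-cmd-sound : (τ : Tree k) → Placed lo hi 0 τ → length (yield τ) ≤ n → ∀ {σ zs} → State [] 0 0 N []
      (regs σ) (stks σ) → Ok σ → input σ ≡ zs →
      map (λ z → step (g z)) zs ≡ yield τ → clock σ + U + B k ≤ TM →
      Sat (exec blk noSelf 0 σ) (Scanned τ (clock σ)) (Failed τ [] 0)
    block-cmd-sound τ pl len {σ} {zs} st ok inp zs≡ tm =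
      subst (λ i → Sat (recurse v i (exec stepCmd) (exec (A.readLetter interp) noSelf) v σ₁)
        (Scanned τ (clock σ)) (Failed τ [] 0)) (sym k≡)
        (sat-map
          (block-sound {noSelf} {v} v≤w τ {v} {σ₁} {0} {[]} {0} {[]} {zs} {[]}
            (subst (λ m → State [] 0 0 m [] (regs σ) (stks σ)) (sym N≡) st) (Spent.ok d) [] pl
              (≤-reflexive N≡) len ≤-refl ≤-refl
            (trans inp (sym (List.++-identityʳ zs))) zs≡
            (≤-trans (+-monoˡ-≤ _ (+-monoˡ-≤ Z (+-monoˡ-≤ (k * w) v≤w))) SM≥)
            (≤-trans (+-monoˡ-≤ (B k) (Spent.clk d)) tm))
          (λ {σ′} D → scanned (Done.ran D) (Done.van D) (0 + 2 ^ k , subst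
            (λ m → State (Done.S′ D) (2 ^ k) 0 m [] (regs σ′) (stks σ′)) N≡ (Done.final≡ D)) (Done.ok D)
            (clk (Done.clk D)))
          (λ f → f))
      where
      v : ℕ
      v = bits (eval (var A.k) σ)
      σ₁ : Config
      σ₁ = charge 0 (cost (var A.k) σ) σ
      k≡ : eval (var A.k) σ ≡ k
      k≡ = elim (λ r st → lookup r A.k ≡ k) st (λ _ → refl)
      v≤w : v ≤ w
      v≤w = bits-≤w (subst (_≤ V) (sym k≡) k≤V)
      sp : 0 + Z + W₀ * (w * w) ≤ SM
      sp = ≤-trans (+-monoˡ-≤ _ (+-monoˡ-≤ Z (z≤n {w + k * w}))) SM≥
      d : Spent U σ σ₁
      d = charged {0} {cost (var A.k) σ} {1} {σ} (cost-≤ (var A.k) {σ} (Ok.regsOk ok)) (small 1) ok sp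
        (≤-trans (m≤m+n _ (B k)) tm)
      clk : ∀ {c} → Clk τ (clock σ₁) c → c ≤ clock σ + 9 * U + B k
      clk (inj₁ (_ , c≤)) = ≤-trans c≤ (≤-trans
        (bump {clock σ} {2} (bump {clock σ} {1} (bump {clock σ} {0} (≤-reflexive (sym (+-identityʳ _)))
          (Spent.clk d)) ≤-refl) ≤-refl)
        (≤-trans (+-monoʳ-≤ (clock σ) (*-monoˡ-≤ U (≤ᵇ⇒≤ 3 9 tt))) (m≤m+n _ (B k))))
      clk (inj₂ c≤) = ≤-trans c≤ (m≤n+m (B k) (clock σ + 9 * U))

    scan-sound : ∀ first last → cmdWeight (A.lo ≔ first) ≤ W₀ → cmdWeight (A.hi ≔ last) ≤ W₀ →
      (∀ {junk st} → eval first (at (n ∷ p ∷ α ∷ k ∷ N ∷ junk) st) ≡ lo) →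
      (∀ {junk st} → eval last (at (n ∷ p ∷ α ∷ k ∷ N ∷ junk) st) ≡ hi) →
      (τ : Tree k) → Placed lo hi 0 τ → length (yield τ) ≤ n → ∀ {σ zs} → Ready n p α k N (regs σ) (stks σ) →
        Ok σ → input σ ≡ zs →
      map (λ z → step (g z)) zs ≡ yield τ → clock σ + 7 * U + B k ≤ TM →
      Sat (exec (A.scan first last interp) noSelf 0 σ) (Scanned τ (clock σ + 6 * U)) (Failed τ [] 0)
    scan-sound first last x₁ x₂ first≡ last≡ τ pl len {σ} {zs} rd ok inp zs≡ tm =
      prefix-sound (setup first last) blk {State [] 0 0 N []} {0} {σ}
        ((w₁ , z≤n) ∷ (w₁ , z≤n) ∷ (w₁ , z≤n) ∷ (w₁ , z≤n) ∷ (x₁ , z≤n) ∷ (x₂ , z≤n) ∷ [])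
        (wp₁ (regs σ) (stks σ) rd) ok sp
        (≤-trans (+-monoʳ-≤ (clock σ) (*-monoˡ-≤ U (≤ᵇ⇒≤ 6 7 tt))) (≤-trans (m≤m+n _ (B k)) tm))
        λ {σ′} st s → sat-map
          (block-cmd-sound τ pl len {σ′} {zs} st (Spent.ok s) (trans (Spent.input≡ s) inp) zs≡
            (≤-trans (+-monoˡ-≤ (B k) (bump {clock σ} {6} (Spent.clk s) ≤-refl)) tm))
          (λ y → scanned (Scanned.ran y) (Scanned.van y) (Scanned.fin y) (Scanned.ok y)
             (≤-trans (Scanned.clk y) (+-monoˡ-≤ (B k) (+-monoˡ-≤ (9 * U) (Spent.clk s)))))
          (λ f → f)
      where
      w₁ : 1 ≤ W₀
      w₁ = small 1
      N≤V : N ≤ V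
      N≤V = <⇒≤ (<⇒≤ N<V)
      sp : 0 + Z + W₀ * (w * w) ≤ SM
      sp = ≤-trans (+-monoˡ-≤ _ (+-monoˡ-≤ Z (z≤n {w + k * w}))) SM≥
      wp₁ : ∀ r st → Ready n p α k N r st → wps (setup first last) (State [] 0 0 N []) r st
      wp₁ _ _ (ready {_ ∷ _ ∷ _ ∷ _ ∷ _ ∷ _ ∷ junk}) =
        z≤n , z≤n , z≤n , N≤V ,
        subst (_≤ V) (sym first≡) (≤-trans (<⇒≤ lo<hi) (≤-trans hi≤N N≤V)) ,
        subst (_≤ V) (sym last≡) (≤-trans hi≤N N≤V) ,
        registers-set first≡ last≡
        where
        registers-set : ∀ {l h} → l ≡ lo → h ≡ hi → State [] 0 0 N []
          (n ∷ p ∷ α ∷ k ∷ N ∷ 0 ∷ 0 ∷ l ∷ h ∷ 0 ∷ N ∷ junk) ([] ∷ [] ∷ [])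
        registers-set refl refl = state []

    checkEmpty : Cmd
    checkEmpty = A.when nonEmpty A.S do′ reject

    check-sound : ∀ {i} {τ : Tree i} {c σ} (y : Scanned τ c σ) → clock σ + U ≤ TM →
      Sat (exec checkEmpty noSelf 0 σ) (Post (λ r st → Scanned.S′ y ≡ [] × Ready n p α k N r st) U σ)
        (λ σ′ → Scanned.S′ y ≢ [] × Within σ′)
    check-sound {σ = σ} y tm = go (proj₂ (Scanned.fin y))
      where
      Q : Pred
      Q r st = Scanned.S′ y ≡ [] × Ready n p α k N r st
      wp₁ : ∀ {S t r st} → Scanned.S′ y ≡ S → State S t 0 N [] r st → wp checkEmpty Q (Scanned.S′ y ≢ []) r st
      wp₁ eq (state [])          = (λ ()) , λ _ → eq , ready
      wp₁ eq (state (enc _ _ _)) = (λ _ → nonempty eq) , λ ()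
        where
        nonempty : ∀ {S T : Stack} {I} → S ≡ I ∷ T → S ≢ []
        nonempty refl ()
      go : ∀ {t} → State (Scanned.S′ y) t 0 N [] (regs σ) (stks σ) → Sat (exec checkEmpty noSelf 0 σ)
        (Post Q U σ) (λ σ′ → Scanned.S′ y ≢ [] × Within σ′)
      go st = fits-sound checkEmpty {Q} {Scanned.S′ y ≢ []} {noSelf} {0} {σ} (small (cmdWeight checkEmpty)) z≤n
        (wp₁ refl st) (Scanned.ok y) (≤-trans (+-monoˡ-≤ _ (+-monoˡ-≤ Z (z≤n {w + k * w}))) SM≥) tm

-- Both passes together

-- The stack `T₂` is arbitrary because the program tests for emptiness only after the first pass.
record Accepts (p α : ℕ) {k : ℕ} (τ : Tree k) : Set where
  constructor mkAccepts
  field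
    {D₁ D₂} : List Poly
    {T₂}    : Stack
    run₁    : srun τ 0 [] ≡ just ([] , D₁)
    van₁    : All (Vanishes p α) D₁
    run₂    : srun (mirror τ) 0 [] ≡ just (T₂ , D₂)
    van₂    : All (Vanishes p α) D₂

module WholeRun (V w L TM SM : ℕ) (w≡ : bits V ≡ w)
  (n p α : ℕ) .{{_ : NonZero p}} (p≥2 : 2 ≤ p) (α<p : α < p) (p≤V : p ≤ V)
  (W₀ : ℕ) (W₀≥ : 1000 ≤ W₀) (n>0 : 0 < n) (N<V : 2 + 2 ^ ⌈log₂ n ⌉ ≤ V) (3≤V : 3 ≤ V)
  (k≤w : ⌈log₂ n ⌉ ≤ w) (L≥ : (2 + ⌈log₂ n ⌉) * 3 ≤ L)
  (TM≥ : suc ⌈log₂ n ⌉ * (16 * (W₀ * w ^ 4)) + suc ⌈log₂ n ⌉ * (16 * (W₀ * w ^ 4)) +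
    (16 * (W₀ * w ^ 4) + 16 * (W₀ * w ^ 4)) ≤ TM)
  (SM≥ : w + ⌈log₂ n ⌉ * w + Limits.Z V w L TM SM w≡ + W₀ * (w * w) ≤ SM)
  where
  open Limits V w L TM SM w≡
  open Blocks V w L TM SM w≡

  k N U E B : ℕ
  k = ⌈log₂ n ⌉
  N = 2 ^ k
  U = W₀ * w ^ 4
  E = 16 * U
  B = suc k * E

  n≤N : n ≤ N
  n≤N = n≤2^⌈log₂n⌉ n

  N≤V : N ≤ V
  N≤V = <⇒≤ (<⇒≤ N<V)

  k≤V : k ≤ V
  k≤V = ≤-trans (<⇒≤ (n<2^n k)) N≤V

  double-loop : ∀ i {Q R k′ M j st} → 2 ^ i * M ≤ V → Q (n ∷ p ∷ α ∷ k′ ∷ 2 ^ i * M ∷ j) st →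
                iter i (λ P → wp (A.N ≔ lit 2 :* var A.N) P R) Q (n ∷ p ∷ α ∷ k′ ∷ M ∷ j) st
  double-loop zero {Q} {k′ = k′} {M} {j} {st} le q = subst (λ M → Q (n ∷ p ∷ α ∷ k′ ∷ M ∷ j) st) (*-identityˡ M) q
  double-loop (suc i) {Q} {R} {k′} {M} {j} {st} le q =
    ≤-trans (ℕ.m≤n*m (2 * M) (2 ^ i) {{>-nonZero (ℕ.m^n>0 2 i)}}) le′ ,
    double-loop i {Q} {R} le′ (subst (λ M → Q (n ∷ p ∷ α ∷ k′ ∷ M ∷ j) st) eq q)
    where
    eq : 2 ^ suc i * M ≡ 2 ^ i * (2 * M)
    eq = trans (cong (_* M) (ℕ.*-comm 2 (2 ^ i))) (ℕ.*-assoc (2 ^ i) 2 M)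
    le′ : 2 ^ i * (2 * M) ≤ V
    le′ = subst (_≤ V) eq le

  initialise-wp : ∀ {Q R r₃ r₄ j st} → (n % 2 ≡ 1 → R) → (n % 2 ≢ 1 → Q (n ∷ p ∷ α ∷ k ∷ N ∷ j) st) →
                  wp A.initialise Q R (n ∷ p ∷ α ∷ r₃ ∷ r₄ ∷ j) st
  initialise-wp {Q} {R} {j = j} {st} odd even =
    (λ t → odd (≡ᵇ-true t)) ,
    (λ t → k≤V , ≤-trans (s≤s z≤n) 3≤V , k≤w ,
           double-loop k {Q} {R} (subst (_≤ V) (sym (*-identityʳ N)) N≤V)
             (subst (λ M → Q (n ∷ p ∷ α ∷ k ∷ M ∷ j) st) (sym (*-identityʳ N)) (even (≡ᵇ-false t))))

  regs₀ : Vec ℕ 21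
  regs₀ = n ∷ p ∷ α ∷ Vec.replicate 18 0

  stks₀ : Vec (List ℕ) 2
  stks₀ = Vec.replicate 2 []

  σ₀ : List Letter → Config
  σ₀ x = config regs₀ stks₀ x 0 0 0

  ok₀ : ∀ x → Ok (σ₀ x)
  ok₀ x = record { regsOk = regs≤ ; stksOk = λ { zero → [] , z≤n ; (suc zero) → [] , z≤n } ; timeOk = z≤n ;
    spaceOk = z≤n }
    where
    regs≤ : ∀ y → lookup regs₀ y ≤ V
    regs≤ zero                = ≤-trans n≤N N≤V
    regs≤ (suc zero)          = p≤V
    regs≤ (suc (suc zero))    = ≤-trans (<⇒≤ α<p) p≤V
    regs≤ (suc (suc (suc y))) = subst (_≤ V) (sym (Vec.lookup-replicate y 0)) z≤n
      where import Data.Vec.Properties as Vec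

  skip-wp : Hash.Interprets n p α k N 0 n p≥2 α<p p≤V skip (λ z → z)
  skip-wp R Q t H s m st z junk q = q

  swap-wp : Hash.Interprets n p α k N (N ∸ n) N p≥2 α<p p≤V A.swapLetter swap
  swap-wp R Q t H s m st a junk q = (λ _ → ≤-trans (s≤s z≤n) 3≤V , q) , λ ()
  swap-wp R Q t H s m st ā junk q = (λ ()) , λ _ → (λ _ → z≤n , q) , λ ()
  swap-wp R Q t H s m st b junk q = (λ ()) , λ _ → (λ ()) , λ _ → (λ _ → 3≤V , q) , λ ()
  swap-wp R Q t H s m st b̄ junk q = (λ ()) , λ _ → (λ ()) , λ _ → (λ ()) , λ _ → ≤-trans (s≤s (s≤s z≤n)) 3≤V , q

  U≤E : ∀ j → T (j ≤ᵇ 16) → j * U ≤ E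
  U≤E j j≤ = *-monoˡ-≤ U (≤ᵇ⇒≤ j 16 j≤)

  TM₁ : B + B + E ≤ TM
  TM₁ = ≤-trans (+-monoʳ-≤ (B + B) (m≤m+n E E)) TM≥

  TM₂ : ∀ {x y} → x ≤ B + E → y ≤ B + E → x + y ≤ TM
  TM₂ x≤ y≤ = ≤-trans (+-mono-≤ x≤ y≤) (≤-trans (≤-reflexive (rot B E)) TM≥)
    where
    rot : ∀ a b → a + b + (a + b) ≡ a + a + (b + b)
    rot = solve-∀

  initTime : cmdTime A.initialise ≤ U
  initTime = *-mono-≤ (≤-trans (≤ᵇ⇒≤ (cmdWeight A.initialise) 1000 tt) W₀≥) (w^-mono {3} {4} (≤ᵇ⇒≤ 3 4 tt))

  initSpace : 0 + Z + cmdWeight A.initialise * (w * w) ≤ SM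
  initSpace = ≤-trans (+-mono-≤ (+-monoˡ-≤ Z (z≤n {w + k * w}))
    (*-monoˡ-≤ (w * w) (≤-trans (≤ᵇ⇒≤ (cmdWeight A.initialise) 1000 tt) W₀≥))) SM≥

  U≤TM : U ≤ TM
  U≤TM = ≤-trans (m≤m+n U _) (≤-trans (m≤n+m E (B + B)) TM₁)

  odd-sound : n % 2 ≡ 1 → ∀ x → Sat (runMachine A.algorithm₃ regs₀ x) (λ _ → ⊥) Within
  odd-sound odd x =
    sat-bind {P = λ _ → ⊥} {P′ = λ _ → ⊥} {R = Within}
      (sat-bind {P′ = λ _ → ⊥}
        (wp-sound A.initialise {λ _ _ → ⊥} {⊤} {noSelf} {0} {σ₀ x}
          (initialise-wp {λ _ _ → ⊥} {⊤} {0} {0} {Vec.replicate 16 0} {stks₀} (λ _ → tt) (λ even → even odd))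
          (ok₀ x) initSpace (≤-trans initTime U≤TM))
        (λ (f , _) → ⊥-elim f) proj₂)
      (λ ()) (λ wt → wt)

  lo<hi : N ∸ n < N
  lo<hi = ℕ.∸-monoʳ-< {N} {n} {0} n>0 n≤N

  module S₁ = Scan.Passes V w L TM SM w≡ n p α k N 0 n p≥2 α<p p≤V skip (λ z → z) W₀ W₀≥
    skip-wp z≤n refl n≤N N<V 3≤V n>0 L≥ TM₁ refl k≤V n≤N SM≥
  module S₂ = Scan.Passes V w L TM SM w≡ n p α k N (N ∸ n) N p≥2 α<p p≤V A.swapLetter swap W₀ W₀≥
    swap-wp (≤ᵇ⇒≤ (cmdWeight A.swapLetter) 100 tt) refl n≤N N<V 3≤V lo<hi L≥ TM₁ refl k≤V ≤-refl SM≥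

  record Mid (τ : Tree k) (σ : Config) : Set where
    constructor mid
    field
      {D₁}   : List Poly
      run₁   : srun τ 0 [] ≡ just ([] , D₁)
      van₁   : All (Vanishes p α) D₁
      again  : Ready n p α k N (regs σ) (stks σ)
      ok     : Ok σ
      clk    : clock σ ≤ B + E + U

  -- Both outcomes are characterized: that acceptance gives `Accepts` serves the error bound, and
  -- that rejection refutes it gives acceptance with probability 1 on well-parenthesized words.
  even-sound : n % 2 ≢ 1 → ∀ x (τ : Tree k) → Placed 0 n 0 τ → Placed (N ∸ n) N 0 (mirror τ) → map step x ≡ yield τ →
    map (λ z → step (swap z)) (reverse x) ≡ yield (mirror τ) → length x ≡ n →
    Sat (runMachine A.algorithm₃ regs₀ x) (λ σ → Accepts p α τ × Within σ) (λ σ → ¬ Accepts p α τ × Within σ)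
  even-sound even x τ pl pl′ y≡ y≡′ len =
    sat-bind {P = Mid τ} {R = λ σ → ¬ Accepts p α τ × Within σ}
      (sat-bind
        (wp-sound A.initialise {Ready n p α k N} {⊥} {noSelf} {0} {σ₀ x}
          (initialise-wp {Ready n p α k N} {⊥} {0} {0} {Vec.replicate 16 0} {stks₀}
            (λ odd → ⊥-elim (even odd)) (λ _ → ready)) (ok₀ x) initSpace (≤-trans initTime U≤TM))
        (λ {σ} (rd , sp) → pass₁ {σ} rd (Spent.ok sp) (Spent.input≡ sp) (≤-trans (Spent.clk sp) initTime))
        (λ (f , _) → ⊥-elim f))
      (λ {σ} m → pass₂ {σ} m)
      (λ r → r)
    where
    yield-length : length (yield τ) ≤ n
    yield-length = ≤-reflexive (trans (cong length (sym y≡)) (trans (List.length-map step x) len))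
    yield-length′ : length (yield (mirror τ)) ≤ n
    yield-length′ = ≤-reflexive (trans (cong length (sym y≡′))
      (trans (List.length-map _ (reverse x)) (trans (List.length-reverse x) len)))

    pass₁ : ∀ {σ} → Ready n p α k N (regs σ) (stks σ) → Ok σ → input σ ≡ x → clock σ ≤ U →
            Sat (exec (A.scan (lit 0) (var A.n) skip ⨾ (A.when nonEmpty A.S do′ reject)) noSelf 0 σ) (Mid τ)
              (λ σ → ¬ Accepts p α τ × Within σ)
    pass₁ {σ} rd ok inp c≤ =
      sat-bind
        (S₁.scan-sound (lit 0) (var A.n) (≤-trans (≤ᵇ⇒≤ 1 1000 tt) W₀≥) (≤-trans (≤ᵇ⇒≤ 1 1000 tt) W₀≥) refl
          refl τ pl yield-length {σ} {x} rd ok inp y≡ tm₁)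
        (λ {σ₁} y → sat-map (S₁.check-sound y (tm₂ (c₁ (S₁.Scanned.clk y))))
          (λ { {σ₂} ((eq , rd′) , d) → mid (trans (S₁.Scanned.ran y) (cong (λ S → just (S , _)) eq))
            (S₁.Scanned.van y) rd′ (Spent.ok d)
                 (≤-trans (Spent.clk d) (+-monoˡ-≤ U (c₁ (S₁.Scanned.clk y)))) })
          (λ (ne , wt) → (λ acc → ne (same-stack (S₁.Scanned.ran y) (Accepts.run₁ acc))) , wt))
        (λ (fl , wt) → (λ acc → fl (Accepts.run₁ acc) (Accepts.van₁ acc)) , wt)
      where
      same-stack : ∀ {R S D T E} → R ≡ just (S , D) → R ≡ just (T , E) → S ≡ T
      same-stack refl refl = refl
      tm₁ : clock σ + 7 * U + B ≤ TM
      tm₁ = ≤-trans (+-monoˡ-≤ B (≤-trans (+-monoˡ-≤ (7 * U) c≤) (U≤E 8 tt)))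
        (≤-trans (≤-reflexive (+-comm E B)) (≤-trans (+-monoˡ-≤ E (m≤m+n B B)) TM₁))
      c₁ : ∀ {c} → c ≤ clock σ + 6 * U + 9 * U + B → c ≤ B + E
      c₁ c′ = ≤-trans c′ (≤-trans (+-monoˡ-≤ B (≤-trans (+-monoˡ-≤ (9 * U) (+-monoˡ-≤ (6 * U) c≤))
        (≤-reflexive (add U)))) (≤-reflexive (+-comm E B)))
        where
        -- One unit for `initialise`, 6 for the assignments of `setup`, and 9 from the bound in
        -- `Scanned`.
        add : ∀ u → u + 6 * u + 9 * u ≡ 16 * u
        add = solve-∀
      tm₂ : ∀ {c} → c ≤ B + E → c + U ≤ TM
      tm₂ c′ = TM₂ c′ (≤-trans (m≤m+n U _) (m≤n+m E B))

    pass₂ : ∀ {σ} → Mid τ σ → Sat (runPasses ((←ᵈ , A.scan (var A.N :- var A.n) (var A.N) A.swapLetter) ∷ [])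
      x σ) (λ σ → Accepts p α τ × Within σ) (λ σ → ¬ Accepts p α τ × Within σ)
    pass₂ {σ} m =
      sat-bind
        (S₂.scan-sound (var A.N :- var A.n) (var A.N) (≤-trans
          (≤ᵇ⇒≤ (cmdWeight (A.lo ≔ var A.N :- var A.n)) 1000 tt) W₀≥) (≤-trans (≤ᵇ⇒≤ 1 1000 tt) W₀≥)
          refl refl (mirror τ) pl′ yield-length′ {record σ { input = reverse x }} {reverse x} (Mid.again m)
          (record { regsOk = Ok.regsOk (Mid.ok m) ; stksOk = Ok.stksOk (Mid.ok m) ; timeOk = Ok.timeOk
            (Mid.ok m) ; spaceOk = Ok.spaceOk (Mid.ok m) }) refl y≡′ tm₁)
        (λ y → runs (mkAccepts (Mid.run₁ m) (Mid.van₁ m) (S₂.Scanned.ran y) (S₂.Scanned.van y) , Ok.timeOk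
          (S₂.Scanned.ok y) , Ok.spaceOk (S₂.Scanned.ok y)))
        (λ (fl , wt) → (λ acc → fl (Accepts.run₂ acc) (Accepts.van₂ acc)) , wt)
      where
      tm₁ : clock σ + 7 * U + B ≤ TM
      tm₁ = ≤-trans (+-monoˡ-≤ B (+-monoˡ-≤ (7 * U) (Mid.clk m)))
        (≤-trans (≤-reflexive (rot B E U)) (TM₂ (≤-refl {B + E}) (+-monoʳ-≤ B (U≤E 8 tt))))
        where
        rot : ∀ b e u → b + e + u + 7 * u + b ≡ b + e + (b + 8 * u)
        rot = solve-∀

-- Probabilities

ι : ℕ → ℚ
ι m = + m ℚ./ 1

toℚᵘ-/ : ∀ m d → toℚᵘ (+ m ℚ./ suc d) ℚᵘ.≃ mkℚᵘ (+ m) d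
toℚᵘ-/ m d = ℚ.toℚᵘ-fromℚᵘ (mkℚᵘ (+ m) d)

/-ι : ∀ m p .{{_ : NonZero p}} → (+ m ℚ./ p) ℚ.* ι p ≡ ι m
/-ι m (suc d) = ℚ.toℚᵘ-injective (ℚᵘ.≃-trans (ℚ.toℚᵘ-homo-* (+ m ℚ./ suc d) (ι (suc d)))
  (ℚᵘ.≃-trans (ℚᵘ.*-cong (toℚᵘ-/ m d) (toℚᵘ-/ (suc d) 0)) (ℚᵘ.≃-trans (*≡* eq) (ℚᵘ.≃-sym (toℚᵘ-/ m 0)))))
  where
  eq : (+ m ℤ.* + suc d) ℤ.* 1ℤ ≡ + m ℤ.* + (suc d * 1)
  eq = trans (ℤ.*-identityʳ _) (cong (λ z → + m ℤ.* + z) (sym (*-identityʳ (suc d))))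

ι-* : ∀ m n → ι (m * n) ≡ ι m ℚ.* ι n
ι-* m n = ℚ.toℚᵘ-injective (ℚᵘ.≃-trans (toℚᵘ-/ (m * n) 0) (ℚᵘ.≃-trans (*≡* (cong (ℤ._* 1ℤ) (ℤ.pos-* m n)))
  (ℚᵘ.≃-sym (ℚᵘ.≃-trans (ℚ.toℚᵘ-homo-* (ι m) (ι n)) (ℚᵘ.*-cong (toℚᵘ-/ m 0) (toℚᵘ-/ n 0))))))

ι-mono : ∀ {m n} → m ≤ n → ι m ℚ.≤ ι n
ι-mono {m} {n} m≤n = ℚ.toℚᵘ-cancel-≤ (ℚᵘ.≤-respˡ-≃ (ℚᵘ.≃-sym (toℚᵘ-/ m 0)) (ℚᵘ.≤-respʳ-≃ (ℚᵘ.≃-sym (toℚᵘ-/ n 0))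
  (*≤* (ℤ.*-monoʳ-≤-nonNeg 1ℤ (ℤ.+≤+ m≤n)))))

ι-pos : ∀ m → 0 < m → ℚ.Positive (ι m)
ι-pos (suc m) _ = ℚ.normalize-pos (suc m) 1

/-+ : ∀ l m p .{{_ : NonZero p}} → (+ l ℚ./ p) ℚ.+ (+ m ℚ./ p) ≡ + (l + m) ℚ./ p
/-+ l m (suc d) = ℚ.toℚᵘ-injective (ℚᵘ.≃-trans (ℚ.toℚᵘ-homo-+ (+ l ℚ./ suc d) (+ m ℚ./ suc d))
  (ℚᵘ.≃-trans (ℚᵘ.+-cong (toℚᵘ-/ l d) (toℚᵘ-/ m d)) (ℚᵘ.≃-trans (*≡* eq) (ℚᵘ.≃-sym (toℚᵘ-/ (l + m) d)))))
  where
  eq : (+ l ℤ.* + suc d ℤ.+ + m ℤ.* + suc d) ℤ.* + suc d ≡ + (l + m) ℤ.* + (suc d * suc d)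
  eq = trans (cong (ℤ._* + suc d) (trans (sym (ℤ.*-distribʳ-+ (+ suc d) (+ l) (+ m)))
    (cong (ℤ._* + suc d) (sym (ℤ.pos-+ l m)))))
    (trans (ℤ.*-assoc (+ (l + m)) (+ suc d) (+ suc d)) (cong (λ z → + (l + m) ℤ.* z) (sym (ℤ.pos-* (suc d) (suc d)))))

n/n≡1 : ∀ p .{{_ : NonZero p}} → + p ℚ./ p ≡ 1ℚ
n/n≡1 (suc d) = ℚ.toℚᵘ-injective (ℚᵘ.≃-trans (toℚᵘ-/ (suc d) d) (*≡* (ℤ.*-comm (+ suc d) 1ℤ)))

^-ι : ∀ m p .{{_ : NonZero p}} v → ((+ m ℚ./ p) ℚ^.^ v) ℚ.* ι (p ^ v) ≡ ι (m ^ v)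
^-ι m p zero    = refl
^-ι m p (suc v) = begin
  (q ℚ.* Q) ℚ.* ι (p * p ^ v)  ≡⟨ cong ((q ℚ.* Q) ℚ.*_) (ι-* p (p ^ v)) ⟩
  (q ℚ.* Q) ℚ.* (ι p ℚ.* ι (p ^ v))  ≡⟨ interchange q Q (ι p) (ι (p ^ v)) ⟩
  (q ℚ.* ι p) ℚ.* (Q ℚ.* ι (p ^ v))  ≡⟨ cong₂ ℚ._*_ (/-ι m p) (^-ι m p v) ⟩
  ι m ℚ.* ι (m ^ v)  ≡⟨ ι-* m (m ^ v) ⟨
  ι (m * m ^ v)  ∎
  where
  open ≡-Reasoning
  q = + m ℚ./ p
  Q = q ℚ^.^ v

-- Multiplying by p^v clears the denominator and leaves m^v n^u ≤ n^(v+u) ≤ p^v, where the last step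
-- is the lower bound on p for the same fraction u/v.
fraction-bound : ∀ m n p c .{{_ : NonZero p}} → m ≤ n → n ^[1+ c ]≤ p → (+ m ℚ./ p) ≤ n ^- c
fraction-bound m n p c m≤n n≤p u v u/v<c = ℚ.*-cancelʳ-≤-pos (ι (p ^ v)) {{ι-pos (p ^ v) (ℕ.m^n>0 p v)}} (begin
  Q ℚ.* ι (n ^ u) ℚ.* ι (p ^ v)  ≡⟨ ℚ.*-assoc Q _ _ ⟩
  Q ℚ.* (ι (n ^ u) ℚ.* ι (p ^ v))  ≡⟨ cong (Q ℚ.*_) (ℚ.*-comm (ι (n ^ u)) _) ⟩
  Q ℚ.* (ι (p ^ v) ℚ.* ι (n ^ u))  ≡⟨ ℚ.*-assoc Q _ _ ⟨
  Q ℚ.* ι (p ^ v) ℚ.* ι (n ^ u)  ≡⟨ cong (ℚ._* ι (n ^ u)) (^-ι m p v) ⟩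
  ι (m ^ v) ℚ.* ι (n ^ u)  ≡⟨ ι-* (m ^ v) (n ^ u) ⟨
  ι (m ^ v * n ^ u)  ≤⟨ ι-mono (≤-trans (*-monoˡ-≤ (n ^ u) (ℕ.^-monoˡ-≤ v m≤n))
    (≤-trans (≤-reflexive (sym (ℕ.^-distribˡ-+-* n v u))) (n≤p u v u/v<c))) ⟩
  ι (p ^ v)  ≡⟨ ℚ.*-identityˡ _ ⟨
  1ℚ ℚ.* ι (p ^ v)  ∎)
  where
  open ℚ.≤-Reasoning
  Q = (+ m ℚ./ p) ℚ^.^ v

length-filter-not : ∀ (e : ℕ → Bool) xs → length (filterᵇ e xs) + length (filterᵇ (λ x → not (e x)) xs) ≡ length xs
length-filter-not e []       = refl
length-filter-not e (x ∷ xs) with e x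
... | true  = cong suc (length-filter-not e xs)
... | false = trans (ℕ.+-suc _ _) (cong suc (length-filter-not e xs))

complement : ∀ p .{{_ : NonZero p}} e → 1ℚ ℚ.- Pr p (λ x → not (e x)) ≡ + length (filterᵇ e (upTo p)) ℚ./ p
complement p e = begin
  1ℚ ℚ.- R  ≡⟨ cong (ℚ._- R) (trans (sym (n/n≡1 p)) (trans (cong (λ z → + z ℚ./ p) (sym total))
    (sym (/-+ (length (filterᵇ e (upTo p))) _ p)))) ⟩
  X ℚ.+ R ℚ.- R  ≡⟨ ℚ.+-assoc X R (ℚ.- R) ⟩
  X ℚ.+ (R ℚ.- R)  ≡⟨ cong (X ℚ.+_) (ℚ.+-inverseʳ R) ⟩
  X ℚ.+ ℚ.0ℚ  ≡⟨ ℚ.+-identityʳ X ⟩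
  X  ∎
  where
  open ≡-Reasoning
  X R : ℚ
  X = + length (filterᵇ e (upTo p)) ℚ./ p
  R = Pr p (λ x → not (e x))
  total : length (filterᵇ e (upTo p)) + length (filterᵇ (λ x → not (e x)) (upTo p)) ≡ p
  total = trans (length-filter-not e (upTo p)) (List.length-upTo p)

certain : ∀ p .{{_ : NonZero p}} e → (∀ {α} → α < p → e α ≡ true) → Pr p e ≡ 1ℚ
certain p e h = trans (cong (λ xs → + length xs ℚ./ p) (List.filter-all (T? ∘ e)
  (All.map (λ α<p → subst T (sym (h α<p)) _) (All.all-upTo p))))
  (trans (cong (λ z → + z ℚ./ p) (List.length-upTo p)) (n/n≡1 p))

accepting : ∀ p e → Unique (filterᵇ e (upTo p)) × All (λ α → α < p × e α ≡ true) (filterᵇ e (upTo p))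
accepting p e = Unique.filter⁺ (T? ∘ e) (Unique.upTo⁺ p) ,
  All.zip (All.filter⁺ (T? ∘ e) (All.all-upTo p) , All.map (λ {α} t → T⇒≡ (e α) t) (All.all-filter (T? ∘ e) (upTo p)))
  where
  T⇒≡ : ∀ x → T x → x ≡ true
  T⇒≡ true _ = refl

-- Any rational q above c provides C: its denominator is at least 1, so q is at most the absolute
-- value of its numerator. A fraction below c but above this integer would put q into the lower cut
-- too, against `disjoint`.
ceiling : (c : ℝ) → ∃[ C ] (∀ u v → u / suc v <ᴿ c → u ≤ C * suc v)
ceiling c with ℝ.upper-inhabited c
... | q@(ℚ.mkℚ num d _) , above-c = ℤ.∣ num ∣ , λ u v low → ℕ.≮⇒≥ λ C<u → ℝ.disjoint c q
  (Equivalence.from (ℝ.lower-rounded c q) (+ u ℚ./ suc v , below u v C<u , low) , above-c)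
  where
  below : ∀ u v → ℤ.∣ num ∣ * suc v < u → q ℚ.< + u ℚ./ suc v
  below u v C<u = ℚ.toℚᵘ-cancel-< (ℚᵘ.<-respʳ-≃ (ℚᵘ.≃-sym (toℚᵘ-/ u v)) (*<* (begin-strict
    num ℤ.* + suc v  ≤⟨ ℤ.*-monoʳ-≤-nonNeg (+ suc v) num≤ ⟩
    + ℤ.∣ num ∣ ℤ.* + suc v  ≡⟨ ℤ.pos-* ℤ.∣ num ∣ (suc v) ⟨
    + (ℤ.∣ num ∣ * suc v)             <⟨ ℤ.+<+ C<u ⟩
    + u  ≤⟨ ℤ.+≤+ (ℕ.m≤m*n u (suc d)) ⟩
    + (u * suc d)  ≡⟨ ℤ.pos-* u (suc d) ⟩
    + u ℤ.* + suc d  ∎)))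
    where
    open ℤ.≤-Reasoning
    num≤ : num ℤ.≤ + ℤ.∣ num ∣
    num≤ = abs≤ num
      where
      abs≤ : ∀ z → z ℤ.≤ + ℤ.∣ z ∣
      abs≤ (+ z)      = ℤ.≤-refl
      abs≤ ℤ.-[1+ z ] = ℤ.-≤+

-- Asymptotic bounds and correctness

satisfied : ∀ {o A R} → Sat o A R → isRunning o ≡ true → A (final o)
satisfied (runs x) refl = x

never-rejecting : ∀ {o A R} → Sat o A R → (∀ {σ} → ¬ R σ) → isRunning o ≡ true
never-rejecting (runs x)  h = refl
never-rejecting (halts r) h = ⊥-elim (h r)

both : ∀ {o A R} {X : Config → Set} → Sat o A R → (∀ {σ} → A σ → X σ) → (∀ {σ} → R σ → X σ) → X (final o)
both (runs x)  f g = f x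
both (halts r) f g = g r

dyck-even : ∀ {x} → Dyck₂ x → Even (length x)
dyck-even ε = 0 , refl
dyck-even (aLāL {u} {v} p q) with dyck-even p | dyck-even q
... | i , i≡ | j , j≡ = suc (i + j) , cong suc (trans (List.length-++ u)
  (trans (ℕ.+-suc (length u) _) (cong suc (trans (cong₂ _+_ i≡ j≡) (sym (ℕ.*-distribʳ-+ 2 i j))))))
dyck-even (bLb̄L {u} {v} p q) with dyck-even p | dyck-even q
... | i , i≡ | j , j≡ = suc (i + j) , cong suc (trans (List.length-++ u)
  (trans (ℕ.+-suc (length u) _) (cong suc (trans (cong₂ _+_ i≡ j≡) (sym (ℕ.*-distribʳ-+ 2 i j))))))

-- A natural exponent replaces the real one, so that p has O(log n) bits. The upper bound on p also
-- excludes n = 0, where its right-hand side is 0.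
prime-bound : ∀ {n p c C} → (∀ u v → u / suc v <ᴿ c → u ≤ C * suc v) → p <2* n ^[1+ c ] → 0 < n × p < 2 * n ^ suc C
prime-bound {zero} {p} ceil (u , v , u/v<c , lt) = ⊥-elim (ℕ.n≮0 (subst (p ^ suc v <_) (ℕ.*-zeroʳ (2 ^ suc v)) lt))
prime-bound {n@(suc _)} {p} {C = C} ceil (u , v , u/v<c , lt) = s≤s z≤n , ℕ.≰⇒> λ le → ℕ.<⇒≱ lt (begin
  2 ^ suc v * n ^ (suc v + u)  ≤⟨ *-monoʳ-≤ (2 ^ suc v) (ℕ.^-monoʳ-≤ n (+-monoʳ-≤ (suc v) (ceil u v u/v<c))) ⟩
  2 ^ suc v * n ^ (suc C * suc v)  ≡⟨ cong (λ z → 2 ^ suc v * z) (ℕ.^-*-assoc n (suc C) (suc v)) ⟨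
  2 ^ suc v * (n ^ suc C) ^ suc v  ≡⟨ ^-distrib-* 2 (n ^ suc C) (suc v) ⟨
  (2 * n ^ suc C) ^ suc v  ≤⟨ ℕ.^-monoˡ-≤ (suc v) le ⟩
  p ^ suc v  ∎)
  where
  open ℕ.≤-Reasoning
  ^-distrib-* : ∀ x y j → (x * y) ^ j ≡ x ^ j * y ^ j
  ^-distrib-* x y zero    = refl
  ^-distrib-* x y (suc j) = trans (cong (λ z → x * y * z) (^-distrib-* x y j)) (mix x y (x ^ j) (y ^ j))
    where
    mix : ∀ a b c d → a * b * (c * d) ≡ a * c * (b * d)
    mix = solve-∀

fits-length : ∀ {n} → 0 < n → Even n → Fits ⌈log₂ n ⌉ n
fits-length {n} n>0 ev with ⌈log₂ n ⌉ | n≤2^⌈log₂n⌉ n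
... | suc i | le = ev , le
fits-length {suc zero}    n>0 (zero , ())  | zero | le
fits-length {suc zero}    n>0 (suc j , ()) | zero | le
fits-length {suc (suc n)} n>0 ev           | zero | s≤s ()

%2-even : ∀ {n} → n % 2 ≢ 1 → Even n
%2-even {n} ne = n / 2 , trans (ℕ.m≡m%n+[m/n]*n n 2) (cong (_+ n / 2 * 2) (residue-0 (n % 2) (ℕ.m%n<n n 2) ne))
  where
  residue-0 : ∀ m → m < 2 → m ≢ 1 → m ≡ 0
  residue-0 zero          _              _  = refl
  residue-0 (suc zero)    _              ne = ⊥-elim (ne refl)
  residue-0 (suc (suc m)) (s≤s (s≤s ())) _

-- V exceeds the padded length and every p < 2n^(1+C).
module Bounds (W₀ C n : ℕ) where
  ℓ k e V w L TM SM : ℕ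
  ℓ = ⌊log₂ n ⌋
  k = ⌈log₂ n ⌉
  -- As n < 2^(ℓ+1), the bound 2n^(C+1) is at most 2 to the power 1 + (ℓ+1)(C+1); one further bit is
  -- spare.
  e = 2 + suc ℓ * suc C
  V = 2 ^ e
  w = suc e
  L = (2 + k) * 3
  TM = suc k * (16 * (W₀ * w ^ 4)) + suc k * (16 * (W₀ * w ^ 4)) + (16 * (W₀ * w ^ 4) + 16 * (W₀ * w ^ 4))
  SM = w + k * w + (21 * w + 2 * (L * w)) + W₀ * (w * w)

  w≡ : bits V ≡ w
  w≡ = cong suc (⌊log₂[2^n]⌋≡n e)

  k≤ : k ≤ suc ℓ
  k≤ = ⌈log₂n⌉≤bits n

  k≤w : k ≤ w
  k≤w = ≤-trans k≤ (≤-trans (ℕ.m≤m*n (suc ℓ) (suc C)) (m≤n+m _ 3))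

  p≤V : ∀ {p} → p < 2 * n ^ suc C → p ≤ V
  p≤V {p} p< = ≤-trans (<⇒≤ p<) (begin
    2 * n ^ suc C  ≤⟨ *-monoʳ-≤ 2 (ℕ.^-monoˡ-≤ (suc C) (<⇒≤ (n<2^bits n))) ⟩
    2 * (2 ^ suc ℓ) ^ suc C  ≡⟨ cong (2 *_) (ℕ.^-*-assoc 2 (suc ℓ) (suc C)) ⟩
    2 ^ suc (suc ℓ * suc C)  ≤⟨ ℕ.^-monoʳ-≤ 2 {suc (suc ℓ * suc C)} {e} (n≤1+n _) ⟩
    V  ∎)
    where open ℕ.≤-Reasoning

  4≤V : 4 ≤ V
  4≤V = ℕ.^-monoʳ-≤ 2 {2} {e} (s≤s (s≤s z≤n))

  N<V : 2 + 2 ^ k ≤ V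
  N<V = begin
    2 + 2 ^ k  ≤⟨ +-mono-≤ (ℕ.^-monoʳ-≤ 2 {1} {suc ℓ} (s≤s z≤n)) (ℕ.^-monoʳ-≤ 2 {k} {suc ℓ} k≤) ⟩
    2 ^ suc ℓ + 2 ^ suc ℓ  ≡⟨ cong (λ z → 2 ^ suc ℓ + z) (+-identityʳ _) ⟨
    2 ^ suc (suc ℓ)  ≤⟨ ℕ.^-monoʳ-≤ 2 {suc (suc ℓ)} {e} (≤-trans (s≤s (ℕ.m≤m*n (suc ℓ) (suc C))) (n≤1+n _)) ⟩
    V  ∎
    where open ℕ.≤-Reasoning

  TM≥ : suc k * (16 * (W₀ * w ^ 4)) + suc k * (16 * (W₀ * w ^ 4)) + (16 * (W₀ * w ^ 4) + 16 * (W₀ * w ^ 4)) ≤ TM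
  TM≥ = ≤-refl

  SM≥ : w + k * w + (21 * w + 2 * (L * w)) + W₀ * (w * w) ≤ SM
  SM≥ = ≤-refl

  module _ (n≥2 : 2 ≤ n) where

    D : ℕ
    D = 3 + 2 * suc C

    ℓ≥1 : 1 ≤ ℓ
    ℓ≥1 = ⌊log₂⌋-mono-≤ {2} {n} n≥2

    1+ℓ≤2ℓ : suc ℓ ≤ 2 * ℓ
    1+ℓ≤2ℓ = +-mono-≤ ℓ≥1 (m≤m+n ℓ 0)

    k≤2ℓ : k ≤ 2 * ℓ
    k≤2ℓ = ≤-trans k≤ 1+ℓ≤2ℓ

    w≤Dℓ : w ≤ D * ℓ
    w≤Dℓ = ≤-trans (+-mono-≤ (*-monoʳ-≤ 3 ℓ≥1) (*-monoˡ-≤ (suc C) 1+ℓ≤2ℓ)) (≤-reflexive (collect ℓ (suc C)))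
      where
      collect : ∀ l c → 3 * l + 2 * l * c ≡ (3 + 2 * c) * l
      collect = solve-∀

    L≤ : L ≤ 12 * ℓ
    L≤ = ≤-trans (*-monoˡ-≤ 3 (+-mono-≤ (*-monoʳ-≤ 2 ℓ≥1) k≤2ℓ)) (≤-reflexive (collect ℓ))
      where
      collect : ∀ l → (2 * l + 2 * l) * 3 ≡ 12 * l
      collect = solve-∀

    -- For n ≥ 2 the logarithm ℓ is at least 1 and absorbs additive constants. The quadratic terms
    -- are the k nested calls and the L entries of each stack, of w bits each, and the intermediate
    -- values of one step. The 48 is 1 + 2 + 21 + 24.
    space-bound : SM ≤ (48 * D + W₀ * (D * D)) * ℓ ^ 2
    space-bound = ≤-trans
      (+-mono-≤ (+-mono-≤ (+-mono-≤ w≤ (*-mono-≤ k≤2ℓ w≤Dℓ))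
          (+-mono-≤ (*-monoʳ-≤ 21 w≤) (*-monoʳ-≤ 2 (*-mono-≤ L≤ w≤Dℓ))))
        (*-monoʳ-≤ W₀ (*-mono-≤ w≤Dℓ w≤Dℓ)))
      (≤-reflexive (collect D ℓ W₀))
      where
      w≤ : w ≤ D * ℓ * ℓ
      w≤ = ≤-trans w≤Dℓ (≤-trans (≤-reflexive (sym (*-identityʳ _))) (*-monoʳ-≤ (D * ℓ) ℓ≥1))
      collect : ∀ d l x → d * l * l + 2 * l * (d * l) + (21 * (d * l * l) + 2 * (12 * l * (d * l))) + x *
        (d * l * (d * l))
                ≡ (48 * d + x * (d * d)) * (l * (l * 1))
      collect = solve-∀

    -- The exponent 5 is one factor for the levels of the recursion and four for the work at a
    -- level. The 128 is 16 times 3 + 3 + 1 + 1.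
    time-bound : TM ≤ (128 * (W₀ * D ^ 4)) * ℓ ^ 5
    time-bound = ≤-trans (+-mono-≤ (+-mono-≤ blocks≤ blocks≤) (+-mono-≤ one one)) (≤-reflexive (collect D ℓ W₀))
      where
      unit : 16 * (W₀ * w ^ 4) ≤ 16 * (W₀ * (D * ℓ) ^ 4)
      unit = *-monoʳ-≤ 16 (*-monoʳ-≤ W₀ (ℕ.^-monoˡ-≤ 4 w≤Dℓ))
      blocks≤ : suc k * (16 * (W₀ * w ^ 4)) ≤ 3 * ℓ * (16 * (W₀ * (D * ℓ) ^ 4))
      blocks≤ = *-mono-≤ (+-mono-≤ ℓ≥1 k≤2ℓ) unit
      one : 16 * (W₀ * w ^ 4) ≤ ℓ * (16 * (W₀ * (D * ℓ) ^ 4))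
      one = ≤-trans unit (≤-trans (≤-reflexive (sym (*-identityˡ _))) (*-monoˡ-≤ _ ℓ≥1))
      collect : ∀ d l x →
        let u = 16 * (x * (d * l * (d * l * (d * l * (d * l * 1))))) in
        3 * l * u + 3 * l * u + (l * u + l * u) ≡ 128 * (x * (d * (d * (d * (d * 1))))) *
          (l * (l * (l * (l * (l * 1)))))
      collect = solve-∀

space-∈O : ∀ W₀ C → Bounds.SM W₀ C ∈O (λ n → ⌊log₂ n ⌋ ^ 2)
space-∈O W₀ C = 48 * (3 + 2 * suc C) + W₀ * ((3 + 2 * suc C) * (3 + 2 * suc C)) , 2 , Bounds.space-bound W₀ C

time-polylog : ∀ W₀ C → Polylog (Bounds.TM W₀ C)
time-polylog W₀ C = 5 , 128 * (W₀ * (3 + 2 * suc C) ^ 4) , 2 , Bounds.time-bound W₀ C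

-- Completeness and error probability

module Correct (V w L TM SM : ℕ) (w≡ : bits V ≡ w) (n p : ℕ) .{{_ : NonZero p}} (pr : Prime p) (p≤V : p ≤ V)
  (W₀ : ℕ) (W₀≥ : 1000 ≤ W₀) (n>0 : 0 < n) (N<V : 2 + 2 ^ ⌈log₂ n ⌉ ≤ V) (3≤V : 3 ≤ V)
  (k≤w : ⌈log₂ n ⌉ ≤ w) (L≥ : (2 + ⌈log₂ n ⌉) * 3 ≤ L)
  (TM≥ : suc ⌈log₂ n ⌉ * (16 * (W₀ * w ^ 4)) + suc ⌈log₂ n ⌉ * (16 * (W₀ * w ^ 4)) +
    (16 * (W₀ * w ^ 4) + 16 * (W₀ * w ^ 4)) ≤ TM)
  (SM≥ : w + ⌈log₂ n ⌉ * w + (21 * w + 2 * (L * w)) + W₀ * (w * w) ≤ SM)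
  (x : List Letter) (len : length x ≡ n) where

  k : ℕ
  k = ⌈log₂ n ⌉

  p≥2 : 2 ≤ p
  p≥2 = nonTrivial⇒n>1 p {{prime⇒nonTrivial pr}}

  τ : Tree k
  τ = build k x

  outcome : ℕ → Outcome
  outcome α = runMachine A.algorithm₃ (n ∷ p ∷ α ∷ Vec.replicate 18 0) x

  run₃≡ : ∀ α → A.run₃ p α x ≡ outcome α
  run₃≡ α = cong (λ m → runMachine A.algorithm₃ (m ∷ p ∷ α ∷ Vec.replicate 18 0) x) len

  Within : Config → Set
  Within = Limits.Within V w L TM SM w≡

  odd-run : n % 2 ≡ 1 → ∀ α → α < p → Sat (outcome α) (λ _ → ⊥) Within
  odd-run odd α α<p = WholeRun.odd-sound V w L TM SM w≡ n p α p≥2 α<p p≤V W₀ W₀≥ n>0 N<V 3≤V k≤w L≥ TM≥ SM≥ odd x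

  module _ (even : Even n) where

    fits : Fits k (length x)
    fits = subst (Fits k) (sym len) (fits-length n>0 even)

    yield≡ : yield τ ≡ map step x
    yield≡ = yield-build k x fits

    placed : Placed 0 n 0 τ
    placed = placed-build k x n 0 (trans len (sym (ℕ.m≤n⇒m⊓n≡m (n≤2^⌈log₂n⌉ n))))

    placed′ : Placed (2 ^ k ∸ n) (2 ^ k) 0 (mirror τ)
    placed′ = placed-mirror refl (ℕ.m+[n∸m]≡n (n≤2^⌈log₂n⌉ n)) (+-identityʳ (2 ^ k)) placed

    even-run : n % 2 ≢ 1 → ∀ α → α < p → Sat (outcome α) (λ σ → Accepts p α τ × Within σ)
      (λ σ → ¬ Accepts p α τ × Within σ)
    even-run ne α α<p = WholeRun.even-sound V w L TM SM w≡ n p α p≥2 α<p p≤V W₀ W₀≥ n>0 N<V 3≤V k≤w L≥ TM≥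
      SM≥ ne x τ placed placed′ (sym yield≡) (yield-mirror-build {k} {x} yield≡) len

  resources : ∀ α → α < p → spaceUsed p α x ≤ SM × timeUsed p α x ≤ TM
  resources α α<p = let t , s = subst (λ o → Within (final o)) (sym (run₃≡ α)) (within (n % 2 ℕ.≟ 1)) in s , t
    where
    within : Dec (n % 2 ≡ 1) → Within (final (outcome α))
    within (yes odd) = both (odd-run odd α α<p) ⊥-elim (λ r → r)
    within (no  ne)  = both (even-run (%2-even ne) ne α α<p) proj₂ proj₂

  even≢odd : Even n → n % 2 ≢ 1
  even≢odd (j , n≡) odd with trans (sym odd) (trans (cong (_% 2) n≡) (ℕ.m*n%n≡0 j 2))
  ... | ()

  complete : Dyck₂ x → Pr p (accepts p x) ≡ 1ℚ
  complete dyck = certain p (accepts p x) λ {α} α<p → subst (λ o → isRunning o ≡ true) (sym (run₃≡ α))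
    (never-rejecting (even-run even (even≢odd even) α α<p) (λ (¬acc , _) → ¬acc (acc α α<p)))
    where
    even : Even n
    even = subst Even len (dyck-even dyck)
    red : Red τ [] []
    red = dyck⇒red τ (sym (yield≡ even)) dyck
    acc : ∀ α α<p → Accepts p α τ
    acc α α<p = let D₁ , r₁ , z₁ = red-complete red
                    D₂ , r₂ , z₂ = red-complete (red-mirror red)
                in mkAccepts r₁ (All.map (λ {P} → vanish P) z₁) r₂ (All.map (λ {P} → vanish P) z₂)
      where
      vanish : ∀ P → P ≈ [] → Vanishes p α P
      vanish P z = subst (+ p ∣ℤ_) (sym (ev-zero (+ α) P z)) (ℤ.divides 0ℤ refl)

  same-run : ∀ {R : Result} {S T D E} → R ≡ just (S , D) → R ≡ just (T , E) → D ≡ E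
  same-run refl refl = refl

  -- All accepting α discard the same polynomials (`same-run`). Each of these has at most n + 1
  -- coefficients and vanishes at more than n residues, so it is null. With the lists of both passes
  -- null, `null⇒red` yields a reduction, and the empty stack after the first pass closes it.
  many-accepting⇒dyck : ∀ {xs} → Unique xs → All (λ α → α < p × accepts p x α ≡ true) xs → n < length xs → Dyck₂ x
  many-accepting⇒dyck {α₀ ∷ xs} uniq all@((α₀<p , acc₀) ∷ _) long = by-parity (n % 2 ℕ.≟ 1)
    where
    by-parity : Dec (n % 2 ≡ 1) → Dyck₂ x
    by-parity (yes odd) = ⊥-elim (satisfied (odd-run odd α₀ α₀<p) (subst (λ o → isRunning o ≡ true) (run₃≡ α₀) acc₀))
    by-parity (no ne)   = red⇒dyck τ (sym (yield≡ even)) (red-closed red (run₁ first′))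
      where
      open Accepts
      even : Even n
      even = %2-even ne
      acc : ∀ {α} (h : α < p × accepts p x α ≡ true) → Accepts p α τ
      acc {α} (α<p , h) = proj₁ (satisfied (even-run even ne α α<p) (subst (λ o → isRunning o ≡ true) (run₃≡ α) h))
      first′ : Accepts p α₀ τ
      first′ = acc (α₀<p , acc₀)
      null : ∀ {i} (υ : Tree i) {S D} → length (yield υ) ≡ n → srun υ 0 [] ≡ just (S , D) →
             All (λ α → All (Vanishes p α) D) (α₀ ∷ xs) → All (Null p) D
      null υ {D = D} eq r van = All.tabulate λ {P} P∈D →
        many-roots⇒null pr P (α₀ ∷ xs) uniq (All.map proj₁ all) (All.map (λ v → All.lookup v P∈D) van)
          (≤-trans (All.lookup (proj₂ (srun-short υ (≤-reflexive (cong suc eq)) [] r)) P∈D) long)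
      len₁ : length (yield τ) ≡ n
      len₁ = trans (cong length (yield≡ even)) (trans (List.length-map step x) len)
      len₂ : length (yield (mirror τ)) ≡ n
      len₂ = trans (cong length (yield-mirror τ)) (trans (List.length-map opposite (reverse (yield τ)))
        (trans (List.length-reverse (yield τ)) len₁))
      null₁ : All (Null p) (D₁ first′)
      null₁ = null τ len₁ (run₁ first′) (All.map (λ h → subst (All _) (same-run (run₁ (acc h)) (run₁ first′))
        (van₁ (acc h))) all)
      null₂ : All (Null p) (D₂ first′)
      null₂ = null (mirror τ) len₂ (run₂ first′) (All.map
        (λ h → subst (All _) (same-run (run₂ (acc h)) (run₂ first′)) (van₂ (acc h))) all)
      red : Red τ _ _
      red = proj₂ (proj₂ (null⇒red p≥2 τ [] [] (run₁ first′) (run₂ first′) null₁ null₂))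

  sound : ∀ c → n ^[1+ c ]≤ p → ¬ Dyck₂ x → (1ℚ - Pr p (rejects p x)) ≤ n ^- c
  sound c n≤p ¬dyck = subst (_≤ n ^- c) (sym (complement p (accepts p x)))
    (fraction-bound (length (filterᵇ (accepts p x) (upTo p))) n p c
      (ℕ.≮⇒≥ λ long → let u , all = accepting p (accepts p x) in ¬dyck (many-accepting⇒dyck u all long)) n≤p)

Correctness : (c : ℝ) (space time : ℕ → ℕ) → Set
Correctness c space time =
  ∀ (n p : ℕ) .{{_ : NonZero p}} → Prime p → n ^[1+ c ]≤ p → p <2* n ^[1+ c ] →
  ∀ (x : List Letter) → length x ≡ n →
  (∀ α → α < p → spaceUsed p α x ≤ space n × timeUsed p α x ≤ time n) ×
  (Dyck₂ x → Pr p (accepts p x) ≡ 1ℚ) ×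
  (¬ Dyck₂ x → (1ℚ - Pr p (rejects p x)) ≤ n ^- c)

correctness : ∀ W₀ → 1000 ≤ W₀ → ∀ c C → (∀ u v → u / suc v <ᴿ c → u ≤ C * suc v) →
              Correctness c (Bounds.SM W₀ C) (Bounds.TM W₀ C)
correctness W₀ W₀≥ c C ceil n p pr n≤p p< x len = K.resources , K.complete , K.sound c n≤p
  where
  module B = Bounds W₀ C n
  n>0 : 0 < n
  n>0 = proj₁ (prime-bound {n} {p} {c} {C} ceil p<)
  p≤V : p ≤ B.V
  p≤V = B.p≤V (proj₂ (prime-bound {n} {p} {c} {C} ceil p<))
  module K = Correct B.V B.w B.L B.TM B.SM B.w≡ n p pr p≤V W₀ W₀≥ n>0 B.N<V (<⇒≤ B.4≤V) B.k≤w ≤-refl B.TM≥ B.SM≥ x len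

theorem2 : (c : ℝ) → 1≤ c →
    ∃[ space ] ∃[ time ]
    (space ∈O (λ n → ⌊log₂ n ⌋ ^ 2)) ×
    Polylog time ×
    (∀ (n p : ℕ) .{{_ : NonZero p}} → Prime p → n ^[1+ c ]≤ p → p <2* n ^[1+ c ] →
    ∀ (x : List Letter) → length x ≡ n →
    (∀ α → α < p → spaceUsed p α x ≤ space n × timeUsed p α x ≤ time n) ×
    (Dyck₂ x → Pr p (accepts p x) ≡ 1ℚ) ×
    (¬ Dyck₂ x → (1ℚ - Pr p (rejects p x)) ≤ n ^- c))
theorem2 c _ =
  Bounds.SM 1000 (proj₁ (ceiling c)) , Bounds.TM 1000 (proj₁ (ceiling c)) ,
  space-∈O 1000 (proj₁ (ceiling c)) , time-polylog 1000 (proj₁ (ceiling c)) ,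
  correctness 1000 ≤-refl c (proj₁ (ceiling c)) (proj₂ (ceiling c))
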